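{- For every $k\in\mathbb{N}$ with $k\ge 2$ there exists a 3-connected cubic planar graph $G$ of circumference at least $2k$ such that $\mathcal{C}(G)\cap[2k,4k+1]=\emptyset$.
   Context: All graphs are finite and simple. The cycle spectrum $\mathcal{C}(G)$ is the set of lengths of cycles in $G$; the circumference of $G$ is the length of a longest cycle in $G$. For integers $a\le b$, $[a,b]$ denotes the set of integers $m$ with $a\le m\le b$. -}

module Defs where

open import Data.Nat as ℕ using (ℕ; zero; suc)
open import Data.Bool using (Bool; true; false; T; if_then_else_)
open import Data.Fin using (Fin; toℕ)
open import Data.List using (allFin; map)
open import Data.Nat.ListAction using (sum)
open import Data.Product using (Σ; ∃; _×_; _,_)
open import Data.Sum using (_⊎_)
open import Function.Definitions using (Injective)
open import Relation.Binary.PropositionalEquality using (_≡_; _≢_)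
open import Relation.Nullary using (¬_)
open import Data.Rational as ℚ using (ℚ; 0ℚ; 1ℚ)

record Graph (n : ℕ) : Set where
  field
    adj    : Fin n → Fin n → Bool
    sym    : ∀ u v → adj u v ≡ adj v u
    irrefl : ∀ u → adj u u ≡ false

open Graph public

Adj : ∀ {n} → Graph n → Fin n → Fin n → Set
Adj G u v = T (adj G u v)

degree : ∀ {n} → Graph n → Fin n → ℕ
degree {n} G v = sum (map (λ w → if adj G v w then 1 else 0) (allFin n))

Cubic : ∀ {n} → Graph n → Set
Cubic {n} G = ∀ (v : Fin n) → degree G v ≡ 3

HasCycle : ∀ {n} → Graph n → ℕ → Set
HasCycle {n} G m =
  Σ (Fin m → Fin n) λ c →
    3 ℕ.≤ m
    × Injective _≡_ _≡_ c
    × (∀ (i j : Fin m) → suc (toℕ i) ≡ toℕ j → Adj G (c i) (c j))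
    × (∀ (i j : Fin m) → toℕ i ≡ 0 → suc (toℕ j) ≡ m → Adj G (c j) (c i))

_∈𝒞_ : ℕ → ∀ {n} → Graph n → Set
m ∈𝒞 G = HasCycle G m

CircumferenceAtLeast : ∀ {n} → Graph n → ℕ → Set
CircumferenceAtLeast G c = ∃ λ m → c ℕ.≤ m × HasCycle G m

data PathIn {n} (G : Graph n) (ok : Fin n → Set) : Fin n → Fin n → Set where
  here : ∀ {u} → ok u → PathIn G ok u u
  step : ∀ {u w v} → ok u → Adj G u w → PathIn G ok w v → PathIn G ok u v

-- 3-connected: more than 3 vertices, and deleting any set {a,b} of at most
-- two vertices (a = b allowed) leaves a connected graph.
ThreeConnected : ∀ {n} → Graph n → Set
ThreeConnected {n} G =
  3 ℕ.< n ×
  (∀ (a b u v : Fin n) → u ≢ a → u ≢ b → v ≢ a → v ≢ b →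
     PathIn G (λ x → x ≢ a × x ≢ b) u v)

-- Planarity, via plane straight-line drawings with rational coordinates
-- (equivalent to topological planarity by Fáry's theorem).
Point : Set
Point = ℚ × ℚ

lerp : Point → Point → ℚ → Point
lerp (x₁ , y₁) (x₂ , y₂) s = (x₁ ℚ.+ s ℚ.* (x₂ ℚ.- x₁)) , (y₁ ℚ.+ s ℚ.* (y₂ ℚ.- y₁))

InUnit : ℚ → Set
InUnit s = 0ℚ ℚ.≤ s × s ℚ.≤ 1ℚ

IsPlaneDrawing : ∀ {n} → Graph n → (Fin n → Point) → Set
IsPlaneDrawing {n} G pos =
  Injective _≡_ _≡_ pos
  × (∀ (x a b : Fin n) → Adj G a b → x ≢ a → x ≢ b →
       ∀ s → InUnit s → lerp (pos a) (pos b) s ≢ pos x)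
  × (∀ (a b c d : Fin n) → Adj G a b → Adj G c d →
       ¬ (a ≡ c × b ≡ d) → ¬ (a ≡ d × b ≡ c) →
       ∀ s t → InUnit s → InUnit t →
       lerp (pos a) (pos b) s ≡ lerp (pos c) (pos d) t →
       ∃ λ x → (x ≡ a ⊎ x ≡ b) × (x ≡ c ⊎ x ≡ d) ×
               lerp (pos a) (pos b) s ≡ pos x)

Planar : ∀ {n} → Graph n → Set
Planar {n} G = Σ (Fin n → Point) λ pos → IsPlaneDrawing G pos

{-# OPTIONS --safe #-}
module Submission where

-- The graph is a generalised dodecahedron (two n-gons and 2n pentagons, n = 2k + 1) whose vertices
-- are blown up.  In the dodecahedron three rings, of n, 2n and n vertices, are joined by 2n spokes;
-- every vertex is replaced by a fragment, a ladder of k − 1 rungs whose last rung lies on the ring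
-- and whose other end is closed by an apex, which is attached to the spoke.  A fragment has 2k − 1
-- vertices, so cycles inside one fragment are too short.  A cycle using a spoke passes through all
-- 2k levels between its two rings at least twice and needs two further vertices beyond one of them,
-- hence has at least 4k + 2 vertices.  A cycle that leaves a fragment but uses no spoke runs around
-- a whole ring, hence has at least 2n = 4k + 2 vertices.
--
-- The two fragments of a spoke form a bone.  The bones are numbered cyclically by Fin (2n), those of
-- even and odd number attached to opposite n-gons; consecutive bones are neighbours on the middle
-- ring, bones at distance two are neighbours on a pole ring.

open import Defs
open import Data.Bool using (Bool; true; false; T; not; if_then_else_; _∨_; _∧_)
import Data.Bool.Properties as Bool
open import Data.Empty using (⊥; ⊥-elim)
open import Data.Fin as Fin using (Fin; zero; suc; toℕ; fromℕ; fromℕ<; inject₁; combine; remQuot)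
open import Data.Fin.Induction using (<-weakInduction; >-weakInduction)
open import Data.Fin.Patterns
import Data.Fin.Properties as Fin
open import Data.Fin.Relation.Unary.Top using (View; view; ‵fromℕ; ‵inject₁; view-fromℕ; view-inject₁)
import Data.Integer as ℤ
import Data.Integer.Properties as ℤ
open import Data.List using (map; allFin; tabulate)
open import Data.List.Properties using (map-tabulate; map-cong; tabulate-cong)
open import Data.Nat as ℕ using (ℕ; zero; suc; _+_; _∸_; _*_; _≤_; _<_; NonZero; z≤n; s≤s; ⌊_/2⌋)
import Data.Nat.Coprimality as Coprime
open import Data.Nat.DivMod using (_%_; _/_; m%n<n; m<n⇒m%n≡m; %-distribˡ-+; m%n%n≡m%n; n%n≡0; [m+n]%n≡m%n; m≡m%n+[m/n]*n)
open import Data.Nat.ListAction using (sum)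
import Data.Nat.Properties as ℕ
open import Data.Nat.Tactic.RingSolver using (solve-∀)
open import Data.Product using (Σ; _×_; _,_; proj₁; proj₂)
open import Data.Product.Function.NonDependent.Propositional using (_×-↔_)
open import Data.Rational as ℚ using (ℚ; mkℚ; 0ℚ; 1ℚ; *≤*; *<*)
import Data.Rational.Properties as ℚ
open import Data.Rational.Solver using (module +-*-Solver)
import Data.Rational.Unnormalised as ℚᵘ
import Data.Rational.Unnormalised.Properties as ℚᵘ
open import Data.Sum using (_⊎_; inj₁; inj₂; swap; map₂)
open import Data.Sum.Function.Propositional using (_⊎-↔_)
open import Data.Unit using (tt)
open import Function using (_∘_; id; Equivalence; mk⇔; _⇔_; _↔_; mk↔ₛ′; Inverse)
open import Function.Construct.Composition using (_↔-∘_)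
open import Function.Construct.Identity using (↔-id)
open import Function.Construct.Symmetry using (↔-sym)
open import Relation.Binary.Definitions using (tri<; tri≈; tri>)
open import Relation.Binary.PropositionalEquality using (_≡_; _≢_; refl; trans; cong; cong₂; subst; subst₂; module ≡-Reasoning) renaming (sym to ≡-sym)
open import Relation.Nullary using (¬_; Dec; yes; no; contradiction; _×-dec_; _⊎-dec_)
open import Relation.Nullary.Decidable using (isYes)

-- Cubic graphs given by three neighbour functions

-- Three edges leave a fragment: its spoke and two ring edges. A cycle that crosses this cut crosses
-- it again, so a cycle through a spoke must use a ring edge at each of its two fragments, and a
-- cycle through a ring edge but no spoke must go on to the next ring edge. This forces the two
-- kinds of long cycle. For 3-connectivity, every vertex has three disjoint routes to three
-- different bones, and two deleted vertices spoil at most two of them; among the undamaged bones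
-- the pole rings jump over a damaged one. Planarity asks for explicit coordinates for every k. The
-- cyclic order of the bones is cut open before bone 0 and the bones are stacked on an integer grid.
-- There all edges but three stay within adjacent rows and columns, so that they are disjoint as
-- soon as they keep the order of the columns between two rows. The three ring edges running through
-- the cut become long segments, two of them on the convex hull and the third on it but for one
-- vertex.

indicator : Bool → ℕ
indicator b = if b then 1 else 0

sum-tabulate-+ : ∀ {n} (f g : Fin n → ℕ) →
  sum (tabulate (λ i → f i + g i)) ≡ sum (tabulate f) + sum (tabulate g)
sum-tabulate-+ {zero}  f g = refl
sum-tabulate-+ {suc n} f g = begin
  f zero + g zero + sum (tabulate (λ i → f (suc i) + g (suc i)))
    ≡⟨ cong (f zero + g zero +_) (sum-tabulate-+ (f ∘ suc) (g ∘ suc)) ⟩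
  f zero + g zero + (sum (tabulate (f ∘ suc)) + sum (tabulate (g ∘ suc)))
    ≡⟨ ℕ.+-assoc (f zero) (g zero) _ ⟩
  f zero + (g zero + (sum (tabulate (f ∘ suc)) + sum (tabulate (g ∘ suc))))
    ≡⟨ cong (f zero +_) (x+[y+z]≡y+[x+z] (g zero) (sum (tabulate (f ∘ suc))) _) ⟩
  f zero + (sum (tabulate (f ∘ suc)) + (g zero + sum (tabulate (g ∘ suc))))
    ≡⟨ ℕ.+-assoc (f zero) _ _ ⟨
  f zero + sum (tabulate (f ∘ suc)) + (g zero + sum (tabulate (g ∘ suc))) ∎
  where
  open ≡-Reasoning
  x+[y+z]≡y+[x+z] : ∀ x y z → x + (y + z) ≡ y + (x + z)
  x+[y+z]≡y+[x+z] x y z = trans (≡-sym (ℕ.+-assoc x y z)) (trans (cong (_+ z) (ℕ.+-comm x y)) (ℕ.+-assoc y x z))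

sum-zero : ∀ {n} (f : Fin n → ℕ) → (∀ i → f i ≡ 0) → sum (tabulate f) ≡ 0
sum-zero {zero}  f f≡0 = refl
sum-zero {suc n} f f≡0 = cong₂ _+_ (f≡0 zero) (sum-zero (f ∘ suc) (f≡0 ∘ suc))

sum-indicator-≟ : ∀ {n} (a : Fin n) → sum (tabulate (λ i → indicator (isYes (i Fin.≟ a)))) ≡ 1
sum-indicator-≟ {suc n} zero = cong suc (sum-zero {n} (λ _ → 0) (λ _ → refl))
sum-indicator-≟ (suc a) = trans (cong sum (tabulate-cong same)) (sum-indicator-≟ a)
  where
  same : ∀ i → indicator (isYes (suc i Fin.≟ suc a)) ≡ indicator (isYes (i Fin.≟ a))
  same i with i Fin.≟ a
  ... | yes _ = refl
  ... | no  _ = refl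

indicator-∨ : ∀ {p} {P Q R : Set p} (P? : Dec P) (Q? : Dec Q) (R? : Dec R) →
  ¬ (P × Q) → ¬ (P × R) → ¬ (Q × R) →
  indicator (isYes P? ∨ isYes Q? ∨ isYes R?) ≡
  indicator (isYes P?) + (indicator (isYes Q?) + indicator (isYes R?))
indicator-∨ (yes p) (yes q) R?      ¬pq ¬pr ¬qr = contradiction (p , q) ¬pq
indicator-∨ (yes p) (no _)  (yes r) ¬pq ¬pr ¬qr = contradiction (p , r) ¬pr
indicator-∨ (yes p) (no _)  (no _)  ¬pq ¬pr ¬qr = refl
indicator-∨ (no _)  (yes q) (yes r) ¬pq ¬pr ¬qr = contradiction (q , r) ¬qr
indicator-∨ (no _)  (yes q) (no _)  ¬pq ¬pr ¬qr = refl
indicator-∨ (no _)  (no _)  (yes r) ¬pq ¬pr ¬qr = refl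
indicator-∨ (no _)  (no _)  (no _)  ¬pq ¬pr ¬qr = refl

T-isYes∨ : ∀ {p} {P Q R : Set p} (P? : Dec P) (Q? : Dec Q) (R? : Dec R) →
  T (isYes P? ∨ isYes Q? ∨ isYes R?) ⇔ (P ⊎ Q ⊎ R)
T-isYes∨ (yes p) Q?      R?      = mk⇔ (λ _ → inj₁ p) (λ _ → tt)
T-isYes∨ (no ¬p) (yes q) R?      = mk⇔ (λ _ → inj₂ (inj₁ q)) (λ _ → tt)
T-isYes∨ (no ¬p) (no ¬q) (yes r) = mk⇔ (λ _ → inj₂ (inj₂ r)) (λ _ → tt)
T-isYes∨ (no ¬p) (no ¬q) (no ¬r) = mk⇔ (λ ()) λ where
  (inj₁ p) → ¬p p
  (inj₂ (inj₁ q)) → ¬q q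
  (inj₂ (inj₂ r)) → ¬r r

T-injective : ∀ {b c} → (T b → T c) → (T c → T b) → b ≡ c
T-injective {false} {false} f g = refl
T-injective {false} {true}  f g = ⊥-elim (g tt)
T-injective {true}  {false} f g = ⊥-elim (f tt)
T-injective {true}  {true}  f g = refl

¬T⇒false : ∀ {b} → ¬ T b → b ≡ false
¬T⇒false {false} _ = refl
¬T⇒false {true}  f = ⊥-elim (f tt)

module CubicGraph {V : Set} {N : ℕ} (V↔Fin : V ↔ Fin N) (nb₀ nb₁ nb₂ : V → V) where

  open Inverse V↔Fin using () renaming (to to enc; from to dec; strictlyInverseˡ to enc∘dec; strictlyInverseʳ to dec∘enc) public

  Nb : V → V → Set
  Nb u v = v ≡ nb₀ u ⊎ v ≡ nb₁ u ⊎ v ≡ nb₂ u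

  private
    enc-injective : ∀ {u v} → enc u ≡ enc v → u ≡ v
    enc-injective {u} {v} eq = trans (≡-sym (dec∘enc u)) (trans (cong dec eq) (dec∘enc v))

    joined : Fin N → Fin N → Bool
    joined i j = isYes (j Fin.≟ enc (nb₀ (dec i))) ∨ isYes (j Fin.≟ enc (nb₁ (dec i))) ∨ isYes (j Fin.≟ enc (nb₂ (dec i)))

    ≡enc⇒dec≡ : ∀ {j v} → j ≡ enc v → dec j ≡ v
    ≡enc⇒dec≡ {v = v} refl = dec∘enc v

    dec≡⇒≡enc : ∀ {j v} → dec j ≡ v → j ≡ enc v
    dec≡⇒≡enc {j} refl = ≡-sym (enc∘dec j)

    joined⇒Nb : ∀ i j → T (joined i j) → Nb (dec i) (dec j)
    joined⇒Nb i j t with Equivalence.to (T-isYes∨ (j Fin.≟ _) (j Fin.≟ _) (j Fin.≟ _)) t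
    ... | inj₁ eq = inj₁ (≡enc⇒dec≡ eq)
    ... | inj₂ (inj₁ eq) = inj₂ (inj₁ (≡enc⇒dec≡ eq))
    ... | inj₂ (inj₂ eq) = inj₂ (inj₂ (≡enc⇒dec≡ eq))

    Nb⇒joined : ∀ i j → Nb (dec i) (dec j) → T (joined i j)
    Nb⇒joined i j nb = Equivalence.from (T-isYes∨ (j Fin.≟ _) (j Fin.≟ _) (j Fin.≟ _)) (to-enc nb)
      where
      to-enc : Nb (dec i) (dec j) → _
      to-enc (inj₁ eq) = inj₁ (dec≡⇒≡enc eq)
      to-enc (inj₂ (inj₁ eq)) = inj₂ (inj₁ (dec≡⇒≡enc eq))
      to-enc (inj₂ (inj₂ eq)) = inj₂ (inj₂ (dec≡⇒≡enc eq))

  module _ (Nb-sym : ∀ {u v} → Nb u v → Nb v u) (Nb-irrefl : ∀ {u} → ¬ Nb u u) where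

    graph : Graph N
    graph .adj = joined
    graph .Graph.sym i j = T-injective
      (λ t → Nb⇒joined j i (Nb-sym (joined⇒Nb i j t)))
      (λ t → Nb⇒joined i j (Nb-sym (joined⇒Nb j i t)))
    graph .irrefl i = ¬T⇒false (λ t → Nb-irrefl (joined⇒Nb i i t))

    Adj⇒Nb : ∀ {i j} → Adj graph i j → Nb (dec i) (dec j)
    Adj⇒Nb {i} {j} = joined⇒Nb i j

    Nb⇒Adj : ∀ {i j} → Nb (dec i) (dec j) → Adj graph i j
    Nb⇒Adj {i} {j} = Nb⇒joined i j

    -- A row of the adjacency matrix is a sum of three point indicators, because the numbering is
    -- injective and the three neighbours are distinct.
    cubic : (∀ v → nb₀ v ≢ nb₁ v) → (∀ v → nb₀ v ≢ nb₂ v) → (∀ v → nb₁ v ≢ nb₂ v) → Cubic graph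
    cubic 0≢1 0≢2 1≢2 i = begin
      sum (map (λ j → indicator (joined i j)) (allFin N))
        ≡⟨ cong sum (map-cong split (allFin N)) ⟩
      sum (map (λ j → δ a j + (δ b j + δ c j)) (allFin N))
        ≡⟨ cong sum (map-tabulate {n = N} id (λ j → δ a j + (δ b j + δ c j))) ⟩
      sum (tabulate (λ j → δ a j + (δ b j + δ c j)))
        ≡⟨ sum-tabulate-+ (δ a) _ ⟩
      sum (tabulate (δ a)) + sum (tabulate (λ j → δ b j + δ c j))
        ≡⟨ cong₂ _+_ (sum-indicator-≟ a) (sum-tabulate-+ (δ b) (δ c)) ⟩
      1 + (sum (tabulate (δ b)) + sum (tabulate (δ c)))
        ≡⟨ cong suc (cong₂ _+_ (sum-indicator-≟ b) (sum-indicator-≟ c)) ⟩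
      3 ∎
      where
      open ≡-Reasoning
      a b c : Fin N
      a = enc (nb₀ (dec i))
      b = enc (nb₁ (dec i))
      c = enc (nb₂ (dec i))
      δ : Fin N → Fin N → ℕ
      δ d j = indicator (isYes (j Fin.≟ d))
      differ : ∀ {u v} → u ≢ v → ∀ {j} → ¬ (j ≡ enc u × j ≡ enc v)
      differ u≢v (refl , eq) = u≢v (enc-injective eq)
      split : ∀ j → indicator (joined i j) ≡ δ a j + (δ b j + δ c j)
      split j = indicator-∨ (j Fin.≟ a) (j Fin.≟ b) (j Fin.≟ c)
        (differ (0≢1 _)) (differ (0≢2 _)) (differ (1≢2 _))

-- The graph of bones

module Rotation (P : ℕ) .{{_ : NonZero P}} where

  -- A rotation backwards by `t` is written `rot (P ∸ t)`, so that addition modulo `P` suffices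
  -- throughout.
  rot : ℕ → Fin P → Fin P
  rot t q = fromℕ< (m%n<n (toℕ q + t) P)

  toℕ-rot : ∀ t q → toℕ (rot t q) ≡ (toℕ q + t) % P
  toℕ-rot t q = Fin.toℕ-fromℕ< (m%n<n (toℕ q + t) P)

  toℕ% : ∀ (q : Fin P) → toℕ q % P ≡ toℕ q
  toℕ% q = m<n⇒m%n≡m (Fin.toℕ<n q)

  rot-0 : ∀ q → rot 0 q ≡ q
  rot-0 q = Fin.toℕ-injective (trans (toℕ-rot 0 q) (trans (cong (_% P) (ℕ.+-identityʳ (toℕ q))) (toℕ% q)))

  rot-P : ∀ q → rot P q ≡ q
  rot-P q = Fin.toℕ-injective (trans (toℕ-rot P q) (trans ([m+n]%n≡m%n (toℕ q) P) (toℕ% q)))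

  [m%P+t]%P≡[m+t]%P : ∀ m t → (m % P + t) % P ≡ (m + t) % P
  [m%P+t]%P≡[m+t]%P m t = begin
    (m % P + t) % P           ≡⟨ %-distribˡ-+ (m % P) t P ⟩
    (m % P % P + t % P) % P   ≡⟨ cong (λ z → (z + t % P) % P) (m%n%n≡m%n m P) ⟩
    (m % P + t % P) % P       ≡⟨ %-distribˡ-+ m t P ⟨
    (m + t) % P               ∎
    where open ≡-Reasoning

  rot-rot : ∀ s t q → rot s (rot t q) ≡ rot (t + s) q
  rot-rot s t q = Fin.toℕ-injective (begin
    toℕ (rot s (rot t q))      ≡⟨ toℕ-rot s (rot t q) ⟩
    (toℕ (rot t q) + s) % P    ≡⟨ cong (λ z → (z + s) % P) (toℕ-rot t q) ⟩
    ((toℕ q + t) % P + s) % P  ≡⟨ [m%P+t]%P≡[m+t]%P (toℕ q + t) s ⟩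
    (toℕ q + t + s) % P        ≡⟨ cong (_% P) (ℕ.+-assoc (toℕ q) t s) ⟩
    (toℕ q + (t + s)) % P      ≡⟨ toℕ-rot (t + s) q ⟨
    toℕ (rot (t + s) q)        ∎)
    where open ≡-Reasoning

  rot-cancel : ∀ {s t} → s + t ≡ P → ∀ q → rot t (rot s q) ≡ q
  rot-cancel {s} {t} eq q = trans (rot-rot t s q) (trans (cong (λ z → rot z q) eq) (rot-P q))

  rot-injective : ∀ t {q q'} → t ≤ P → rot t q ≡ rot t q' → q ≡ q'
  rot-injective t {q} {q'} t≤P eq =
    trans (≡-sym (rot-cancel (ℕ.m+[n∸m]≡n t≤P) q)) (trans (cong (rot (P ∸ t)) eq) (rot-cancel (ℕ.m+[n∸m]≡n t≤P) q'))

  rot-reaches : ∀ q q' → Σ ℕ λ t → t < P × rot t q ≡ q'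
  rot-reaches q q' = t % P , m%n<n t P , Fin.toℕ-injective (begin
      toℕ (rot (t % P) q)            ≡⟨ toℕ-rot (t % P) q ⟩
      (toℕ q + t % P) % P            ≡⟨ cong (_% P) (ℕ.+-comm (toℕ q) (t % P)) ⟩
      (t % P + toℕ q) % P            ≡⟨ [m%P+t]%P≡[m+t]%P t (toℕ q) ⟩
      (toℕ q' + (P ∸ toℕ q) + toℕ q) % P
        ≡⟨ cong (_% P) (ℕ.+-assoc (toℕ q') (P ∸ toℕ q) (toℕ q)) ⟩
      (toℕ q' + (P ∸ toℕ q + toℕ q)) % P
        ≡⟨ cong (λ z → (toℕ q' + z) % P) (ℕ.m∸n+n≡m (ℕ.<⇒≤ (Fin.toℕ<n q))) ⟩
      (toℕ q' + P) % P               ≡⟨ [m+n]%n≡m%n (toℕ q') P ⟩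
      toℕ q' % P                     ≡⟨ toℕ% q' ⟩
      toℕ q'                         ∎)
    where
    open ≡-Reasoning
    t : ℕ
    t = toℕ q' + (P ∸ toℕ q)

  -- The amount of rotation is recovered from its result by adding `P ∸ toℕ q` modulo `P`.
  rot-<-injective : ∀ {s t} q → s < P → t < P → rot s q ≡ rot t q → s ≡ t
  rot-<-injective {s} {t} q s<P t<P eq = trans (≡-sym (unrot s<P)) (trans (cong back eq) (unrot t<P))
    where
    open ≡-Reasoning
    back : Fin P → ℕ
    back q' = (toℕ q' + (P ∸ toℕ q)) % P
    unrot : ∀ {s} → s < P → back (rot s q) ≡ s
    unrot {s} s<P = begin
      (toℕ (rot s q) + (P ∸ toℕ q)) % P      ≡⟨ cong (λ z → (z + (P ∸ toℕ q)) % P) (toℕ-rot s q) ⟩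
      ((toℕ q + s) % P + (P ∸ toℕ q)) % P    ≡⟨ [m%P+t]%P≡[m+t]%P (toℕ q + s) (P ∸ toℕ q) ⟩
      (toℕ q + s + (P ∸ toℕ q)) % P          ≡⟨ cong (λ z → (z + (P ∸ toℕ q)) % P) (ℕ.+-comm (toℕ q) s) ⟩
      (s + toℕ q + (P ∸ toℕ q)) % P          ≡⟨ cong (_% P) (ℕ.+-assoc s (toℕ q) (P ∸ toℕ q)) ⟩
      (s + (toℕ q + (P ∸ toℕ q))) % P        ≡⟨ cong (λ z → (s + z) % P) (ℕ.m+[n∸m]≡n (ℕ.<⇒≤ (Fin.toℕ<n q))) ⟩
      (s + P) % P                            ≡⟨ [m+n]%n≡m%n s P ⟩
      s % P                                  ≡⟨ m<n⇒m%n≡m s<P ⟩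
      s                                      ∎

  toℕ-rot-< : ∀ t q → toℕ q + t < P → toℕ (rot t q) ≡ toℕ q + t
  toℕ-rot-< t q lt = trans (toℕ-rot t q) (m<n⇒m%n≡m lt)

  toℕ-rot-wrap : ∀ t r q → r < P → toℕ q + t ≡ r + P → toℕ (rot t q) ≡ r
  toℕ-rot-wrap t r q r<P eq =
    trans (toℕ-rot t q) (trans (cong (_% P) eq) (trans ([m+n]%n≡m%n r P) (m<n⇒m%n≡m r<P)))

odd : ℕ → Bool
odd zero    = false
odd (suc n) = not (odd n)

odd-double : ∀ n → odd (2 * n) ≡ false
odd-double zero    = refl
odd-double (suc n) = begin
  not (odd (n + (suc n + 0)))  ≡⟨ cong (not ∘ odd) (ℕ.+-suc n (n + 0)) ⟩
  not (not (odd (2 * n)))      ≡⟨ Bool.not-involutive _ ⟩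
  odd (2 * n)                  ≡⟨ odd-double n ⟩
  false                        ∎
  where open ≡-Reasoning

pattern mid  = false
pattern pole = true
pattern lo   = false
pattern up   = true

module Bones (κ n : ℕ) (2<n : 2 < n) where

  P : ℕ
  P = 2 * n

  instance
    P-nonZero : NonZero P
    P-nonZero = ℕ.>-nonZero (ℕ.<-≤-trans (s≤s z≤n) (ℕ.≤-trans 2<n (ℕ.m≤m+n n (n + 0))))

  5<P : 5 < P
  5<P = ℕ.*-monoʳ-≤ 2 2<n

  open Rotation P public

  parity : Fin P → Bool
  parity q = odd (toℕ q)

  -- `P` is even, so even the step from the last bone to bone 0 changes the parity.
  parity-rot-1 : ∀ q → parity (rot 1 q) ≡ not (parity q)
  parity-rot-1 q with ℕ.m≤n⇒m<n∨m≡n (Fin.toℕ<n q)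
  ... | inj₁ 1+q<P = cong odd (trans (toℕ-rot-< 1 q (subst (_< P) (ℕ.+-comm 1 _) 1+q<P)) (ℕ.+-comm _ 1))
  ... | inj₂ 1+q≡P = trans (cong odd (toℕ-rot-wrap 1 0 q (ℕ.<-≤-trans (s≤s z≤n) 5<P) (trans (ℕ.+-comm _ 1) 1+q≡P)))
                           (≡-sym (trans (cong odd 1+q≡P) (odd-double n)))

  parity-rot-2 : ∀ q → parity (rot 2 q) ≡ parity q
  parity-rot-2 q = trans (cong parity (≡-sym (rot-rot 1 1 q)))
    (trans (parity-rot-1 (rot 1 q)) (trans (cong not (parity-rot-1 q)) (Bool.not-involutive _)))

  K : ℕ
  K = suc κ

  -- rail s j is an end of the rung number j, counted from the apex.
  data Frag : Set where
    apex : Frag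
    rail : Bool → Fin K → Frag

  record V : Set where
    constructor vert
    field
      bone : Fin P
      half : Bool
      frag : Frag
  open V public

  top : Fin K
  top = fromℕ κ

  stride : Bool → ℕ
  stride mid  = 1
  stride pole = 2

  stride≤P : ∀ h → stride h ≤ P
  stride≤P mid  = ℕ.≤-trans (s≤s z≤n) 5<P
  stride≤P pole = ℕ.≤-trans (s≤s (s≤s z≤n)) 5<P

  across : Fin P → Bool → Bool → V
  across q h up = vert (rot (stride h) q) h (rail lo top)
  across q h lo = vert (rot (P ∸ stride h) q) h (rail up top)

  outward : Fin P → Bool → Bool → {j : Fin K} → View j → V
  outward q h s ‵fromℕ       = across q h s
  outward q h s (‵inject₁ i) = vert q h (rail s (suc i))

  nb₀ nb₁ nb₂ : V → V
  nb₀ (vert q h apex)             = vert q (not h) apex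
  nb₀ (vert q h (rail s j))       = vert q h (rail (not s) j)
  nb₁ (vert q h apex)             = vert q h (rail lo zero)
  nb₁ (vert q h (rail s zero))    = vert q h apex
  nb₁ (vert q h (rail s (suc i))) = vert q h (rail s (inject₁ i))
  nb₂ (vert q h apex)             = vert q h (rail up zero)
  nb₂ (vert q h (rail s j))       = outward q h s (view j)

  Nb : V → V → Set
  Nb u v = v ≡ nb₀ u ⊎ v ≡ nb₁ u ⊎ v ≡ nb₂ u

  -- Each edge occurs once and in one direction, which suits case analysis; the functions above
  -- describe the same graph in the form that suits counting degrees.
  data E : V → V → Set where
    spine : ∀ q → E (vert q mid apex) (vert q pole apex)
    foot  : ∀ q h s → E (vert q h apex) (vert q h (rail s zero))
    rung  : ∀ q h j → E (vert q h (rail lo j)) (vert q h (rail up j))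
    rail  : ∀ q h s (i : Fin κ) → E (vert q h (rail s (inject₁ i))) (vert q h (rail s (suc i)))
    ring  : ∀ q h → E (vert q h (rail up top)) (vert (rot (stride h) q) h (rail lo top))

  _~_ : V → V → Set
  u ~ v = E u v ⊎ E v u

  ~-sym : ∀ {u v} → u ~ v → v ~ u
  ~-sym (inj₁ e) = inj₂ e
  ~-sym (inj₂ e) = inj₁ e

  E⇒Nb : ∀ {u v} → E u v → Nb u v
  E⇒Nb (spine q)       = inj₁ refl
  E⇒Nb (foot q h lo)   = inj₂ (inj₁ refl)
  E⇒Nb (foot q h up)   = inj₂ (inj₂ refl)
  E⇒Nb (rung q h j)    = inj₁ refl
  E⇒Nb (rail q h s i)  = inj₂ (inj₂ (cong (outward q h s) (≡-sym (view-inject₁ i))))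
  E⇒Nb (ring q h)      = inj₂ (inj₂ (cong (outward q h up) (≡-sym (view-fromℕ κ))))

  E⇒Nb˘ : ∀ {u v} → E u v → Nb v u
  E⇒Nb˘ (spine q)      = inj₁ refl
  E⇒Nb˘ (foot q h s)   = inj₂ (inj₁ refl)
  E⇒Nb˘ (rung q h j)   = inj₁ refl
  E⇒Nb˘ (rail q h s i) = inj₂ (inj₁ refl)
  E⇒Nb˘ (ring q h)     = inj₂ (inj₂ (trans
    (cong (λ z → vert z h (rail up top)) (≡-sym (rot-cancel (ℕ.m+[n∸m]≡n (stride≤P h)) q)))
    (cong (outward (rot (stride h) q) h lo) (≡-sym (view-fromℕ κ)))))

  ~⇒Nb : ∀ {u v} → u ~ v → Nb u v
  ~⇒Nb (inj₁ e) = E⇒Nb e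
  ~⇒Nb (inj₂ e) = E⇒Nb˘ e

  ~across : ∀ q h s → vert q h (rail s top) ~ across q h s
  ~across q h up = inj₁ (ring q h)
  ~across q h lo = inj₂ (subst (λ z → E (vert (rot (P ∸ stride h) q) h (rail up top)) (vert z h (rail lo top)))
    (rot-cancel (ℕ.m∸n+n≡m (stride≤P h)) q) (ring (rot (P ∸ stride h) q) h))

  ~nb₀ : ∀ v → v ~ nb₀ v
  ~nb₀ (vert q mid apex)       = inj₁ (spine q)
  ~nb₀ (vert q pole apex)      = inj₂ (spine q)
  ~nb₀ (vert q h (rail lo j))  = inj₁ (rung q h j)
  ~nb₀ (vert q h (rail up j))  = inj₂ (rung q h j)

  ~nb₁ : ∀ v → v ~ nb₁ v
  ~nb₁ (vert q h apex)             = inj₁ (foot q h lo)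
  ~nb₁ (vert q h (rail s zero))    = inj₂ (foot q h s)
  ~nb₁ (vert q h (rail s (suc i))) = inj₂ (rail q h s i)

  ~nb₂ : ∀ v → v ~ nb₂ v
  ~nb₂ (vert q h apex) = inj₁ (foot q h up)
  ~nb₂ (vert q h (rail s j)) with view j
  ... | ‵fromℕ     = ~across q h s
  ... | ‵inject₁ i = inj₁ (rail q h s i)

  Nb⇒~ : ∀ {u v} → Nb u v → u ~ v
  Nb⇒~ {u} (inj₁ refl)        = ~nb₀ u
  Nb⇒~ {u} (inj₂ (inj₁ refl)) = ~nb₁ u
  Nb⇒~ {u} (inj₂ (inj₂ refl)) = ~nb₂ u

  rot-stride≢ : ∀ h q → rot (stride h) q ≢ q
  rot-stride≢ mid q eq with () ← rot-<-injective {1} {0} q (ℕ.≤-trans (s≤s (s≤s z≤n)) 5<P) (ℕ.≤-trans (s≤s z≤n) 5<P) (trans eq (≡-sym (rot-0 q)))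
  rot-stride≢ pole q eq with () ← rot-<-injective {2} {0} q (ℕ.≤-trans (s≤s (s≤s (s≤s z≤n))) 5<P) (ℕ.≤-trans (s≤s z≤n) 5<P) (trans eq (≡-sym (rot-0 q)))

  E-irrefl : ∀ {u v} → E u v → u ≢ v
  E-irrefl (rail q h s i) eq = ℕ.m≢1+m+n (toℕ i) (trans (≡-sym (Fin.toℕ-inject₁ i)) (trans (cong (index ∘ frag) eq) (cong suc (≡-sym (ℕ.+-identityʳ _)))))
    where
    index : Frag → ℕ
    index apex       = 0
    index (rail _ j) = toℕ j

  ~-irrefl : ∀ {u v} → u ~ v → u ≢ v
  ~-irrefl (inj₁ e) = E-irrefl e
  ~-irrefl (inj₂ e) = E-irrefl e ∘ ≡-sym

  bone-across≢ : ∀ q h s → bone (across q h s) ≢ q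
  bone-across≢ q h up eq = rot-stride≢ h q eq
  bone-across≢ q h lo eq = rot-stride≢ h q (trans (cong (rot (stride h)) (≡-sym eq)) (rot-cancel (ℕ.m∸n+n≡m (stride≤P h)) q))

  nb₀≢nb₁ : ∀ v → nb₀ v ≢ nb₁ v
  nb₀≢nb₁ (vert q h apex) ()
  nb₀≢nb₁ (vert q h (rail s zero)) ()
  nb₀≢nb₁ (vert q h (rail lo (suc i))) ()
  nb₀≢nb₁ (vert q h (rail up (suc i))) ()

  nb₀≢nb₂ : ∀ v → nb₀ v ≢ nb₂ v
  nb₀≢nb₂ (vert q h apex) ()
  nb₀≢nb₂ (vert q h (rail s j)) eq with view j
  nb₀≢nb₂ (vert q h (rail s _)) eq | ‵fromℕ = bone-across≢ q h s (≡-sym (cong bone eq))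
  nb₀≢nb₂ (vert q h (rail lo _)) () | ‵inject₁ i
  nb₀≢nb₂ (vert q h (rail up _)) () | ‵inject₁ i

  nb₁≢nb₂ : ∀ v → nb₁ v ≢ nb₂ v
  nb₁≢nb₂ (vert q h apex) ()
  nb₁≢nb₂ (vert q h (rail s j)) eq with view j
  nb₁≢nb₂ (vert q h (rail s j)) eq | ‵fromℕ = bone-across≢ q h s (trans (≡-sym (cong bone eq)) (bone-nb₁ (rail s j)))
    where
    bone-nb₁ : ∀ f → bone (nb₁ (vert q h f)) ≡ q
    bone-nb₁ apex             = refl
    bone-nb₁ (rail _ zero)    = refl
    bone-nb₁ (rail _ (suc _)) = refl
  nb₁≢nb₂ (vert q h (rail s _)) eq | ‵inject₁ zero with () ← eq
  -- The two neighbours on the rail have the indices i and i + 2.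
  nb₁≢nb₂ (vert q h (rail s _)) eq | ‵inject₁ (suc i) = ℕ.<⇒≢ (s≤s (ℕ.≤-trans (ℕ.≤-reflexive (trans (Fin.toℕ-inject₁ (inject₁ i)) (Fin.toℕ-inject₁ i))) (ℕ.n≤1+n _))) (cong (index ∘ frag) eq)
    where
    index : Frag → ℕ
    index apex       = 0
    index (rail _ j) = toℕ j

  -- Distance from the rungs of the middle ring.
  dist : Bool → Frag → ℕ
  dist mid  (rail s j) = κ ∸ toℕ j
  dist mid  apex       = suc κ
  dist pole apex       = 2 + κ
  dist pole (rail s j) = 3 + κ + toℕ j

  Frag↔Fin : Frag ↔ Fin (1 + 2 * K)
  Frag↔Fin = ↔-sym Fin.+↔⊎ ↔-∘ ((↔-sym Fin.1↔⊤ ⊎-↔ (↔-sym Fin.*↔× ↔-∘ (↔-sym Fin.2↔Bool ×-↔ ↔-id (Fin K)))) ↔-∘ mk↔ₛ′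
    (λ { apex → inj₁ tt ; (rail s j) → inj₂ (s , j) })
    (λ { (inj₁ tt) → apex ; (inj₂ (s , j)) → rail s j })
    (λ { (inj₁ tt) → refl ; (inj₂ (s , j)) → refl })
    (λ { apex → refl ; (rail s j) → refl }))

  V↔Fin : V ↔ Fin (P * (2 * (1 + 2 * K)))
  V↔Fin = ↔-sym Fin.*↔× ↔-∘ ((↔-id (Fin P) ×-↔ (↔-sym Fin.*↔× ↔-∘ (↔-sym Fin.2↔Bool ×-↔ Frag↔Fin))) ↔-∘ mk↔ₛ′
    (λ (vert q h f) → q , h , f) (λ (q , h , f) → vert q h f) (λ _ → refl) (λ _ → refl))

-- Straight-line drawings

ι : ℕ → ℚ
ι n = mkℚ (ℤ.+ n) 0 (Coprime.sym (Coprime.1-coprimeTo n))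

ι-mono-≤ : ∀ {m n} → m ℕ.≤ n → ι m ℚ.≤ ι n
ι-mono-≤ {m} {n} m≤n = *≤* (subst₂ ℤ._≤_ (≡-sym (ℤ.*-identityʳ (ℤ.+ m))) (≡-sym (ℤ.*-identityʳ (ℤ.+ n))) (ℤ.+≤+ m≤n))

ι-mono-< : ∀ {m n} → m ℕ.< n → ι m ℚ.< ι n
ι-mono-< {m} {n} m<n = *<* (subst₂ ℤ._<_ (≡-sym (ℤ.*-identityʳ (ℤ.+ m))) (≡-sym (ℤ.*-identityʳ (ℤ.+ n))) (ℤ.+<+ m<n))

ι-injective : ∀ {m n} → ι m ≡ ι n → m ≡ n
ι-injective refl = refl

ι-+ : ∀ m n → ι (m ℕ.+ n) ≡ ι m ℚ.+ ι n
ι-+ m n = ℚ.toℚᵘ-injective (ℚᵘ.≃-trans (ℚᵘ.*≡* eq) (ℚᵘ.≃-sym (ℚ.toℚᵘ-homo-+ (ι m) (ι n))))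
  where
  eq : ℤ.+ (m ℕ.+ n) ℤ.* ℤ.+ 1 ≡ (ℤ.+ m ℤ.* ℤ.+ 1 ℤ.+ ℤ.+ n ℤ.* ℤ.+ 1) ℤ.* ℤ.+ 1
  eq = cong (ℤ._* ℤ.+ 1) (cong₂ ℤ._+_ (≡-sym (ℤ.*-identityʳ (ℤ.+ m))) (≡-sym (ℤ.*-identityʳ (ℤ.+ n))))

ι-* : ∀ m n → ι (m ℕ.* n) ≡ ι m ℚ.* ι n
ι-* m n = ℚ.toℚᵘ-injective (ℚᵘ.≃-trans (ℚᵘ.*≡* (cong (ℤ._* ℤ.+ 1) (ℤ.pos-* m n))) (ℚᵘ.≃-sym (ℚ.toℚᵘ-homo-* (ι m) (ι n))))

record Affine (f : Point → ℚ) : Set where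
  field
    along : ∀ a b s → f (lerp a b s) ≡ f a ℚ.+ s ℚ.* (f b ℚ.- f a)

open Affine

affine-x : Affine proj₁
affine-x .along _ _ _ = refl

affine-y : Affine proj₂
affine-y .along _ _ _ = refl

module _ where
  open +-*-Solver

  affine-combination : ∀ α β → Affine (λ p → α ℚ.* proj₁ p ℚ.+ β ℚ.* proj₂ p)
  affine-combination α β .along (x₁ , y₁) (x₂ , y₂) s = solve 7
    (λ α β x₁ y₁ x₂ y₂ s → α :* (x₁ :+ s :* (x₂ :- x₁)) :+ β :* (y₁ :+ s :* (y₂ :- y₁)) :=
      (α :* x₁ :+ β :* y₁) :+ s :* ((α :* x₂ :+ β :* y₂) :- (α :* x₁ :+ β :* y₁)))
    refl α β x₁ y₁ x₂ y₂ s

  affine-neg : ∀ {f} → Affine f → Affine (λ p → ℚ.- f p)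
  affine-neg {f} aff .along a b s = trans (cong ℚ.-_ (aff .along a b s))
    (solve 3 (λ a b s → :- (a :+ s :* (b :- a)) := (:- a) :+ s :* ((:- b) :- (:- a))) refl (f a) (f b) s)

  neg-involutive : ∀ a → ℚ.- (ℚ.- a) ≡ a
  neg-involutive = solve 1 (λ a → :- (:- a) := a) refl

  lerp-0 : ∀ a b → lerp a b 0ℚ ≡ a
  lerp-0 (x₁ , y₁) (x₂ , y₂) = cong₂ _,_ (at-0 x₁ x₂) (at-0 y₁ y₂)
    where
    at-0 : ∀ x y → x ℚ.+ 0ℚ ℚ.* (y ℚ.- x) ≡ x
    at-0 = solve 2 (λ x y → x :+ con 0ℚ :* (y :- x) := x) refl

  lerp-flip : ∀ a b s → lerp a b s ≡ lerp b a (1ℚ ℚ.- s)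
  lerp-flip (x₁ , y₁) (x₂ , y₂) s = cong₂ _,_ (flipped x₁ x₂) (flipped y₁ y₂)
    where
    flipped : ∀ x y → x ℚ.+ s ℚ.* (y ℚ.- x) ≡ y ℚ.+ (1ℚ ℚ.- s) ℚ.* (x ℚ.- y)
    flipped x y = solve 3 (λ x y s → x :+ s :* (y :- x) := y :+ (con 1ℚ :- s) :* (x :- y)) refl x y s

  convex : ∀ a b s → a ℚ.+ s ℚ.* (b ℚ.- a) ≡ (1ℚ ℚ.- s) ℚ.* a ℚ.+ s ℚ.* b
  convex = solve 3 (λ a b s → a :+ s :* (b :- a) := (con 1ℚ :- s) :* a :+ s :* b) refl

  0≤1-s : ∀ {s} → s ℚ.≤ 1ℚ → 0ℚ ℚ.≤ 1ℚ ℚ.- s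
  0≤1-s {s} s≤1 = ℚ.≤-trans (ℚ.≤-reflexive (≡-sym (ℚ.+-inverseʳ s))) (ℚ.+-monoˡ-≤ (ℚ.- s) s≤1)

  1-s≤1 : ∀ {s} → 0ℚ ℚ.≤ s → 1ℚ ℚ.- s ℚ.≤ 1ℚ
  1-s≤1 0≤s = ℚ.+-monoʳ-≤ 1ℚ (ℚ.neg-antimono-≤ 0≤s)

  convex-mono : ∀ {a b c d s} → InUnit s → a ℚ.≤ c → b ℚ.≤ d →
    (1ℚ ℚ.- s) ℚ.* a ℚ.+ s ℚ.* b ℚ.≤ (1ℚ ℚ.- s) ℚ.* c ℚ.+ s ℚ.* d
  convex-mono {s = s} (0≤s , s≤1) a≤c b≤d = ℚ.+-mono-≤
    (ℚ.*-monoˡ-≤-nonNeg (1ℚ ℚ.- s) {{ℚ.nonNegative (0≤1-s s≤1)}} a≤c)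
    (ℚ.*-monoˡ-≤-nonNeg s {{ℚ.nonNegative 0≤s}} b≤d)

  convex-self : ∀ c s → (1ℚ ℚ.- s) ℚ.* c ℚ.+ s ℚ.* c ≡ c
  convex-self = solve 2 (λ c s → (con 1ℚ :- s) :* c :+ s :* c := c) refl

  convex-excess : ∀ c b s → (1ℚ ℚ.- s) ℚ.* c ℚ.+ s ℚ.* b ℚ.- c ≡ s ℚ.* (b ℚ.- c)
  convex-excess = solve 3 (λ c b s → (con 1ℚ :- s) :* c :+ s :* b :- c := s :* (b :- c)) refl

record OnSegment (p a b : Point) : Set where
  constructor onSegment
  field
    parameter : ℚ
    in-unit   : InUnit parameter
    p≡lerp    : p ≡ lerp a b parameter

onSegment-flip : ∀ {p a b} → OnSegment p a b → OnSegment p b a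
onSegment-flip {a = a} {b} (onSegment s (0≤s , s≤1) eq) = onSegment (1ℚ ℚ.- s) (0≤1-s s≤1 , 1-s≤1 0≤s) (trans eq (lerp-flip a b s))

module _ {f : Point → ℚ} (aff : Affine f) where

  onSegment-≤ : ∀ {p a b c} → f a ℚ.≤ c → f b ℚ.≤ c → OnSegment p a b → f p ℚ.≤ c
  onSegment-≤ {a = a} {b} {c} fa≤c fb≤c (onSegment s s∈ refl) = begin
    f (lerp a b s)                          ≡⟨ trans (aff .along a b s) (convex (f a) (f b) s) ⟩
    (1ℚ ℚ.- s) ℚ.* f a ℚ.+ s ℚ.* f b        ≤⟨ convex-mono s∈ fa≤c fb≤c ⟩
    (1ℚ ℚ.- s) ℚ.* c ℚ.+ s ℚ.* c            ≡⟨ convex-self c s ⟩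
    c                                       ∎
    where open ℚ.≤-Reasoning

  -- By convexity s (f b - c) is at most f p - c, hence at most 0; as f b - c is positive, the
  -- parameter s vanishes.
  onSegment-end : ∀ {p a b c} → c ℚ.≤ f a → c ℚ.< f b → f p ℚ.≤ c → OnSegment p a b → p ≡ a
  onSegment-end {a = a} {b} {c} c≤fa c<fb fp≤c (onSegment s s∈@(0≤s , _) refl) =
    trans (cong (lerp a b) (ℚ.≤-antisym s≤0 0≤s)) (lerp-0 a b)
    where
    0<fb-c : 0ℚ ℚ.< f b ℚ.- c
    0<fb-c = ℚ.≤-<-trans (ℚ.≤-reflexive (≡-sym (ℚ.+-inverseʳ c))) (ℚ.+-monoˡ-< (ℚ.- c) c<fb)
    s[fb-c]≤0 : s ℚ.* (f b ℚ.- c) ℚ.≤ 0ℚ ℚ.* (f b ℚ.- c)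
    s[fb-c]≤0 = begin
      s ℚ.* (f b ℚ.- c)                            ≡⟨ convex-excess c (f b) s ⟨
      (1ℚ ℚ.- s) ℚ.* c ℚ.+ s ℚ.* f b ℚ.- c         ≤⟨ ℚ.+-monoˡ-≤ (ℚ.- c) (convex-mono s∈ c≤fa ℚ.≤-refl) ⟩
      (1ℚ ℚ.- s) ℚ.* f a ℚ.+ s ℚ.* f b ℚ.- c       ≡⟨ cong (ℚ._- c) (trans (≡-sym (convex (f a) (f b) s)) (≡-sym (aff .along a b s))) ⟩
      f (lerp a b s) ℚ.- c                         ≤⟨ ℚ.+-monoˡ-≤ (ℚ.- c) fp≤c ⟩
      c ℚ.- c                                      ≡⟨ ℚ.+-inverseʳ c ⟩
      0ℚ                                           ≡⟨ ℚ.*-zeroˡ (f b ℚ.- c) ⟨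
      0ℚ ℚ.* (f b ℚ.- c)                           ∎
      where open ℚ.≤-Reasoning
    s≤0 : s ℚ.≤ 0ℚ
    s≤0 = ℚ.*-cancelʳ-≤-pos (f b ℚ.- c) {{ℚ.positive 0<fb-c}} s[fb-c]≤0

module _ {f : Point → ℚ} (aff : Affine f) where

  onSegment-≥ : ∀ {p a b c} → c ℚ.≤ f a → c ℚ.≤ f b → OnSegment p a b → c ℚ.≤ f p
  onSegment-≥ {p} {a} {b} {c} c≤fa c≤fb p∈ = subst₂ ℚ._≤_ (neg-involutive c) (neg-involutive (f p))
    (ℚ.neg-antimono-≤ (onSegment-≤ (affine-neg aff) (ℚ.neg-antimono-≤ c≤fa) (ℚ.neg-antimono-≤ c≤fb) p∈))

  onSegment-end-≥ : ∀ {p a b c} → f a ℚ.≤ c → f b ℚ.< c → c ℚ.≤ f p → OnSegment p a b → p ≡ a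
  onSegment-end-≥ fa≤c fb<c c≤fp = onSegment-end (affine-neg aff) (ℚ.neg-antimono-≤ fa≤c) (ℚ.neg-antimono-< fb<c) (ℚ.neg-antimono-≤ c≤fp)

module Drawing {V : Set} (pos : V → Point) (pos-injective : ∀ {u v} → pos u ≡ pos v → u ≡ v) where

  record Meet (a b c d : V) : Set where
    constructor meeting
    field
      meet : ∀ {p} → OnSegment p (pos a) (pos b) → OnSegment p (pos c) (pos d) →
        Σ V λ x → (x ≡ a ⊎ x ≡ b) × (x ≡ c ⊎ x ≡ d) × p ≡ pos x

  open Meet public

  meet-flipˡ : ∀ {a b c d} → Meet a b c d → Meet b a c d
  meet-flipˡ m .meet p∈ba p∈cd =
    let x , x∈ab , x∈cd , eq = m .meet (onSegment-flip p∈ba) p∈cd in x , swap x∈ab , x∈cd , eq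

  meet-swap : ∀ {a b c d} → Meet a b c d → Meet c d a b
  meet-swap m .meet p∈cd p∈ab =
    let x , x∈ab , x∈cd , eq = m .meet p∈ab p∈cd in x , x∈cd , x∈ab , eq

  meet-flipʳ : ∀ {a b c d} → Meet a b c d → Meet a b d c
  meet-flipʳ = meet-swap ∘ meet-flipˡ ∘ meet-swap

  module _ {f : Point → ℚ} (aff : Affine f) where

    -- The line f = t separates the segments and touches each of them at most in its first end.
    meet-sides : ∀ {a b c d} t → f (pos a) ℚ.≤ t → f (pos b) ℚ.< t → t ℚ.≤ f (pos c) → t ℚ.< f (pos d) → Meet a b c d
    meet-sides {a} {b} {c} {d} t a≤t b<t t≤c t<d .meet {p} p∈ab p∈cd =
      a , inj₁ refl , inj₁ (pos-injective (trans (≡-sym p≡a) p≡c)) , p≡a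
      where
      p≡c : p ≡ pos c
      p≡c = onSegment-end aff t≤c t<d (onSegment-≤ aff a≤t (ℚ.<⇒≤ b<t) p∈ab) p∈cd
      p≡a : p ≡ pos a
      p≡a = onSegment-end-≥ aff a≤t b<t (onSegment-≥ aff t≤c (ℚ.<⇒≤ t<d) p∈cd) p∈ab

    -- The first segment lies in the half-plane f ≤ t, which the second can touch only at `c`.
    meet-hull : ∀ {a b c d} t → f (pos a) ℚ.≤ t → f (pos b) ℚ.≤ t → t ℚ.≤ f (pos c) → t ℚ.< f (pos d) →
      (f (pos c) ≡ t → c ≡ a ⊎ c ≡ b) → Meet a b c d
    meet-hull {a} {b} {c} {d} t a≤t b≤t t≤c t<d on-hull .meet {p} p∈ab p∈cd =
      c , on-hull (ℚ.≤-antisym (subst (λ z → f z ℚ.≤ t) p≡c p≤t) t≤c) , inj₁ refl , p≡c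
      where
      p≤t : f p ℚ.≤ t
      p≤t = onSegment-≤ aff a≤t b≤t p∈ab
      p≡c : p ≡ pos c
      p≡c = onSegment-end aff t≤c t<d p≤t p∈cd

    -- Made for edges of the convex hull: the line f = t carries the edge from `a` to `b`, and other
    -- vertices lie strictly on one side of it.
    meet-hull-edge : ∀ {a b c d} t → f (pos a) ≡ t → f (pos b) ≡ t →
      (c ≡ a ⊎ c ≡ b) ⊎ t ℚ.< f (pos c) → (d ≡ a ⊎ d ≡ b) ⊎ t ℚ.< f (pos d) →
      c ≢ d → ¬ (a ≡ c × b ≡ d) → ¬ (a ≡ d × b ≡ c) → Meet a b c d
    meet-hull-edge {a} {b} {c} {d} t fa fb c-cases d-cases c≢d ¬same ¬flipped = go c-cases d-cases
      where
      on : ∀ {v} → v ≡ a ⊎ v ≡ b → t ℚ.≤ f (pos v)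
      on (inj₁ refl) = ℚ.≤-reflexive (≡-sym fa)
      on (inj₂ refl) = ℚ.≤-reflexive (≡-sym fb)
      go : (c ≡ a ⊎ c ≡ b) ⊎ t ℚ.< f (pos c) → (d ≡ a ⊎ d ≡ b) ⊎ t ℚ.< f (pos d) → Meet a b c d
      go (inj₂ t<c) (inj₂ t<d) = meet-hull t (ℚ.≤-reflexive fa) (ℚ.≤-reflexive fb) (ℚ.<⇒≤ t<c) t<d (λ eq → contradiction (≡-sym eq) (ℚ.<⇒≢ t<c))
      go (inj₁ c∈)  (inj₂ t<d) = meet-hull t (ℚ.≤-reflexive fa) (ℚ.≤-reflexive fb) (on c∈) t<d (λ _ → c∈)
      go (inj₂ t<c) (inj₁ d∈)  = meet-flipʳ (meet-hull t (ℚ.≤-reflexive fa) (ℚ.≤-reflexive fb) (on d∈) t<c (λ _ → d∈))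
      go (inj₁ (inj₁ refl)) (inj₁ (inj₁ refl)) = contradiction refl c≢d
      go (inj₁ (inj₁ refl)) (inj₁ (inj₂ refl)) = contradiction (refl , refl) ¬same
      go (inj₁ (inj₂ refl)) (inj₁ (inj₁ refl)) = contradiction (refl , refl) ¬flipped
      go (inj₁ (inj₂ refl)) (inj₁ (inj₂ refl)) = contradiction refl c≢d

  module _ {a b c d : V}
           (ya≡yc : proj₂ (pos a) ≡ proj₂ (pos c)) (yb≡ : proj₂ (pos b) ≡ proj₂ (pos a) ℚ.+ 1ℚ)
           (yd≡ : proj₂ (pos d) ≡ proj₂ (pos a) ℚ.+ 1ℚ) where

    open +-*-Solver

    private
      xa xb xc xd h β t : ℚ
      xa = proj₁ (pos a)
      xb = proj₁ (pos b)
      xc = proj₁ (pos c)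
      xd = proj₁ (pos d)
      h  = proj₂ (pos a)
      β  = (xa ℚ.+ xc) ℚ.- (xb ℚ.+ xd)
      t  = xa ℚ.+ xc ℚ.+ β ℚ.* h

      -- The line f = t runs halfway between the two segments.
      f : Point → ℚ
      f p = (1ℚ ℚ.+ 1ℚ) ℚ.* proj₁ p ℚ.+ β ℚ.* proj₂ p

      f-affine : Affine f
      f-affine = affine-combination (1ℚ ℚ.+ 1ℚ) β

      low : ∀ x z → (1ℚ ℚ.+ 1ℚ) ℚ.* x ℚ.+ z ≡ x ℚ.+ (x ℚ.+ z)
      low = solve 2 (λ x z → (con 1ℚ :+ con 1ℚ) :* x :+ z := x :+ (x :+ z)) refl

      f-a : f (pos a) ≡ xa ℚ.+ (xa ℚ.+ β ℚ.* h)
      f-a = low xa (β ℚ.* h)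

      f-c : f (pos c) ≡ xc ℚ.+ (xc ℚ.+ β ℚ.* h)
      f-c = trans (cong (λ z → (1ℚ ℚ.+ 1ℚ) ℚ.* xc ℚ.+ β ℚ.* z) (≡-sym ya≡yc)) (low xc (β ℚ.* h))

      t-a : t ≡ xc ℚ.+ (xa ℚ.+ β ℚ.* h)
      t-a = solve 3 (λ xa xc z → xa :+ xc :+ z := xc :+ (xa :+ z)) refl xa xc (β ℚ.* h)

      t-c : t ≡ xa ℚ.+ (xc ℚ.+ β ℚ.* h)
      t-c = ℚ.+-assoc xa xc (β ℚ.* h)

      rest : ℚ → ℚ
      rest x = xa ℚ.+ xc ℚ.- x ℚ.+ β ℚ.* h

      t-rest : ∀ x → t ≡ x ℚ.+ rest x
      t-rest x = solve 4 (λ xa xc x z → xa :+ xc :+ z := x :+ (xa :+ xc :- x :+ z)) refl xa xc x (β ℚ.* h)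

      f-b : f (pos b) ≡ xb ℚ.+ rest xd
      f-b = trans (cong (λ z → (1ℚ ℚ.+ 1ℚ) ℚ.* xb ℚ.+ β ℚ.* z) yb≡)
        (solve 5 (λ xa xb xc xd h → let β' = (xa :+ xc) :- (xb :+ xd) in
          (con 1ℚ :+ con 1ℚ) :* xb :+ β' :* (h :+ con 1ℚ) := xb :+ (xa :+ xc :- xd :+ β' :* h)) refl xa xb xc xd h)

      f-d : f (pos d) ≡ xd ℚ.+ rest xb
      f-d = trans (cong (λ z → (1ℚ ℚ.+ 1ℚ) ℚ.* xd ℚ.+ β ℚ.* z) yd≡)
        (solve 5 (λ xa xb xc xd h → let β' = (xa :+ xc) :- (xb :+ xd) in
          (con 1ℚ :+ con 1ℚ) :* xd :+ β' :* (h :+ con 1ℚ) := xd :+ (xa :+ xc :- xb :+ β' :* h)) refl xa xb xc xd h)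

    -- The separating line passes through the midpoints of the lower ends and of the upper ends. A
    -- tie is harmless in one of the two rows, here in the upper one.
    meet-strip-< : xa ℚ.< xc → xb ℚ.≤ xd → Meet a b c d
    meet-strip-< xa<xc xb≤xd = meet-flipˡ (meet-flipʳ (meet-sides f-affine t
      (subst₂ ℚ._≤_ (≡-sym f-b) (≡-sym (t-rest xd)) (ℚ.+-monoˡ-≤ (rest xd) xb≤xd))
      (subst₂ ℚ._<_ (≡-sym f-a) (≡-sym t-a) (ℚ.+-monoˡ-< (xa ℚ.+ β ℚ.* h) xa<xc))
      (subst₂ ℚ._≤_ (≡-sym (t-rest xb)) (≡-sym f-d) (ℚ.+-monoˡ-≤ (rest xb) xb≤xd))
      (subst₂ ℚ._<_ (≡-sym t-c) (≡-sym f-c) (ℚ.+-monoˡ-< (xc ℚ.+ β ℚ.* h) xa<xc))))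

    meet-strip-≤ : xa ℚ.≤ xc → xb ℚ.< xd → Meet a b c d
    meet-strip-≤ xa≤xc xb<xd = meet-sides f-affine t
      (subst₂ ℚ._≤_ (≡-sym f-a) (≡-sym t-a) (ℚ.+-monoˡ-≤ (xa ℚ.+ β ℚ.* h) xa≤xc))
      (subst₂ ℚ._<_ (≡-sym f-b) (≡-sym (t-rest xd)) (ℚ.+-monoˡ-< (rest xd) xb<xd))
      (subst₂ ℚ._≤_ (≡-sym t-c) (≡-sym f-c) (ℚ.+-monoˡ-≤ (xc ℚ.+ β ℚ.* h) xa≤xc))
      (subst₂ ℚ._<_ (≡-sym (t-rest xb)) (≡-sym f-d) (ℚ.+-monoˡ-< (rest xb) xb<xd))

-- A vertex v sits in column x v of row y v; X stretches the columns of each row monotonically.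
module LevelDrawing {V : Set} (x y X : V → ℕ)
                    (grid-injective : ∀ {u v} → x u ≡ x v → y u ≡ y v → u ≡ v)
                    (X-mono : ∀ {u v} → y u ≡ y v → x u ℕ.< x v → X u ℕ.< X v) where

  pos : V → Point
  pos v = ι (X v) , ι (y v)

  private
    X-mono-≤ : ∀ {u v} → y u ≡ y v → x u ℕ.≤ x v → X u ℕ.≤ X v
    X-mono-≤ eq le with ℕ.m≤n⇒m<n∨m≡n le
    ... | inj₁ lt  = ℕ.<⇒≤ (X-mono eq lt)
    ... | inj₂ eq' = ℕ.≤-reflexive (cong X (grid-injective eq' eq))

  pos-injective : ∀ {u v} → pos u ≡ pos v → u ≡ v
  pos-injective {u} {v} eq with ℕ.<-cmp (x u) (x v) | ι-injective (cong proj₁ eq) | ι-injective (cong proj₂ eq)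
  ... | tri< lt _ _  | X≡ | y≡ = contradiction X≡ (ℕ.<⇒≢ (X-mono y≡ lt))
  ... | tri≈ _ x≡ _  | X≡ | y≡ = grid-injective x≡ y≡
  ... | tri> _ _ gt  | X≡ | y≡ = contradiction (≡-sym X≡) (ℕ.<⇒≢ (X-mono (≡-sym y≡) gt))

  open Drawing pos pos-injective public

  Horizontal : V → V → Set
  Horizontal a b = y b ≡ y a × x b ≡ suc (x a)

  Steep : V → V → Set
  Steep a b = y b ≡ suc (y a)

  private
    X< : ∀ {a b} → Horizontal a b → X a ℕ.< X b
    X< (y≡ , x≡) = X-mono (≡-sym y≡) (ℕ.≤-reflexive (≡-sym x≡))

    y< : ∀ {a b} → Steep a b → y a ℕ.< y b
    y< eq = ℕ.≤-reflexive (≡-sym eq)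

  meet-rows : ∀ {a b c d} → y a ℕ.≤ y b → y b ℕ.< y c → y c ℕ.≤ y d → Meet a b c d
  meet-rows {a} {b} {c} {d} a≤b b<c c≤d = meet-hull affine-y (ι (y b)) (ι-mono-≤ a≤b) (ι-mono-≤ ℕ.≤-refl)
    (ι-mono-≤ (ℕ.<⇒≤ b<c)) (ι-mono-< (ℕ.<-≤-trans b<c c≤d)) (λ eq → contradiction (≡-sym (ι-injective eq)) (ℕ.<⇒≢ b<c))

  on-horizontal : ∀ {a b c} → Horizontal a b → y c ≡ y a → OnSegment (pos c) (pos a) (pos b) → c ≡ a ⊎ c ≡ b
  on-horizontal {a} {b} {c} hor@(yb≡ , xb≡) yc≡ on with ℕ.≤-<-connex (x c) (x a)
  ... | inj₁ xc≤xa = inj₁ (pos-injective (onSegment-end affine-x ℚ.≤-refl (ι-mono-< (X< hor)) (ι-mono-≤ (X-mono-≤ yc≡ xc≤xa)) on))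
  ... | inj₂ xa<xc = inj₂ (pos-injective (onSegment-end-≥ affine-x ℚ.≤-refl (ι-mono-< (X< hor))
    (ι-mono-≤ (X-mono-≤ (trans yb≡ (≡-sym yc≡)) (ℕ.≤-trans (ℕ.≤-reflexive xb≡) xa<xc))) (onSegment-flip on)))

  -- A steep edge joins consecutive rows, so it meets a row only in one of its ends.
  meet-hor-steep : ∀ {a b c d} → Horizontal a b → Steep c d → Meet a b c d
  meet-hor-steep {a} {b} {c} {d} hor@(yb≡ , xb≡) st with ℕ.<-cmp (y a) (y c)
  ... | tri< lt _ _ = meet-rows (ℕ.≤-reflexive (≡-sym yb≡)) (subst (ℕ._< y c) (≡-sym yb≡) lt) (ℕ.<⇒≤ (y< st))
  ... | tri≈ _ ya≡yc _ = meeting λ p∈ab p∈cd →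
    let p≡c = onSegment-end affine-y (ι-mono-≤ (ℕ.≤-reflexive ya≡yc)) (ι-mono-< (subst (ℕ._< y d) (≡-sym ya≡yc) (y< st)))
                (onSegment-≤ affine-y ℚ.≤-refl (ι-mono-≤ (ℕ.≤-reflexive yb≡)) p∈ab) p∈cd
    in c , on-horizontal hor (≡-sym ya≡yc) (subst (λ z → OnSegment z (pos a) (pos b)) p≡c p∈ab) , inj₁ refl , p≡c
  ... | tri> _ _ gt with ℕ.m≤n⇒m<n∨m≡n (ℕ.≤-trans (ℕ.≤-reflexive st) gt)
  ...   | inj₁ yd<ya = meet-swap (meet-rows (ℕ.<⇒≤ (y< st)) yd<ya (ℕ.≤-reflexive (≡-sym yb≡)))
  ...   | inj₂ yd≡ya = meeting λ p∈ab p∈cd →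
    let p≡d = onSegment-end-≥ affine-y (ι-mono-≤ (ℕ.≤-reflexive yd≡ya)) (ι-mono-< gt)
                (onSegment-≥ affine-y ℚ.≤-refl (ι-mono-≤ (ℕ.≤-reflexive (≡-sym yb≡))) p∈ab) (onSegment-flip p∈cd)
    in d , on-horizontal hor yd≡ya (subst (λ z → OnSegment z (pos a) (pos b)) p≡d p∈ab) , inj₂ refl , p≡d

  private
    meet-beside : ∀ {a b c d} → Horizontal a b → Horizontal c d → y a ≡ y c → x a ℕ.< x c → Meet a b c d
    meet-beside {b = b} {c} hor@(yb≡ , xb≡) hor' ya≡yc lt = meet-flipˡ (meet-sides affine-x (ι (X b))
      ℚ.≤-refl (ι-mono-< (X< hor)) (ι-mono-≤ Xb≤Xc) (ι-mono-< (ℕ.≤-<-trans Xb≤Xc (X< hor'))))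
      where
      Xb≤Xc : X b ℕ.≤ X c
      Xb≤Xc = X-mono-≤ (trans yb≡ ya≡yc) (ℕ.≤-trans (ℕ.≤-reflexive xb≡) lt)

    meet-above : ∀ {a b c d} → Steep a b → Steep c d → y a ℕ.< y c → Meet a b c d
    meet-above {b = b} st st' lt = meet-flipˡ (meet-sides affine-y (ι (y b)) ℚ.≤-refl (ι-mono-< (y< st))
      (ι-mono-≤ (ℕ.≤-trans (ℕ.≤-reflexive st) lt)) (ι-mono-< (ℕ.≤-<-trans (ℕ.≤-trans (ℕ.≤-reflexive st) lt) (y< st'))))

    top-row : ∀ {a b c} → Steep a b → y a ≡ y c → ι (y b) ≡ ι (y c) ℚ.+ 1ℚ
    top-row {c = c} st ya≡yc = trans (cong ι (trans st (trans (cong suc ya≡yc) (ℕ.+-comm 1 (y c))))) (ι-+ (y c) 1)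

    meet-strip : ∀ {a b c d} → Steep a b → Steep c d → y a ≡ y c → x a ℕ.< x c → x b ℕ.≤ x d → Meet a b c d
    meet-strip {a} {b} {c} {d} st st' ya≡yc lt le = meet-strip-< (cong ι ya≡yc) (top-row {a} {b} {a} st refl) (top-row {c} {d} {a} st' (≡-sym ya≡yc))
      (ι-mono-< (X-mono ya≡yc lt)) (ι-mono-≤ (X-mono-≤ (trans st (trans (cong suc ya≡yc) (≡-sym st'))) le))

    meet-fork : ∀ {a b d} → Steep a b → Steep a d → x b ℕ.< x d → Meet a b a d
    meet-fork {a} {b} {d} st st' lt = meet-strip-≤ refl (top-row {a} {b} {a} st refl) (top-row {a} {d} {a} st' refl)
      ℚ.≤-refl (ι-mono-< (X-mono (trans st (≡-sym st')) lt))

  meet-hor-hor : ∀ {a b c d} → Horizontal a b → Horizontal c d → ¬ (a ≡ c × b ≡ d) → Meet a b c d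
  meet-hor-hor {a} {b} {c} {d} hor@(yb≡ , xb≡) hor'@(yd≡ , xd≡) different with ℕ.<-cmp (y a) (y c)
  ... | tri< lt _ _ = meet-rows (ℕ.≤-reflexive (≡-sym yb≡)) (subst (ℕ._< y c) (≡-sym yb≡) lt) (ℕ.≤-reflexive (≡-sym yd≡))
  ... | tri> _ _ gt = meet-swap (meet-rows (ℕ.≤-reflexive (≡-sym yd≡)) (subst (ℕ._< y a) (≡-sym yd≡) gt) (ℕ.≤-reflexive (≡-sym yb≡)))
  ... | tri≈ _ ya≡yc _ with ℕ.<-cmp (x a) (x c)
  ...   | tri< lt _ _ = meet-beside hor hor' ya≡yc lt
  ...   | tri> _ _ gt = meet-swap (meet-beside hor' hor (≡-sym ya≡yc) gt)
  ...   | tri≈ _ xa≡xc _ = contradiction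
    (grid-injective xa≡xc ya≡yc , grid-injective (trans xb≡ (trans (cong suc xa≡xc) (≡-sym xd≡))) (trans yb≡ (trans ya≡yc (≡-sym yd≡)))) different

  -- Only edges between the same two rows could cross in their interior. The two order hypotheses
  -- exclude this, and they are all that remains to be checked for the graph at hand.
  meet-steep-steep : ∀ {a b c d} → Steep a b → Steep c d →
    (y a ≡ y c → x a ℕ.< x c → x b ℕ.≤ x d) → (y c ≡ y a → x c ℕ.< x a → x d ℕ.≤ x b) →
    ¬ (a ≡ c × b ≡ d) → Meet a b c d
  meet-steep-steep {a} {b} {c} {d} st st' order order' different with ℕ.<-cmp (y a) (y c)
  ... | tri< lt _ _ = meet-above st st' lt
  ... | tri> _ _ gt = meet-swap (meet-above st' st gt)
  ... | tri≈ _ ya≡yc _ with ℕ.<-cmp (x a) (x c)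
  ...   | tri< lt _ _ = meet-strip st st' ya≡yc lt (order ya≡yc lt)
  ...   | tri> _ _ gt = meet-swap (meet-strip st' st (≡-sym ya≡yc) gt (order' (≡-sym ya≡yc) gt))
  ...   | tri≈ _ xa≡xc _ with refl ← grid-injective xa≡xc ya≡yc with ℕ.<-cmp (x b) (x d)
  ...     | tri< lt _ _    = meet-fork st st' lt
  ...     | tri> _ _ gt    = meet-swap (meet-fork st' st gt)
  ...     | tri≈ _ xb≡xd _ = contradiction (refl , grid-injective xb≡xd (trans st (≡-sym st'))) different

-- Connectivity

module Connectivity (κ n : ℕ) (2<n : 2 < n) where
  open Bones κ n 2<n

  data Path (ok : V → Set) : V → V → Set where
    here : ∀ {u} → ok u → Path ok u u
    step : ∀ {u w v} → ok u → u ~ w → Path ok w v → Path ok u v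

  module _ {ok : V → Set} where

    infixr 5 _++_
    _++_ : ∀ {u w v} → Path ok u w → Path ok w v → Path ok u v
    here _       ++ q = q
    step o e p   ++ q = step o e (p ++ q)

    snoc : ∀ {u w v} → Path ok u w → w ~ v → ok v → Path ok u v
    snoc (here o)     e o' = step o e (here o')
    snoc (step o e p) e' o' = step o e (snoc p e' o')

    start-ok : ∀ {u v} → Path ok u v → ok u
    start-ok (here o)     = o
    start-ok (step o _ _) = o

    reverse : ∀ {u v} → Path ok u v → Path ok v u
    reverse (here o)     = here o
    reverse (step o e p) = reverse p ++ step (start-ok p) (~-sym e) (here o)

    path-inward : ∀ q h s (j : Fin K) → (∀ i → toℕ i ≤ toℕ j → ok (vert q h (rail s i))) →
      ok (vert q h apex) → Path ok (vert q h (rail s j)) (vert q h apex)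
    path-inward q h s j = <-weakInduction
      (λ j → (∀ i → toℕ i ≤ toℕ j → ok (vert q h (rail s i))) → ok (vert q h apex) → Path ok (vert q h (rail s j)) (vert q h apex))
      (λ oks o → step (oks zero z≤n) (inj₂ (foot q h s)) (here o))
      (λ i rec oks o → step (oks (suc i) ℕ.≤-refl) (inj₂ (rail q h s i))
        (rec (λ i' le → oks i' (ℕ.m≤n⇒m≤1+n (subst (toℕ i' ≤_) (Fin.toℕ-inject₁ i) le))) o))
      j

    path-outward : ∀ q h s (j : Fin K) → (∀ i → toℕ j ≤ toℕ i → ok (vert q h (rail s i))) →
      Path ok (vert q h (rail s j)) (vert q h (rail s top))
    path-outward q h s j = >-weakInduction
      (λ j → (∀ i → toℕ j ≤ toℕ i → ok (vert q h (rail s i))) → Path ok (vert q h (rail s j)) (vert q h (rail s top)))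
      (λ oks → here (oks top ℕ.≤-refl))
      (λ i rec oks → step (oks (inject₁ i) ℕ.≤-refl) (inj₁ (rail q h s i))
        (rec (λ i' le → oks i' (ℕ.≤-trans (ℕ.≤-reflexive (Fin.toℕ-inject₁ i)) (ℕ.<⇒≤ le)))))
      j

  map-ok : ∀ {ok ok' : V → Set} → (∀ {x} → ok x → ok' x) → ∀ {u v} → Path ok u v → Path ok' u v
  map-ok f (here o)     = here (f o)
  map-ok f (step o e p) = step (f o) e (map-ok f p)

  offset : Bool → Bool → ℕ
  offset h up = stride h
  offset h lo = P ∸ stride h

  bone-across : ∀ q h s → bone (across q h s) ≡ rot (offset h s) q
  bone-across q h lo = refl
  bone-across q h up = refl

  1≤stride : ∀ h → 1 ≤ stride h
  1≤stride mid  = s≤s z≤n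
  1≤stride pole = s≤s z≤n

  stride≤2 : ∀ h → stride h ≤ 2
  stride≤2 mid  = s≤s z≤n
  stride≤2 pole = s≤s (s≤s z≤n)

  -- There are at least six bones, so forward offsets are at most 2 and backward ones at least 4.
  -- Hence the four bones next to a given one are distinct.
  4≤P∸stride : ∀ h → 4 ≤ P ∸ stride h
  4≤P∸stride h = ℕ.∸-mono 5<P (stride≤2 h)

  stride≢P∸stride : ∀ h h' → stride h ≢ P ∸ stride h'
  stride≢P∸stride h h' eq = ℕ.<⇒≱ (s≤s (s≤s (s≤s z≤n))) (ℕ.≤-trans (4≤P∸stride h') (ℕ.≤-trans (ℕ.≤-reflexive (≡-sym eq)) (stride≤2 h)))

  stride-injective : ∀ h h' → stride h ≡ stride h' → h ≡ h'
  stride-injective mid  mid  _ = refl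
  stride-injective pole pole _ = refl

  offset-injective : ∀ h s h' s' → offset h s ≡ offset h' s' → h ≡ h' × s ≡ s'
  offset-injective h lo h' lo eq = stride-injective h h' (ℕ.∸-cancelˡ-≡ (stride≤P h) (stride≤P h') eq) , refl
  offset-injective h lo h' up eq = contradiction (≡-sym eq) (stride≢P∸stride h' h)
  offset-injective h up h' lo eq = contradiction eq (stride≢P∸stride h h')
  offset-injective h up h' up eq = stride-injective h h' eq , refl

  offset<P : ∀ h s → offset h s < P
  offset<P h lo = ℕ.∸-monoʳ-< (1≤stride h) (stride≤P h)
  offset<P h up = ℕ.≤-<-trans (stride≤2 h) (ℕ.≤-trans (s≤s (s≤s (s≤s z≤n))) 5<P)

  across-distinct : ∀ q h s h' s' → bone (across q h s) ≡ bone (across q h' s') → h ≡ h' × s ≡ s'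
  across-distinct q h s h' s' eq = offset-injective h s h' s'
    (rot-<-injective q (offset<P h s) (offset<P h' s')
      (trans (≡-sym (bone-across q h s)) (trans eq (bone-across q h' s'))))

  third : (i j : Fin 3) → Σ (Fin 3) λ l → i ≢ l × j ≢ l
  third 0F 0F = 1F , (λ ()) , (λ ())
  third 0F 1F = 2F , (λ ()) , (λ ())
  third 0F 2F = 1F , (λ ()) , (λ ())
  third 1F 0F = 2F , (λ ()) , (λ ())
  third 1F 1F = 0F , (λ ()) , (λ ())
  third 1F 2F = 0F , (λ ()) , (λ ())
  third 2F 0F = 1F , (λ ()) , (λ ())
  third 2F 1F = 0F , (λ ()) , (λ ())
  third 2F 2F = 0F , (λ ()) , (λ ())

  module Deleted (a b : V) where

    Ok : V → Set
    Ok x = x ≢ a × x ≢ b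

    Intact : Fin P → Set
    Intact q = bone a ≢ q × bone b ≢ q

    Escape : V → Set
    Escape v = Σ V λ w → Path Ok v w × Intact (bone w)

    -- Three paths that are disjoint up to v, told apart by labels: two deleted vertices miss one of them.
    fan : ∀ {v} (label : V → Fin 3) (end : Fin 3 → V) →
      (∀ i → Path (λ x → x ≡ v ⊎ label x ≡ i) v (end i)) →
      (∀ i x → bone x ≡ bone (end i) → label x ≡ i) →
      Ok v → Escape v
    fan {v} label end paths ends (v≢a , v≢b) with i , la≢i , lb≢i ← third (label a) (label b) =
      end i , map-ok avoid (paths i) , la≢i ∘ ends i a , lb≢i ∘ ends i b
      where
      avoid : ∀ {x} → x ≡ v ⊎ label x ≡ i → Ok x
      avoid (inj₁ refl) = v≢a , v≢b
      avoid (inj₂ eq)   = (λ { refl → la≢i eq }) , (λ { refl → lb≢i eq })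

    module _ (q : Fin P) (h : Bool) (s : Bool) (inside : Bool → Frag → Fin 3)
             (inside-not : ∀ f → inside (not h) f ≡ 0F) where

      private
        -- A whole neighbouring bone carries the label of the route ending there. A deleted vertex
        -- with a different label thus neither blocks the route nor damages its last bone. Label 0
        -- is also the default for all bones further away.
        label : V → Fin 3
        label x with bone x Fin.≟ q
        ... | yes _ = inside (half x) (frag x)
        ... | no _ with bone x Fin.≟ bone (across q h s)
        ...   | yes _ = 1F
        ...   | no _ with bone x Fin.≟ bone (across q h (not s))
        ...     | yes _ = 2F
        ...     | no _ = 0F

        end : Fin 3 → V
        end 0F = across q (not h) up
        end 1F = across q h s
        end 2F = across q h (not s)

        label-inside : ∀ h' f → label (vert q h' f) ≡ inside h' f
        label-inside h' f with q Fin.≟ q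
        ... | yes _ = refl
        ... | no ¬p = contradiction refl ¬p

        label-end : ∀ i x → bone x ≡ bone (end i) → label x ≡ i
        label-end i x eq with bone x Fin.≟ q
        label-end 0F x eq | yes refl = contradiction (≡-sym eq) (bone-across≢ q (not h) up)
        label-end 1F x eq | yes refl = contradiction (≡-sym eq) (bone-across≢ q h s)
        label-end 2F x eq | yes refl = contradiction (≡-sym eq) (bone-across≢ q h (not s))
        label-end i x eq | no _ with bone x Fin.≟ bone (across q h s)
        label-end 0F x eq | no _ | yes p = contradiction (proj₁ (across-distinct q (not h) up h s (trans (≡-sym eq) p))) (Bool.not-¬ refl ∘ ≡-sym)
        label-end 1F x eq | no _ | yes _ = refl
        label-end 2F x eq | no _ | yes p = contradiction (proj₂ (across-distinct q h s h (not s) (trans (≡-sym p) eq))) (Bool.not-¬ refl)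
        label-end i x eq | no _ | no ¬p with bone x Fin.≟ bone (across q h (not s))
        label-end 1F x eq | no _ | no ¬p | _ = contradiction eq ¬p
        label-end 0F x eq | no _ | no _ | yes p = contradiction (proj₁ (across-distinct q (not h) up h (not s) (trans (≡-sym eq) p))) (Bool.not-¬ refl ∘ ≡-sym)
        label-end 0F x eq | no _ | no _ | no _ = refl
        label-end 2F x eq | no _ | no _ | yes _ = refl
        label-end 2F x eq | no _ | no _ | no ¬p = contradiction eq ¬p

      -- Route 0 leaves through the other half of the bone, which is labelled 0 throughout, and from
      -- its apex along one rail; routes 1 and 2 leave through the two ring edges of the half
      -- containing the start.
      fan-from : ∀ f → (let ok = λ i x → x ≡ vert q h f ⊎ (bone x ≡ q × inside (half x) (frag x) ≡ i)) →
        Path (ok 0F) (vert q h f) (vert q (not h) apex) →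
        Path (ok 1F) (vert q h f) (vert q h (rail s top)) →
        Path (ok 2F) (vert q h f) (vert q h (rail (not s) top)) →
        Ok (vert q h f) → Escape (vert q h f)
      fan-from f p₀ p₁ p₂ = fan label end paths label-end
        where
        ok : Fin 3 → V → Set
        ok i x = x ≡ vert q h f ⊎ label x ≡ i
        widen : ∀ {i x} → x ≡ vert q h f ⊎ (bone x ≡ q × inside (half x) (frag x) ≡ i) → ok i x
        widen (inj₁ eq) = inj₁ eq
        widen {x = x} (inj₂ (refl , eq)) = inj₂ (trans (label-inside (half x) (frag x)) eq)
        end-ok : ∀ i → ok i (end i)
        end-ok i = inj₂ (label-end i (end i) refl)
        otherwise : ∀ f → ok 0F (vert q (not h) f)
        otherwise f = inj₂ (trans (label-inside (not h) f) (inside-not f))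
        paths : ∀ i → Path (ok i) (vert q h f) (end i)
        paths 0F = map-ok widen p₀
          ++ step (otherwise apex) (inj₁ (foot q (not h) up))
             (path-outward q (not h) up zero (λ i _ → otherwise (rail up i)))
          ++ step (otherwise (rail up top)) (~across q (not h) up) (here (end-ok 0F))
        paths 1F = snoc (map-ok widen p₁) (~across q h s) (end-ok 1F)
        paths 2F = snoc (map-ok widen p₂) (~across q h (not s)) (end-ok 2F)

    -- From an apex the routes start along the spine and the two rails. From a rail they lead inward
    -- to the apex and over the spine, outward on the same rail, and over the rung and outward on
    -- the other rail.
    escape : ∀ v → Ok v → Escape v
    escape (vert q h apex) = fan-from q h lo inside inside-not apex
      (step (inj₁ refl) (~nb₀ _) (here (inj₂ (refl , refl))))
      (step (inj₁ refl) (inj₁ (foot q h lo)) (path-outward q h lo zero (λ i _ → inj₂ (refl , inside-h lo i))))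
      (step (inj₁ refl) (inj₁ (foot q h up)) (path-outward q h up zero (λ i _ → inj₂ (refl , inside-h up i))))
      where
      side : Bool → Fin 3
      side lo = 1F
      side up = 2F
      inside : Bool → Frag → Fin 3
      inside h' apex = 0F
      inside h' (rail s i) with h' Bool.≟ h
      ... | yes _ = side s
      ... | no  _ = 0F
      inside-not : ∀ f → inside (not h) f ≡ 0F
      inside-not apex = refl
      inside-not (rail s i) with not h Bool.≟ h
      ... | yes eq = contradiction (≡-sym eq) (Bool.not-¬ refl)
      ... | no  _  = refl
      inside-h : ∀ s i → inside h (rail s i) ≡ side s
      inside-h s i with h Bool.≟ h
      ... | yes _ = refl
      ... | no ¬p = contradiction refl ¬p
    escape (vert q h (rail s j)) = fan-from q h s inside inside-not (rail s j)
      (snoc (path-inward q h s j inner (inj₂ (refl , refl))) (~nb₀ _) (inj₂ (refl , refl)))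
      (path-outward q h s j outer)
      (step (inj₁ refl) (~nb₀ _) (path-outward q h (not s) j (λ i _ → inj₂ (refl , inside-≢ i))))
      where
      inside : Bool → Frag → Fin 3
      inside h' apex = 0F
      inside h' (rail s' i) with h' Bool.≟ h
      ... | no  _ = 0F
      ... | yes _ with s' Bool.≟ s
      ...   | no _ = 2F
      ...   | yes _ with i Fin.<? j
      ...     | yes _ = 0F
      ...     | no  _ = 1F
      inside-not : ∀ f → inside (not h) f ≡ 0F
      inside-not apex = refl
      inside-not (rail s i) with not h Bool.≟ h
      ... | yes eq = contradiction (≡-sym eq) (Bool.not-¬ refl)
      ... | no  _  = refl
      inside-≢ : ∀ i → inside h (rail (not s) i) ≡ 2F
      inside-≢ i with h Bool.≟ h
      ... | no ¬p = contradiction refl ¬p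
      ... | yes _ with not s Bool.≟ s
      ...   | yes eq = contradiction (≡-sym eq) (Bool.not-¬ refl)
      ...   | no  _  = refl
      inside-< : ∀ i → i Fin.< j → inside h (rail s i) ≡ 0F
      inside-< i i<j with h Bool.≟ h
      ... | no ¬p = contradiction refl ¬p
      ... | yes _ with s Bool.≟ s
      ...   | no ¬p = contradiction refl ¬p
      ...   | yes _ with i Fin.<? j
      ...     | yes _ = refl
      ...     | no i≮j = contradiction i<j i≮j
      inside-≥ : ∀ i → ¬ i Fin.< j → inside h (rail s i) ≡ 1F
      inside-≥ i i≮j with h Bool.≟ h
      ... | no ¬p = contradiction refl ¬p
      ... | yes _ with s Bool.≟ s
      ...   | no ¬p = contradiction refl ¬p
      ...   | yes _ with i Fin.<? j
      ...     | yes i<j = contradiction i<j i≮j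
      ...     | no  _ = refl
      inner : ∀ i → toℕ i ≤ toℕ j → vert q h (rail s i) ≡ vert q h (rail s j) ⊎ (q ≡ q × inside h (rail s i) ≡ 0F)
      inner i i≤j with ℕ.m≤n⇒m<n∨m≡n i≤j
      ... | inj₁ i<j = inj₂ (refl , inside-< i i<j)
      ... | inj₂ i≡j = inj₁ (cong (λ z → vert q h (rail s z)) (Fin.toℕ-injective i≡j))
      outer : ∀ i → toℕ j ≤ toℕ i → vert q h (rail s i) ≡ vert q h (rail s j) ⊎ (q ≡ q × inside h (rail s i) ≡ 1F)
      outer i j≤i = inj₂ (refl , inside-≥ i (ℕ.≤⇒≯ j≤i))

    -- Passing between undamaged bones

    intact-ok : ∀ {x} → Intact (bone x) → Ok x
    intact-ok (a≢ , b≢) = (λ { refl → a≢ refl }) , (λ { refl → b≢ refl })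

    hub : Fin P → V
    hub q = vert q mid apex

    apex-to-hub : ∀ q h → Intact q → Path Ok (vert q h apex) (hub q)
    apex-to-hub q mid  ok = here (intact-ok ok)
    apex-to-hub q pole ok = step (intact-ok ok) (inj₂ (spine q)) (here (intact-ok ok))

    to-hub : ∀ v → Intact (bone v) → Path Ok v (hub (bone v))
    to-hub (vert q h apex)       ok = apex-to-hub q h ok
    to-hub (vert q h (rail s j)) ok =
      path-inward q h s j (λ _ _ → intact-ok ok) (intact-ok ok) ++ apex-to-hub q h ok

    hub-stride : ∀ h q → Intact q → Intact (rot (stride h) q) → Path Ok (hub q) (hub (rot (stride h) q))
    hub-stride h q ok ok' = reverse (to-hub (vert q h (rail up top)) ok)
      ++ step (intact-ok ok) (inj₁ (ring q h)) (to-hub (vert _ h (rail lo top)) ok')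

    -- Starting next to the bone of b, only the bone of a can be in the way, and the pole ring jumps over it.
    hub-rot : ∀ d t → 0 < t → d + t < P → Intact (rot t (bone b)) → Intact (rot (d + t) (bone b)) →
      Path Ok (hub (rot t (bone b))) (hub (rot (d + t) (bone b)))
    hub-rot zero t 0<t lt ok ok' = here (intact-ok ok)
    hub-rot (suc d) t 0<t lt ok ok' with bone a Fin.≟ rot (suc t) (bone b)
    hub-rot (suc d) t 0<t lt ok ok' | no a≢ =
      subst (λ z → Path Ok (hub (rot t (bone b))) (hub z)) next
        (hub-stride mid (rot t (bone b)) ok (subst Intact (≡-sym next) ok₁))
      ++ subst (λ z → Path Ok (hub (rot (suc t) (bone b))) (hub (rot z (bone b)))) (ℕ.+-suc d t)
           (hub-rot d (suc t) (s≤s z≤n) (subst (_< P) (≡-sym (ℕ.+-suc d t)) lt) ok₁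
             (subst (λ z → Intact (rot z (bone b))) (≡-sym (ℕ.+-suc d t)) ok'))
      where
      next : rot 1 (rot t (bone b)) ≡ rot (suc t) (bone b)
      next = trans (rot-rot 1 t (bone b)) (cong (λ z → rot z (bone b)) (ℕ.+-comm t 1))
      ok₁ : Intact (rot (suc t) (bone b))
      ok₁ = a≢ , λ eq → ℕ.0≢1+n (rot-<-injective (bone b) (ℕ.≤-<-trans z≤n lt)
        (ℕ.≤-<-trans (s≤s (ℕ.m≤n+m t d)) lt) (trans (rot-0 (bone b)) eq))
    hub-rot (suc zero)    t 0<t lt ok ok' | yes a≡ = contradiction a≡ (proj₁ ok')
    hub-rot (suc (suc d)) t 0<t lt ok ok' | yes a≡ =
      subst (λ z → Path Ok (hub (rot t (bone b))) (hub z)) next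
        (hub-stride pole (rot t (bone b)) ok (subst Intact (≡-sym next) ok₂))
      ++ subst (λ z → Path Ok (hub (rot (2 + t) (bone b))) (hub (rot z (bone b)))) shift
           (hub-rot d (2 + t) (s≤s z≤n) (subst (_< P) (≡-sym shift) lt) ok₂
             (subst (λ z → Intact (rot z (bone b))) (≡-sym shift) ok'))
      where
      shift : d + (2 + t) ≡ 2 + d + t
      shift = trans (ℕ.+-suc d (suc t)) (cong suc (ℕ.+-suc d t))
      2+t<P : 2 + t < P
      2+t<P = ℕ.≤-<-trans (s≤s (s≤s (ℕ.m≤n+m t d))) lt
      next : rot 2 (rot t (bone b)) ≡ rot (2 + t) (bone b)
      next = trans (rot-rot 2 t (bone b)) (cong (λ z → rot z (bone b)) (ℕ.+-comm t 2))
      ok₂ : Intact (rot (2 + t) (bone b))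
      ok₂ = (λ eq → ℕ.1+n≢n (≡-sym (rot-<-injective (bone b) (ℕ.<-trans (ℕ.n<1+n _) 2+t<P) 2+t<P (trans (≡-sym a≡) eq))))
          , (λ eq → ℕ.0≢1+n (rot-<-injective (bone b) (ℕ.≤-<-trans z≤n lt) 2+t<P (trans (rot-0 (bone b)) eq)))

    hub-rot-≤ : ∀ {t t'} → t ≤ t' → t' < P → Intact (rot t (bone b)) → Intact (rot t' (bone b)) →
      Path Ok (hub (rot t (bone b))) (hub (rot t' (bone b)))
    hub-rot-≤ {zero}       t≤t' t'<P ok ok' = contradiction (≡-sym (rot-0 (bone b))) (proj₂ ok)
    hub-rot-≤ {suc t} {t'} t≤t' t'<P ok ok' with d ← t' ∸ suc t | refl ← ℕ.m∸n+n≡m t≤t' =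
      hub-rot d (suc t) (s≤s z≤n) t'<P ok ok'

    hubs-connected : ∀ q q' → Intact q → Intact q' → Path Ok (hub q) (hub q')
    hubs-connected q q' ok ok' with rot-reaches (bone b) q | rot-reaches (bone b) q'
    ... | t , t<P , refl | t' , t'<P , refl with ℕ.≤-total t t'
    ...   | inj₁ t≤t' = hub-rot-≤ t≤t' t'<P ok ok'
    ...   | inj₂ t'≤t = reverse (hub-rot-≤ t'≤t t<P ok' ok)

    connected : ∀ u v → Ok u → Ok v → Path Ok u v
    connected u v ok-u ok-v with w , u⇝w , ok ← escape u ok-u | w' , v⇝w' , ok' ← escape v ok-v =
      u⇝w ++ to-hub w ok ++ hubs-connected (bone w) (bone w') ok ok' ++ reverse (v⇝w' ++ to-hub w' ok')

-- Cycle lengths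

last-agreement : (f : ℕ → Bool) (b : Bool) → ∀ d a → f a ≡ b → f (d + a) ≢ b →
  Σ ℕ λ i → a ≤ i × i < d + a × f i ≡ b × f (suc i) ≢ b
last-agreement f b zero    a eq neq = contradiction eq neq
last-agreement f b (suc d) a eq neq with f (suc a) Bool.≟ b
... | no  neq' = a , ℕ.≤-refl , s≤s (ℕ.m≤n+m a d) , eq , neq'
... | yes eq' with i , a<i , i<d+a , fi , fsi ← last-agreement f b d (suc a) eq' (neq ∘ trans (cong f (≡-sym (ℕ.+-suc d a))))
  = i , ℕ.<⇒≤ a<i , subst (i <_) (ℕ.+-suc d a) i<d+a , fi , fsi

-- A discrete intermediate value theorem: a sequence that rises by at most one per step skips no
-- value on its way up.
ascend : (f : ℕ → ℕ) → (∀ i → f (suc i) ≤ suc (f i)) → ∀ t d a → f a ≤ t → t ≤ f (d + a) →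
  Σ ℕ λ i → a ≤ i × i ≤ d + a × f i ≡ t
ascend f lip t zero    a le ge = a , ℕ.≤-refl , ℕ.≤-refl , ℕ.≤-antisym le ge
ascend f lip t (suc d) a le ge with ℕ.m≤n⇒m<n∨m≡n le
... | inj₂ eq = a , ℕ.≤-refl , ℕ.m≤n+m a (suc d) , eq
... | inj₁ lt with i , a<i , i≤ , eq ← ascend f lip t d (suc a) (ℕ.≤-trans (lip a) lt) (subst (λ z → t ≤ f z) (≡-sym (ℕ.+-suc d a)) ge)
  = i , ℕ.<⇒≤ a<i , subst (i ≤_) (ℕ.+-suc d a) i≤ , eq

descend : (f : ℕ → ℕ) → (∀ i → f i ≤ suc (f (suc i))) → ∀ t d a → t ≤ f a → f (d + a) ≤ t →
  Σ ℕ λ i → a ≤ i × i ≤ d + a × f i ≡ t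
descend f lip t zero    a ge le = a , ℕ.≤-refl , ℕ.≤-refl , ℕ.≤-antisym le ge
descend f lip t (suc d) a ge le with ℕ.m≤n⇒m<n∨m≡n ge
... | inj₂ eq = a , ℕ.≤-refl , ℕ.m≤n+m a (suc d) , ≡-sym eq
... | inj₁ gt with i , a<i , i≤ , eq ← descend f lip t d (suc a) (ℕ.s≤s⁻¹ (ℕ.≤-trans gt (lip a))) (subst (λ z → f z ≤ t) (≡-sym (ℕ.+-suc d a)) le)
  = i , ℕ.<⇒≤ a<i , subst (i ≤_) (ℕ.+-suc d a) i≤ , eq

module ClosedWalk {V : Set} (_~_ : V → V → Set) (~-sym : ∀ {u v} → u ~ v → v ~ u) where

  -- Cycles as periodic walks, so that they can be rotated.
  record Closed (m : ℕ) (w : ℕ → V) : Set where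
    field
      3≤m       : 3 ≤ m
      adjacent  : ∀ i → w i ~ w (suc i)
      periodic  : ∀ i → w (i + m) ≡ w i
      injective : ∀ {i j} → i < m → j < m → w i ≡ w j → i ≡ j

  open Closed public

  shift : ∀ {m w} → Closed m w → ∀ s → Closed m (λ i → w (i + s))
  shift {m} {w} c s .3≤m = c .3≤m
  shift {m} {w} c s .adjacent i = c .adjacent (i + s)
  shift {m} {w} c s .periodic i = trans (cong w i+m+s≡i+s+m) (c .periodic (i + s))
    where
    i+m+s≡i+s+m : i + m + s ≡ i + s + m
    i+m+s≡i+s+m = trans (ℕ.+-assoc i m s) (trans (cong (i +_) (ℕ.+-comm m s)) (≡-sym (ℕ.+-assoc i s m)))
  shift {m} {w} c zero .injective {i} {j} i<m j<m eq =
    c .injective i<m j<m (trans (cong w (≡-sym (ℕ.+-identityʳ i))) (trans eq (cong w (ℕ.+-identityʳ j))))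
  -- Rotation by one place at a time: only the position m - 1 wraps around, and it then coincides
  -- with position 0.
  shift {m} {w} c (suc s) .injective {i} {j} i<m j<m eq =
    go (ℕ.m≤n⇒m<n∨m≡n i<m) (ℕ.m≤n⇒m<n∨m≡n j<m)
    where
    w' : ℕ → V
    w' i = w (i + s)
    c' : Closed m w'
    c' = shift c s
    0<m : 0 < m
    0<m = ℕ.≤-trans (s≤s z≤n) (c .3≤m)
    eq' : w' (suc i) ≡ w' (suc j)
    eq' = trans (cong w (≡-sym (ℕ.+-suc i s))) (trans eq (cong w (ℕ.+-suc j s)))
    go : suc i < m ⊎ suc i ≡ m → suc j < m ⊎ suc j ≡ m → i ≡ j
    go (inj₁ i+1<m) (inj₁ j+1<m) = ℕ.suc-injective (c' .injective i+1<m j+1<m eq')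
    go (inj₁ i+1<m) (inj₂ refl)  = contradiction (c' .injective i+1<m 0<m (trans eq' (c' .periodic 0))) λ ()
    go (inj₂ refl)  (inj₁ j+1<m) = contradiction (c' .injective j+1<m 0<m (trans (≡-sym eq') (c' .periodic 0))) λ ()
    go (inj₂ refl)  (inj₂ refl)  = refl

  module _ {m : ℕ} {w : ℕ → V} (c : Closed m w) where

    instance
      m-nonZero : NonZero m
      m-nonZero = ℕ.>-nonZero (ℕ.≤-trans (s≤s z≤n) (c .3≤m))

    On : V → Set
    On v = Σ ℕ λ i → w i ≡ v

    periodic* : ∀ i a → w (i + a * m) ≡ w i
    periodic* i zero    = cong w (ℕ.+-identityʳ i)
    periodic* i (suc a) = trans (cong w i+[m+am]≡i+am+m) (trans (c .periodic (i + a * m)) (periodic* i a))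
      where
      i+[m+am]≡i+am+m : i + (m + a * m) ≡ i + a * m + m
      i+[m+am]≡i+am+m = trans (cong (i +_) (ℕ.+-comm m (a * m))) (≡-sym (ℕ.+-assoc i (a * m) m))

    w-% : ∀ i → w (i % m) ≡ w i
    w-% i = trans (≡-sym (periodic* (i % m) (i / m))) (cong w (≡-sym (m≡m%n+[m/n]*n i m)))

    count : ∀ {M} (g : Fin M → V) → (∀ {x y} → g x ≡ g y → x ≡ y) → (∀ x → On (g x)) → M ≤ m
    count {M} g g-injective on = Fin.injective⇒≤ {f = position} position-injective
      where
      position : Fin M → Fin m
      position x = fromℕ< (m%n<n (proj₁ (on x)) m)
      at : ∀ x → w (toℕ (position x)) ≡ g x
      at x = trans (cong w (Fin.toℕ-fromℕ< (m%n<n (proj₁ (on x)) m))) (trans (w-% (proj₁ (on x))) (proj₂ (on x)))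
      position-injective : ∀ {x y} → position x ≡ position y → x ≡ y
      position-injective {x} {y} eq = g-injective (trans (≡-sym (at x)) (trans (cong (w ∘ toℕ) eq) (at y)))

    count₂ : ∀ {M} (g : Fin M → Fin 2 → V) → (∀ {i s j t} → g i s ≡ g j t → i ≡ j × s ≡ t) →
      (∀ i s → On (g i s)) → M * 2 ≤ m
    count₂ {M} g g-injective on = count (λ x → g (proj₁ (remQuot {M} 2 x)) (proj₂ (remQuot {M} 2 x)))
      (λ {x} {y} eq → let p , p' = g-injective eq in
        trans (≡-sym (Fin.combine-remQuot {M} 2 x)) (trans (cong₂ combine p p') (Fin.combine-remQuot {M} 2 y)))
      (λ x → on _ _)

    Uses : V → V → Set
    Uses u v = Σ ℕ λ i → (w i ≡ u × w (suc i) ≡ v) ⊎ (w i ≡ v × w (suc i) ≡ u)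

    Uses-sym : ∀ {u v} → Uses u v → Uses v u
    Uses-sym (i , inj₁ p) = i , inj₂ p
    Uses-sym (i , inj₂ p) = i , inj₁ p

    Uses⇒Onˡ : ∀ {u v} → Uses u v → On u
    Uses⇒Onˡ (i , inj₁ (p , _)) = i , p
    Uses⇒Onˡ (i , inj₂ (_ , p)) = suc i , p

    Uses⇒Onʳ : ∀ {u v} → Uses u v → On v
    Uses⇒Onʳ = Uses⇒Onˡ ∘ Uses-sym

  On-from : ∀ {m w} (c : Closed m w) {v} → On c v → ∀ s → Σ ℕ λ i → i < m × w (i + s) ≡ v
  On-from {suc l} {w} c {v} (i , wi) s =
    -- Subtraction of `s` modulo the length: the length is l + 1, so adding `s * l` has the same
    -- effect.
    (i + s * l) % suc l , m%n<n (i + s * l) (suc l) , trans (w-% (shift c s) (i + s * l)) (trans (cong w shifted) (trans (periodic* c i s) wi))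
    where
    shifted : i + s * l + s ≡ i + s * suc l
    shifted = trans (ℕ.+-assoc i (s * l) s) (cong (i +_) (trans (ℕ.+-comm (s * l) s) (≡-sym (ℕ.*-suc s l))))
  On-from {zero} c _ s = contradiction (c .3≤m) λ ()

  -- By periodicity `S` has to regain its initial value within one period. The step where this
  -- happens is not the first step reversed, because a cycle has length at least 3.
  step-crosses-back : ∀ {m w} → Closed m w → (S : V → Bool) → S (w 0) ≢ S (w 1) →
    Σ ℕ λ i → S (w i) ≡ S (w 1) × S (w (suc i)) ≡ S (w 0) × ¬ (w i ≡ w 1 × w (suc i) ≡ w 0)
  step-crosses-back {m} {w} c S S0≢S1 =
    let i , _ , i<m , Si , Ssi = last-agreement (S ∘ w) (S (w 1)) (m ∸ 1) 1 refl
          (λ eq → S0≢S1 (trans (cong S (≡-sym (trans (cong w m∸1+1) (c .periodic 0)))) eq))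
    in i , Si , trans (Bool.¬-not Ssi) (≡-sym (Bool.¬-not S0≢S1))
         , λ (p , p') → no-digon i (subst (i <_) m∸1+1 i<m) p p'
    where
    m∸1+1 : m ∸ 1 + 1 ≡ m
    m∸1+1 = ℕ.m∸n+n≡m (ℕ.≤-trans (s≤s z≤n) (c .3≤m))
    no-digon : ∀ i → i < m → w i ≡ w 1 → w (suc i) ≡ w 0 → ⊥
    no-digon i i<m p p' with c .injective i<m (ℕ.≤-trans (s≤s (s≤s z≤n)) (c .3≤m)) p
    ... | refl = contradiction (c .injective (c .3≤m) (ℕ.≤-trans (s≤s z≤n) (c .3≤m)) p') λ ()

  -- A cycle crosses every cut an even number of times.
  crosses-again : ∀ {m w} (c : Closed m w) (S : V → Bool) {u v} → Uses c u v → S u ≢ S v →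
    Σ V λ u' → Σ V λ v' → Uses c u' v' × u' ~ v' × S u' ≡ S u × S v' ≡ S v × ¬ (u' ≡ u × v' ≡ v)
  crosses-again c S (i , inj₁ (refl , refl)) Su≢Sv with step-crosses-back (shift c i) S Su≢Sv
  ... | j , Sj , Ssj , different =
    _ , _ , (j + i , inj₂ (refl , refl)) , ~-sym (c .adjacent (j + i)) , Ssj , Sj , λ (p , p') → different (p' , p)
  crosses-again c S (i , inj₂ (refl , refl)) Su≢Sv with step-crosses-back (shift c i) S (Su≢Sv ∘ ≡-sym)
  ... | j , Sj , Ssj , different =
    _ , _ , (j + i , inj₁ (refl , refl)) , c .adjacent (j + i) , Sj , Ssj , different

  neighbours-on : ∀ {m w} (c : Closed m w) {v} → On c v →
    Σ V λ u → Σ V λ u' → On c u × On c u' × v ~ u × v ~ u' × u ≢ u'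
  neighbours-on {zero} c _ = contradiction (c .3≤m) λ ()
  neighbours-on {suc l} {w} c (i , refl) =
    w (l + i) , w (suc i) , (l + i , refl) , (suc i , refl) ,
    ~-sym (subst (w (l + i) ~_) (c' .periodic 0) (c' .adjacent l)) , c .adjacent i , distinct
    where
    c' : Closed (suc l) (λ j → w (j + i))
    c' = shift c i
    distinct : w (l + i) ≢ w (suc i)
    distinct p with c' .injective ℕ.≤-refl (ℕ.≤-trans (s≤s (s≤s z≤n)) (c .3≤m)) p
    ... | refl = contradiction (c .3≤m) λ { (s≤s (s≤s ())) }

-- Cuts and levels in the graph of bones

module Cycles (κ n : ℕ) (2<n : 2 < n) where
  open Bones κ n 2<n
  open ClosedWalk _~_ ~-sym

  data Exit : V → V → Set where
    spine : ∀ q h → Exit (vert q h apex) (vert q (not h) apex)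
    ring  : ∀ q h s → Exit (vert q h (rail s top)) (across q h s)

  SameFragment : V → V → Set
  SameFragment u v = bone v ≡ bone u × half v ≡ half u

  stay-or-exit : ∀ {u v} → u ~ v → SameFragment u v ⊎ Exit u v
  stay-or-exit {u} {v} u~v = go u (~⇒Nb u~v)
    where
    go : ∀ u → Nb u v → SameFragment u v ⊎ Exit u v
    go (vert q h apex)             (inj₁ refl)        = inj₂ (spine q h)
    go (vert q h apex)             (inj₂ (inj₁ refl)) = inj₁ (refl , refl)
    go (vert q h apex)             (inj₂ (inj₂ refl)) = inj₁ (refl , refl)
    go (vert q h (rail s j))       (inj₁ refl)        = inj₁ (refl , refl)
    go (vert q h (rail s zero))    (inj₂ (inj₁ refl)) = inj₁ (refl , refl)
    go (vert q h (rail s (suc i))) (inj₂ (inj₁ refl)) = inj₁ (refl , refl)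
    go (vert q h (rail s j))       (inj₂ (inj₂ eq)) with view j | eq
    ... | ‵fromℕ     | refl = inj₂ (ring q h s)
    ... | ‵inject₁ i | refl = inj₁ (refl , refl)

  inFragment : Fin P → Bool → V → Bool
  inFragment q h v = isYes (bone v Fin.≟ q) ∧ isYes (half v Bool.≟ h)

  inFragment-true : ∀ {q h} v → inFragment q h v ≡ true → bone v ≡ q × half v ≡ h
  inFragment-true {q} {h} v eq with bone v Fin.≟ q | half v Bool.≟ h
  ... | yes p | yes p' = p , p'

  inFragment-self : ∀ q h f → inFragment q h (vert q h f) ≡ true
  inFragment-self q h f with q Fin.≟ q | h Bool.≟ h
  ... | yes _ | yes _ = refl
  ... | no ¬p | _     = contradiction refl ¬p
  ... | yes _ | no ¬p = contradiction refl ¬p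

  inFragment-bone≢ : ∀ {q h} v → bone v ≢ q → inFragment q h v ≡ false
  inFragment-bone≢ {q} v v≢q with bone v Fin.≟ q
  ... | yes p = contradiction p v≢q
  ... | no _  = refl

  inFragment-half≢ : ∀ {q h} v → half v ≢ h → inFragment q h v ≡ false
  inFragment-half≢ {q} {h} v v≢h with bone v Fin.≟ q | half v Bool.≟ h
  ... | _     | yes p = contradiction p v≢h
  ... | yes _ | no _  = refl
  ... | no _  | no _  = refl

  module Level (p : Bool) where

    -- Bones of parity `p` are spread out by the distance from the middle ring, all others are
    -- collapsed to level 0. A middle ring edge then joins the levels 0 and 1, and a pole ring edge,
    -- joining bones of equal parity, keeps the level; so adjacent vertices differ by at most one
    -- level.
    level : V → ℕ
    level (vert q h f) with parity q Bool.≟ p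
    ... | yes _ = suc (dist h f)
    ... | no  _ = 0

    level-≡ : ∀ q h f → parity q ≡ p → level (vert q h f) ≡ suc (dist h f)
    level-≡ q h f eq with parity q Bool.≟ p
    ... | yes _ = refl
    ... | no ¬p = contradiction eq ¬p

    level-≢ : ∀ q h f → parity q ≢ p → level (vert q h f) ≡ 0
    level-≢ q h f neq with parity q Bool.≟ p
    ... | yes eq = contradiction eq neq
    ... | no _   = refl

    Close : ℕ → ℕ → Set
    Close a b = a ≤ suc b × b ≤ suc a

    close-≡ : ∀ {a b} → a ≡ b → Close a b
    close-≡ refl = ℕ.n≤1+n _ , ℕ.n≤1+n _

    close-suc : ∀ {a b} → b ≡ suc a → Close a b
    close-suc refl = ℕ.m≤n+m _ 2 , ℕ.≤-refl

    close-sym : ∀ {a b} → Close a b → Close b a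
    close-sym (p , q) = q , p

    within : ∀ q h h' f f' → Close (dist h f) (dist h' f') → Close (level (vert q h f)) (level (vert q h' f'))
    within q h h' f f' (le , le') with parity q Bool.≟ p
    ... | yes _ = s≤s le , s≤s le'
    ... | no  _ = z≤n , z≤n

    E-close : ∀ {u v} → E u v → Close (level u) (level v)
    E-close (spine q)         = within q mid pole apex apex (close-suc refl)
    E-close (foot q mid s)    = within q mid mid apex (rail s zero) (close-sym (close-suc refl))
    E-close (foot q pole s)   = within q pole pole apex (rail s zero) (close-suc (cong (3 +_) (ℕ.+-identityʳ κ)))
    E-close (rung q mid j)    = within q mid mid (rail lo j) (rail up j) (close-≡ refl)
    E-close (rung q pole j)   = within q pole pole (rail lo j) (rail up j) (close-≡ refl)
    E-close (rail q mid s i)  = within q mid mid (rail s (inject₁ i)) (rail s (suc i))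
      (close-sym (close-suc (trans (cong (κ ∸_) (Fin.toℕ-inject₁ i)) (ℕ.+-∸-assoc 1 (Fin.toℕ<n i)))))
    E-close (rail q pole s i) = within q pole pole (rail s (inject₁ i)) (rail s (suc i))
      (close-suc (trans (ℕ.+-suc (3 + κ) (toℕ i)) (cong (λ z → 4 + κ + z) (≡-sym (Fin.toℕ-inject₁ i)))))
    E-close (ring q mid) with parity q Bool.≟ p | parity (rot 1 q) Bool.≟ p
    ... | yes _ | yes _ = close-≡ refl
    ... | yes _ | no  _ rewrite Fin.toℕ-fromℕ κ | ℕ.n∸n≡0 κ = ℕ.≤-refl , z≤n
    ... | no  _ | yes _ rewrite Fin.toℕ-fromℕ κ | ℕ.n∸n≡0 κ = z≤n , ℕ.≤-refl
    ... | no  _ | no  _ = z≤n , z≤n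
    E-close (ring q pole) with parity q Bool.≟ p | parity (rot 2 q) Bool.≟ p
    ... | yes _ | yes _ = close-≡ refl
    ... | yes e | no ne = contradiction (trans (parity-rot-2 q) e) ne
    ... | no ne | yes e = contradiction (trans (≡-sym (parity-rot-2 q)) e) ne
    ... | no  _ | no  _ = z≤n , z≤n

    ~-close : ∀ {u v} → u ~ v → Close (level u) (level v)
    ~-close (inj₁ e) = E-close e
    ~-close (inj₂ e) = close-sym (E-close e)

    level-0⇒parity≢ : ∀ v → level v ≡ 0 → parity (bone v) ≢ p
    level-0⇒parity≢ (vert q h f) eq e with () ← trans (≡-sym eq) (level-≡ q h f e)

    exit-level-0 : ∀ {u v} → level v ≡ 0 → v ~ u → level u ≢ level v → u ≡ nb₂ v
    exit-level-0 {u} {v} v≡0 v~u u≢v with stay-or-exit v~u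
    exit-level-0 {vert q h f} {v} v≡0 v~u u≢v | inj₁ (refl , refl) =
      contradiction (trans (level-≢ q h f (level-0⇒parity≢ v v≡0)) (≡-sym v≡0)) u≢v
    exit-level-0 v≡0 v~u u≢v | inj₂ (spine q h) =
      contradiction (trans (level-≢ q (not h) apex (level-0⇒parity≢ (vert q h apex) v≡0)) (≡-sym v≡0)) u≢v
    exit-level-0 v≡0 v~u u≢v | inj₂ (ring q h s) = cong (outward q h s) (≡-sym (view-fromℕ κ))

    max-level : ℕ
    max-level = 4 + κ + κ

    at-max : ∀ v → level v ≡ max-level → Σ Bool λ s → v ≡ vert (bone v) pole (rail s top) × parity (bone v) ≡ p
    at-max (vert q h f) eq with parity q Bool.≟ p
    ... | yes e = let s , h≡ , f≡ = invert h f (ℕ.suc-injective eq) in s , cong₂ (vert q) h≡ f≡ , e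
      where
      invert : ∀ h f → dist h f ≡ 3 + κ + κ → Σ Bool λ s → h ≡ pole × f ≡ rail s top
      invert mid  (rail s j) eq = contradiction eq (ℕ.<⇒≢ (s≤s (ℕ.≤-trans (ℕ.m∸n≤m κ (toℕ j)) (ℕ.≤-trans (ℕ.m≤m+n κ κ) (ℕ.m≤n+m (κ + κ) 2)))))
      invert mid  apex       eq = contradiction eq (ℕ.<⇒≢ (s≤s (s≤s (ℕ.≤-trans (ℕ.m≤m+n κ κ) (ℕ.n≤1+n _)))))
      invert pole apex       eq = contradiction eq (ℕ.<⇒≢ (s≤s (s≤s (s≤s (ℕ.m≤m+n κ κ)))))
      invert pole (rail s j) eq = s , refl , cong (rail s) (Fin.toℕ-injective (trans (ℕ.+-cancelˡ-≡ (3 + κ) (toℕ j) κ eq) (≡-sym (Fin.toℕ-fromℕ κ))))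

    level-pole-top : ∀ q s → parity q ≡ p → level (vert q pole (rail s top)) ≡ max-level
    level-pole-top q s e = trans (level-≡ q pole (rail s top) e) (cong (λ z → 4 + κ + z) (Fin.toℕ-fromℕ κ))

    exit-max-level : ∀ {u v} → level v ≡ max-level → v ~ u → level u ≢ level v → u ≡ nb₁ v
    exit-max-level {u} {v} v≡max v~u u≢v with at-max v v≡max
    ... | s , refl , e with ~⇒Nb v~u
    ...   | inj₁ refl        = contradiction (trans (level-pole-top _ (not s) e) (≡-sym v≡max)) u≢v
    ...   | inj₂ (inj₁ eq)   = eq
    ...   | inj₂ (inj₂ refl) rewrite view-fromℕ κ = contradiction (trans (across-max s) (≡-sym v≡max)) u≢v
      where
      across-max : ∀ s → level (across (bone v) pole s) ≡ max-level
      across-max up = level-pole-top _ lo (trans (parity-rot-2 _) e)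
      across-max lo = level-pole-top _ up (trans (≡-sym (parity-rot-2 _)) (trans (cong parity (rot-cancel (ℕ.m∸n+n≡m (stride≤P pole)) _)) e))

    module _ {m : ℕ} {w : ℕ → V} (c : Closed m w) where

      TwoAt : ℕ → Set
      TwoAt t = Σ V λ u → Σ V λ u' → On c u × On c u' × u ≢ u' × level u ≡ t × level u' ≡ t

      -- At the lowest and at the highest level a vertex has at most one neighbour on a different
      -- level, so one of its two neighbours on the cycle shares its level.
      two-at-extreme : ∀ {v v'} → On c v → (∀ {u} → v ~ u → level u ≢ level v → u ≡ v') → TwoAt (level v)
      two-at-extreme {v} on exit with neighbours-on c on
      ... | u , u' , on-u , on-u' , v~u , v~u' , u≢u' with level u ℕ.≟ level v | level u' ℕ.≟ level v
      ...   | yes p | _      = v , u , on , on-u , ~-irrefl v~u , refl , p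
      ...   | no _  | yes p' = v , u' , on , on-u' , ~-irrefl v~u' , refl , p'
      ...   | no ¬p | no ¬p' = contradiction (trans (exit v~u ¬p) (≡-sym (exit v~u' ¬p'))) u≢u'

      -- Rotated to start at level 0, the cycle meets level `t` once before it reaches the maximum
      -- and once more on its return.
      two-between : ∀ {v v'} → On c v → On c v' → level v ≡ 0 → level v' ≡ max-level →
        ∀ t → 0 < t → t < max-level → TwoAt t
      two-between {v' = v'} (s , refl) on' v≡0 v'≡max t 0<t t<max =
        w' i , w' j , (i + s , refl) , (j + s , refl) ,
        (λ eq → ℕ.<⇒≢ (ℕ.<-trans i<i₁ i₁<j) (c' .injective (ℕ.<-trans i<i₁ i₁<m) j<m eq)) , fi , fj
        where
        w' : ℕ → V
        w' i = w (i + s)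
        c' : Closed m w'
        c' = shift c s
        f : ℕ → ℕ
        f i = level (w' i)
        i₁ : ℕ
        i₁ = proj₁ (On-from c on' s)
        i₁<m : i₁ < m
        i₁<m = proj₁ (proj₂ (On-from c on' s))
        f-i₁ : f i₁ ≡ max-level
        f-i₁ = trans (cong level (proj₂ (proj₂ (On-from c on' s)))) v'≡max
        m-i₁+i₁ : m ∸ i₁ + i₁ ≡ m
        m-i₁+i₁ = ℕ.m∸n+n≡m (ℕ.<⇒≤ i₁<m)
        f-m : f m ≡ 0
        f-m = trans (cong level (c' .periodic 0)) v≡0
        rise : Σ ℕ λ i → 0 ≤ i × i ≤ i₁ + 0 × f i ≡ t
        rise = ascend f (λ i → proj₂ (~-close (c' .adjacent i))) t i₁ 0 (ℕ.≤-trans (ℕ.≤-reflexive v≡0) z≤n)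
          (ℕ.≤-trans (ℕ.<⇒≤ t<max) (ℕ.≤-reflexive (≡-sym (trans (cong f (ℕ.+-identityʳ i₁)) f-i₁))))
        fall : Σ ℕ λ j → i₁ ≤ j × j ≤ m ∸ i₁ + i₁ × f j ≡ t
        fall = descend f (λ i → proj₁ (~-close (c' .adjacent i))) t (m ∸ i₁) i₁ (ℕ.≤-trans (ℕ.<⇒≤ t<max) (ℕ.≤-reflexive (≡-sym f-i₁)))
          (ℕ.≤-trans (ℕ.≤-reflexive (trans (cong f m-i₁+i₁) f-m)) z≤n)
        i j : ℕ
        i = proj₁ rise
        j = proj₁ fall
        fi : f i ≡ t
        fi = proj₂ (proj₂ (proj₂ rise))
        fj : f j ≡ t
        fj = proj₂ (proj₂ (proj₂ fall))
        i<i₁ : i < i₁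
        i<i₁ = ℕ.≤∧≢⇒< (ℕ.≤-trans (proj₁ (proj₂ (proj₂ rise))) (ℕ.≤-reflexive (ℕ.+-identityʳ i₁)))
          (λ eq → ℕ.<⇒≢ t<max (trans (≡-sym fi) (trans (cong f eq) f-i₁)))
        i₁<j : i₁ < j
        i₁<j = ℕ.≤∧≢⇒< (proj₁ (proj₂ fall)) (λ eq → ℕ.<⇒≢ t<max (trans (≡-sym fj) (trans (cong f (≡-sym eq)) f-i₁)))
        j<m : j < m
        j<m = ℕ.≤∧≢⇒< (ℕ.≤-trans (proj₁ (proj₂ (proj₂ fall))) (ℕ.≤-reflexive m-i₁+i₁))
          (λ eq → ℕ.<⇒≢ 0<t (trans (≡-sym f-m) (trans (cong f (≡-sym eq)) fj)))

      -- Two vertices on each of the levels from 0 to `max-level`. As `max-level` is 2k for k = κ +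
      -- 2, this makes 4k + 2 vertices.
      span-bound : ∀ {v v'} → On c v → On c v' → level v ≡ 0 → level v' ≡ max-level → suc max-level * 2 ≤ m
      span-bound {v} {v'} on on' v≡0 v'≡max = count₂ c pick pick-injective pick-on
        where
        two : (t : Fin (suc max-level)) → TwoAt (toℕ t)
        two t with ℕ.m≤n⇒m<n∨m≡n (ℕ.s≤s⁻¹ (Fin.toℕ<n t))
        ... | inj₂ t≡max = subst TwoAt (trans v'≡max (≡-sym t≡max)) (two-at-extreme on' (exit-max-level v'≡max))
        two zero    | inj₁ t<max = subst TwoAt v≡0 (two-at-extreme on (exit-level-0 v≡0))
        two (suc t) | inj₁ t<max = two-between on on' v≡0 v'≡max _ (s≤s z≤n) t<max
        pick : Fin (suc max-level) → Fin 2 → V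
        pick t 0F = proj₁ (two t)
        pick t 1F = proj₁ (proj₂ (two t))
        pick-level : ∀ t s → level (pick t s) ≡ toℕ t
        pick-level t 0F = proj₁ (proj₂ (proj₂ (proj₂ (proj₂ (proj₂ (two t))))))
        pick-level t 1F = proj₂ (proj₂ (proj₂ (proj₂ (proj₂ (proj₂ (two t))))))
        pick-on : ∀ t s → On c (pick t s)
        pick-on t 0F = proj₁ (proj₂ (proj₂ (two t)))
        pick-on t 1F = proj₁ (proj₂ (proj₂ (proj₂ (two t))))
        pick-injective : ∀ {t s t' s'} → pick t s ≡ pick t' s' → t ≡ t' × s ≡ s'
        pick-injective {t} {s} {t'} {s'} eq with Fin.toℕ-injective (trans (≡-sym (pick-level t s)) (trans (cong level eq) (pick-level t' s')))
        pick-injective {t} {0F} {_} {0F} eq | refl = refl , refl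
        pick-injective {t} {1F} {_} {1F} eq | refl = refl , refl
        pick-injective {t} {0F} {_} {1F} eq | refl = contradiction eq (proj₁ (proj₂ (proj₂ (proj₂ (proj₂ (two t))))))
        pick-injective {t} {1F} {_} {0F} eq | refl = contradiction (≡-sym eq) (proj₁ (proj₂ (proj₂ (proj₂ (proj₂ (two t))))))

  module _ {m : ℕ} {w : ℕ → V} (c : Closed m w) where

    -- The spoke is one of the three edges leaving the fragment, so the second crossing of this cut
    -- is a ring edge.
    spine⇒ring : ∀ q h → Uses c (vert q h apex) (vert q (not h) apex) →
      Σ Bool λ s → Uses c (vert q h (rail s top)) (across q h s)
    spine⇒ring q h uses with crosses-again c (inFragment q h) uses
      (λ eq → contradiction (trans (≡-sym (inFragment-self q h apex)) (trans eq (inFragment-half≢ (vert q (not h) apex) (Bool.not-¬ refl ∘ ≡-sym)))) λ ())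
    ... | u' , v' , uses' , u'~v' , Su' , Sv' , different
      with inFragment-true u' (trans Su' (inFragment-self q h apex)) | stay-or-exit u'~v'
    ...   | refl , refl | inj₁ (refl , refl) = contradiction
      (trans (≡-sym (inFragment-self q h (frag v'))) (trans Sv' (inFragment-half≢ (vert q (not h) apex) (Bool.not-¬ refl ∘ ≡-sym)))) λ ()
    ...   | refl , refl | inj₂ (spine _ _)  = contradiction (refl , refl) different
    ...   | refl , refl | inj₂ (ring _ _ s) = s , uses'

    -- Levels are taken for the parity of `q`. The middle ring edge that is used leads to a bone of
    -- the other parity, hence to level 0, and the pole ring edge starts at the maximal level.
    spine-bound : ∀ q → Uses c (vert q mid apex) (vert q pole apex) → (5 + κ + κ) * 2 ≤ m
    spine-bound q uses with spine⇒ring q mid uses | spine⇒ring q pole (Uses-sym c uses)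
    ... | s , uses₀ | s' , uses₁ = span-bound c (Uses⇒Onʳ c uses₀) (Uses⇒Onˡ c uses₁) (across-0 s) (level-pole-top q s' refl)
      where
      open Level (parity q)
      across-0 : ∀ s → level (across q mid s) ≡ 0
      across-0 up = level-≢ _ mid _ (λ eq → Bool.not-¬ refl (trans (≡-sym eq) (parity-rot-1 q)))
      across-0 lo = level-≢ _ mid _ (λ eq → Bool.not-¬ refl
        (trans eq (trans (cong parity (≡-sym (rot-cancel (ℕ.m∸n+n≡m (stride≤P mid)) q))) (parity-rot-1 _))))

    RingUsed : Fin P → Bool → Set
    RingUsed q h = Uses c (vert q h (rail up top)) (across q h up)

    module _ (no-spine : ∀ q h → ¬ Uses c (vert q h apex) (vert q (not h) apex)) where

      -- The cycle enters the next fragment at its `lo` end; with the spoke excluded, only the `up`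
      -- end is left to leave by.
      ring-next : ∀ q h → RingUsed q h → RingUsed (rot (stride h) q) h
      ring-next q h uses with crosses-again c (inFragment (rot (stride h) q) h) (Uses-sym c uses)
        (λ eq → contradiction (trans (≡-sym (inFragment-self _ h (rail lo top))) (trans eq (inFragment-bone≢ (vert q h (rail up top)) (rot-stride≢ h q ∘ ≡-sym)))) λ ())
      ... | u' , v' , uses' , u'~v' , Su' , Sv' , different
        with inFragment-true u' (trans Su' (inFragment-self _ h (rail lo top))) | stay-or-exit u'~v'
      ...   | refl , refl | inj₁ (refl , refl) = contradiction
        (trans (≡-sym (inFragment-self _ h (frag v'))) (trans Sv' (inFragment-bone≢ (vert q h (rail up top)) (rot-stride≢ h q ∘ ≡-sym)))) λ ()
      ...   | refl , refl | inj₂ (spine _ _)   = contradiction uses' (no-spine _ _)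
      ...   | refl , refl | inj₂ (ring _ _ up) = uses'
      ...   | refl , refl | inj₂ (ring _ _ lo) = contradiction
        (refl , cong (λ z → vert z h (rail up top)) (rot-cancel (ℕ.m+[n∸m]≡n (stride≤P h)) q)) different

      ring-iterate : ∀ q h → RingUsed q h → ∀ t → RingUsed (rot (t * stride h) q) h
      ring-iterate q h uses zero    = subst (λ z → RingUsed z h) (≡-sym (rot-0 q)) uses
      ring-iterate q h uses (suc t) = subst (λ z → RingUsed z h)
        (trans (rot-rot (stride h) (t * stride h) q) (cong (λ z → rot z q) (ℕ.+-comm (t * stride h) (stride h))))
        (ring-next _ h (ring-iterate q h uses t))

      -- It suffices to follow n consecutive ring edges, which are all of a pole ring but only half
      -- of the middle one. Their 2n ends are distinct, being `up` ends and `lo` ends of distinct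
      -- fragments.
      ring-bound : ∀ q h → RingUsed q h → n * 2 ≤ m
      ring-bound q h uses = count₂ c pick pick-injective pick-on
        where
        at : Fin n → Fin P
        at t = rot (toℕ t * stride h) q
        at-injective : ∀ {t t'} → at t ≡ at t' → t ≡ t'
        at-injective {t} {t'} eq = Fin.toℕ-injective (cancel h (rot-<-injective q (bound h t) (bound h t') eq))
          where
          cancel : ∀ h → toℕ t * stride h ≡ toℕ t' * stride h → toℕ t ≡ toℕ t'
          cancel mid  = ℕ.*-cancelʳ-≡ _ _ 1
          cancel pole = ℕ.*-cancelʳ-≡ _ _ 2
          bound : ∀ h t → toℕ t * stride h < P
          bound mid  t = ℕ.<-≤-trans (subst (_< n) (≡-sym (ℕ.*-identityʳ (toℕ t))) (Fin.toℕ<n t)) (ℕ.m≤m+n n (n + 0))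
          bound pole t = subst (toℕ t * 2 <_) (ℕ.*-comm n 2) (ℕ.*-monoˡ-< 2 (Fin.toℕ<n t))
        pick : Fin n → Fin 2 → V
        pick t 0F = vert (at t) h (rail up top)
        pick t 1F = across (at t) h up
        pick-injective : ∀ {t s t' s'} → pick t s ≡ pick t' s' → t ≡ t' × s ≡ s'
        pick-injective {s = 0F} {s' = 0F} eq = at-injective (cong bone eq) , refl
        pick-injective {s = 1F} {s' = 1F} eq = at-injective (rot-injective (stride h) (stride≤P h) (cong bone eq)) , refl
        pick-injective {s = 0F} {s' = 1F} ()
        pick-injective {s = 1F} {s' = 0F} ()
        pick-on : ∀ t s → On c (pick t s)
        pick-on t 0F = Uses⇒Onˡ c (ring-iterate q h uses (toℕ t))
        pick-on t 1F = Uses⇒Onʳ c (ring-iterate q h uses (toℕ t))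

    fragment-bound : (∀ i → SameFragment (w i) (w (suc i))) → m ≤ 1 + 2 * K
    fragment-bound same = Fin.injective⇒≤ {f = λ (i : Fin m) → Inverse.to Frag↔Fin (frag (w (toℕ i)))} injective'
      where
      same₀ : ∀ i → SameFragment (w 0) (w i)
      same₀ zero    = refl , refl
      same₀ (suc i) with p , p' ← same₀ i | r , r' ← same i = trans r p , trans r' p'
      injective' : ∀ {i j : Fin m} → Inverse.to Frag↔Fin (frag (w (toℕ i))) ≡ Inverse.to Frag↔Fin (frag (w (toℕ j))) → i ≡ j
      injective' {i} {j} eq = Fin.toℕ-injective (c .injective (Fin.toℕ<n i) (Fin.toℕ<n j) (vert-≡
          (trans (proj₁ (same₀ (toℕ i))) (≡-sym (proj₁ (same₀ (toℕ j)))))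
          (trans (proj₂ (same₀ (toℕ i))) (≡-sym (proj₂ (same₀ (toℕ j)))))
          (trans (≡-sym (Inverse.strictlyInverseʳ Frag↔Fin _)) (trans (cong (Inverse.from Frag↔Fin) eq) (Inverse.strictlyInverseʳ Frag↔Fin _)))))
        where
        vert-≡ : ∀ {u v} → bone u ≡ bone v → half u ≡ half v → frag u ≡ frag v → u ≡ v
        vert-≡ refl refl refl = refl

    cycle-gap : 1 + 2 * K < m → m < (5 + κ + κ) * 2 → m < n * 2 → ⊥
    cycle-gap short<m m<spine m<ring = ℕ.<⇒≱ short<m (fragment-bound same)
      where
      no-spine : ∀ q h → ¬ Uses c (vert q h apex) (vert q (not h) apex)
      no-spine q mid  uses = ℕ.<⇒≱ m<spine (spine-bound q uses)
      no-spine q pole uses = ℕ.<⇒≱ m<spine (spine-bound q (Uses-sym c uses))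
      no-ring : ∀ q h → ¬ RingUsed q h
      no-ring q h uses = ℕ.<⇒≱ m<ring (ring-bound no-spine q h uses)
      no-exit : ∀ {u v} → Uses c u v → ¬ Exit u v
      no-exit uses (spine q h)   = no-spine q h uses
      no-exit uses (ring q h up) = no-ring q h uses
      no-exit uses (ring q h lo) = no-ring (rot (P ∸ stride h) q) h (subst
        (λ z → Uses c (vert (rot (P ∸ stride h) q) h (rail up top)) (vert z h (rail lo top)))
        (≡-sym (rot-cancel (ℕ.m∸n+n≡m (stride≤P h)) q)) (Uses-sym c uses))
      same : ∀ i → SameFragment (w i) (w (suc i))
      same i with stay-or-exit (c .adjacent i)
      ... | inj₁ stay = stay
      ... | inj₂ exit = contradiction exit (no-exit (i , inj₁ (refl , refl)))

-- The drawing

module Planarity (κ n : ℕ) (2<n : 2 < n) where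
  open Bones κ n 2<n

  -- Exchanging the halves reverses a bone. Thus the pole rims of the even bones lie in the leftmost
  -- column and those of the odd bones in the rightmost, while the middle ring runs to and fro
  -- between the two central columns.
  column : Bool → Bool → Frag → ℕ
  column false h f = dist (not h) f
  column true  h f = 4 + κ + κ + dist h f

  x : V → ℕ
  x (vert q h f) = column (parity q) h f

  -- Bone q occupies rows q + 1 and q + 2, the even bones to the left of the odd ones.  The last edge of
  -- the middle ring has to return to bone 0 around everything else, so it must reach bone 0 from
  -- below; therefore the rung of bone 0 on the middle ring is moved down by one row.
  Lowered : Fin P → Bool → Fin K → Set
  Lowered q h j = toℕ q ≡ 0 × h ≡ mid × toℕ j ≡ κ

  lowered? : ∀ q h j → Dec (Lowered q h j)
  lowered? q h j = (toℕ q ℕ.≟ 0) ×-dec ((h Bool.≟ mid) ×-dec (toℕ j ℕ.≟ κ))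

  bit : Bool → ℕ
  bit lo = 0
  bit up = 1

  y : V → ℕ
  y (vert q h apex) = suc (toℕ q)
  y (vert q h (rail s j)) with lowered? q h j
  ... | yes _ = bit s
  ... | no  _ = bit s + suc (toℕ q)

  y-lowered : ∀ {q h s j} → Lowered q h j → y (vert q h (rail s j)) ≡ bit s
  y-lowered {q} {h} {s} {j} l with lowered? q h j
  ... | yes _ = refl
  ... | no ¬l = contradiction l ¬l

  y-regular : ∀ {q h s j} → ¬ Lowered q h j → y (vert q h (rail s j)) ≡ bit s + suc (toℕ q)
  y-regular {q} {h} {s} {j} ¬l with lowered? q h j
  ... | yes l = contradiction l ¬l
  ... | no _  = refl

  toℕ-top : toℕ top ≡ κ
  toℕ-top = Fin.toℕ-fromℕ κ

  Outer : Frag → Frag → Set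
  Outer f f' = dist pole f' ≡ suc (dist pole f) × dist mid f ≡ suc (dist mid f')

  outer-foot : ∀ s → Outer apex (rail s zero)
  outer-foot s = cong (3 +_) (ℕ.+-identityʳ κ) , refl

  outer-rail : ∀ s (i : Fin κ) → Outer (rail s (inject₁ i)) (rail s (suc i))
  outer-rail s i = trans (ℕ.+-suc (3 + κ) (toℕ i)) (cong (λ z → 4 + κ + z) (≡-sym (Fin.toℕ-inject₁ i)))
                 , trans (cong (κ ∸_) (Fin.toℕ-inject₁ i)) (ℕ.+-∸-assoc 1 (Fin.toℕ<n i))

  column-outer : ∀ b h {f f'} → Outer f f' →
    (b ≡ h × column b h f' ≡ suc (column b h f)) ⊎ (b ≡ not h × column b h f ≡ suc (column b h f'))
  column-outer false mid  (o , _) = inj₁ (refl , o)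
  column-outer false pole (_ , i) = inj₂ (refl , i)
  column-outer true  mid  (_ , i) = inj₂ (refl , trans (cong (4 + κ + κ +_) i) (ℕ.+-suc (4 + κ + κ) _))
  column-outer true  pole (o , _) = inj₁ (refl , trans (cong (4 + κ + κ +_) o) (ℕ.+-suc (4 + κ + κ) _))

  -- The cells (column c, row r) of the grid crossed by a rising or a falling diagonal edge.
  data Slash (c r : ℕ) : Set where
    inner-mid  : c ≡ 2 + κ → (κ ≡ 0 → 2 ≤ r) → Slash c r
    outer-pole : c ≡ 4 + κ + κ + (2 + κ) → Slash c r
    seam       : c ≡ 3 + κ + κ → r ≡ 1 → Slash c r

  data Back (c r : ℕ) : Set where
    inner-pole : c ≡ κ → Back c r
    outer-mid  : c ≡ 4 + κ + κ + κ → Back c r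
    bottom     : c ≡ 2 + κ + κ → r ≡ 0 ⊎ (r ≡ 1 × κ ≢ 0) → Back c r

  private
    apart : ∀ {a b : ℕ} d → b ≡ suc (a + d) → a ≢ b
    apart {a} d refl = ℕ.m≢1+m+n a

    apart˘ : ∀ {a b : ℕ} d → b ≡ suc (a + d) → b ≢ a
    apart˘ d eq = apart d eq ∘ ≡-sym

  -- The columns of the two kinds differ for every κ, except that those of `inner-mid` and `bottom`
  -- agree for κ = 0; in this case the row conditions are incompatible.
  slash-back : ∀ {c r} → Slash c r → Back c r → ⊥
  slash-back (inner-mid refl _) (inner-pole eq) = apart˘ {κ} 1 (cong suc (ℕ.+-comm 1 κ)) eq
  slash-back (inner-mid refl _) (outer-mid eq) = apart (1 + κ + κ) (lemma κ) eq
    where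
    lemma : ∀ κ → 4 + κ + κ + κ ≡ suc (2 + κ + (1 + κ + κ))
    lemma = solve-∀
  slash-back (inner-mid refl κ≡0⇒2≤r) (bottom eq rows) = clash rows (κ≡0⇒2≤r κ≡0)
    where
    κ≡0 : κ ≡ 0
    κ≡0 = ℕ.+-cancelˡ-≡ (2 + κ) κ 0 (trans (≡-sym eq) (≡-sym (ℕ.+-identityʳ (2 + κ))))
    clash : ∀ {r} → r ≡ 0 ⊎ (r ≡ 1 × κ ≢ 0) → 2 ≤ r → ⊥
    clash (inj₁ refl) ()
    clash (inj₂ (refl , κ≢0)) _ = κ≢0 κ≡0
  slash-back (outer-pole refl) (inner-pole eq) = apart˘ (5 + κ + κ) (lemma κ) eq
    where
    lemma : ∀ κ → 4 + κ + κ + (2 + κ) ≡ suc (κ + (5 + κ + κ))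
    lemma = solve-∀
  slash-back (outer-pole refl) (outer-mid eq) = apart˘ 1 (lemma κ) eq
    where
    lemma : ∀ κ → 4 + κ + κ + (2 + κ) ≡ suc (4 + κ + κ + κ + 1)
    lemma = solve-∀
  slash-back (outer-pole refl) (bottom eq _) = apart˘ (3 + κ) (lemma κ) eq
    where
    lemma : ∀ κ → 4 + κ + κ + (2 + κ) ≡ suc (2 + κ + κ + (3 + κ))
    lemma = solve-∀
  slash-back (seam refl refl) (inner-pole eq) = apart˘ (2 + κ) (lemma κ) eq
    where
    lemma : ∀ κ → 3 + κ + κ ≡ suc (κ + (2 + κ))
    lemma = solve-∀
  slash-back (seam refl refl) (outer-mid eq) = apart κ refl eq
  slash-back (seam refl refl) (bottom eq _) = apart˘ 0 (cong (3 +_) (≡-sym (ℕ.+-identityʳ (κ + κ)))) eq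

  -- Edges of the grid; ⌢ points upwards or to the right.
  infix 4 _⌢_
  data _⌢_ (u v : V) : Set where
    hor   : y v ≡ y u → x v ≡ suc (x u) → u ⌢ v
    vert  : y v ≡ suc (y u) → x v ≡ x u → u ⌢ v
    slash : y v ≡ suc (y u) → x v ≡ suc (x u) → Slash (x u) (y u) → u ⌢ v
    back  : y v ≡ suc (y u) → x u ≡ suc (x v) → Back (x v) (y u) → u ⌢ v

  ⌢-y : ∀ {u v} → u ⌢ v → y u ≤ y v × y v ≤ suc (y u)
  ⌢-y (hor e _)     = ℕ.≤-reflexive (≡-sym e) , ℕ.m≤n⇒m≤1+n (ℕ.≤-reflexive e)
  ⌢-y (vert e _)    = ℕ.≤-trans (ℕ.n≤1+n _) (ℕ.≤-reflexive (≡-sym e)) , ℕ.≤-reflexive e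
  ⌢-y (slash e _ _) = ℕ.≤-trans (ℕ.n≤1+n _) (ℕ.≤-reflexive (≡-sym e)) , ℕ.≤-reflexive e
  ⌢-y (back e _ _)  = ℕ.≤-trans (ℕ.n≤1+n _) (ℕ.≤-reflexive (≡-sym e)) , ℕ.≤-reflexive e

  -- The three edges closing up the rings.
  data Seam : V → V → Set where
    mid-seam  : ∀ q q' → suc (toℕ q) ≡ P → toℕ q' ≡ 0 → Seam (vert q mid (rail up top)) (vert q' mid (rail lo top))
    pole-seam : ∀ q q' → toℕ q + 2 ≡ toℕ q' + P → parity q' ≡ parity q → Seam (vert q pole (rail up top)) (vert q' pole (rail lo top))

  _∼_ : V → V → Set
  u ∼ v = u ⌢ v ⊎ v ⌢ u ⊎ Seam u v

  parity-0 : ∀ {q} → toℕ q ≡ 0 → parity q ≡ false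
  parity-0 eq = cong odd eq

  x≡column : ∀ q {b} h f → parity q ≡ b → x (vert q h f) ≡ column b h f
  x≡column q h f refl = refl

  x-side : ∀ q h s s' j → x (vert q h (rail s j)) ≡ x (vert q h (rail s' j))
  x-side q h s s' j with parity q | h
  ... | false | mid  = refl
  ... | false | pole = refl
  ... | true  | mid  = refl
  ... | true  | pole = refl

  y-pole : ∀ q s j → y (vert q pole (rail s j)) ≡ bit s + suc (toℕ q)
  y-pole q s j = y-regular {q} {pole} {s} {j} λ ()

  hor-outer : ∀ q h {f f'} → Outer f f' → y (vert q h f') ≡ y (vert q h f) → vert q h f ∼ vert q h f'
  hor-outer q h o eq with column-outer (parity q) h o
  ... | inj₁ (_ , e) = inj₁ (hor eq e)
  ... | inj₂ (_ , e) = inj₂ (inj₁ (hor (≡-sym eq) e))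

  foot-∼ : ∀ q h s → vert q h apex ∼ vert q h (rail s zero)
  foot-∼ q h s with lowered? q h zero
  foot-∼ q h lo | no ¬l = hor-outer q h (outer-foot lo) (y-regular ¬l)
  foot-∼ q h up | no ¬l with column-outer (parity q) h (outer-foot up)
  ... | inj₁ (b≡h , e) = inj₁ (slash (y-regular ¬l) e (diagonal h b≡h ¬l))
    where
    diagonal : ∀ h → parity q ≡ h → ¬ Lowered q h zero → Slash (column (parity q) h apex) (suc (toℕ q))
    -- For κ = 0 the first rung is also the last, so on bone 0 it would be the lowered one; the bone
    -- is therefore a later one and its row at least 2.
    diagonal mid  b≡h ¬l rewrite b≡h = inner-mid refl (λ κ≡0 → s≤s (ℕ.n≢0⇒n>0 (λ q≡0 → ¬l (q≡0 , refl , ≡-sym κ≡0))))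
    diagonal pole b≡h ¬l rewrite b≡h = outer-pole refl
  ... | inj₂ (b≡¬h , e) = inj₁ (back (y-regular ¬l) e (diagonal h b≡¬h))
    where
    diagonal : ∀ h → parity q ≡ not h → Back (column (parity q) h (rail up zero)) (suc (toℕ q))
    diagonal mid  b≡¬h rewrite b≡¬h = outer-mid refl
    diagonal pole b≡¬h rewrite b≡¬h = inner-pole refl
  foot-∼ q h s | yes l@(q≡0 , refl , 0≡κ) = lowered-foot s
    where
    x-apex : x (vert q mid apex) ≡ 2 + κ
    x-apex = x≡column q mid apex (parity-0 {q} q≡0)
    x-rail : ∀ s → x (vert q mid (rail s zero)) ≡ suc (x (vert q mid apex))
    x-rail s = trans (x≡column q mid (rail s zero) (parity-0 {q} q≡0)) (trans (cong (3 +_) (ℕ.+-identityʳ κ)) (cong suc (≡-sym x-apex)))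
    lowered-foot : ∀ s → vert q mid apex ∼ vert q mid (rail s zero)
    lowered-foot lo = inj₂ (inj₁ (back (trans (cong suc q≡0) (cong suc (≡-sym (y-lowered l)))) (x-rail lo)
      (bottom (trans x-apex (trans (cong (2 +_) (≡-sym (ℕ.+-identityʳ κ))) (cong (λ z → 2 + κ + z) 0≡κ))) (inj₁ (y-lowered l)))))
    lowered-foot up = inj₁ (hor (trans (y-lowered l) (cong suc (≡-sym q≡0))) (x-rail up))

  rung-∼ : ∀ q h j → vert q h (rail lo j) ∼ vert q h (rail up j)
  rung-∼ q h j with lowered? q h j
  ... | yes l = inj₁ (vert (trans (y-lowered l) (cong suc (≡-sym (y-lowered l)))) (x-side q h up lo j))
  ... | no ¬l = inj₁ (vert (trans (y-regular ¬l) (cong suc (≡-sym (y-regular ¬l)))) (x-side q h up lo j))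

  rail-∼ : ∀ q h s i → vert q h (rail s (inject₁ i)) ∼ vert q h (rail s (suc i))
  rail-∼ q h s i with lowered? q h (suc i)
  ... | no ¬l = hor-outer q h (outer-rail s i) (trans (y-regular ¬l) (≡-sym (y-regular inner)))
    where
    inner : ¬ Lowered q h (inject₁ i)
    inner (_ , _ , eq) = ℕ.<⇒≢ (Fin.toℕ<n i) (trans (≡-sym (Fin.toℕ-inject₁ i)) eq)
  -- The last rail edges of the lowered rung descend by one row, the `lo` one through row 0 and the
  -- `up` one through row 1.
  ... | yes l@(q≡0 , refl , 1+i≡κ) = inj₂ (inj₁ (back
      (trans (y-regular inner) (trans (cong (λ z → bit s + suc z) q≡0) (trans (ℕ.+-comm (bit s) 1) (cong suc (≡-sym (y-lowered l))))))
      (trans (x≡column q mid (rail s (suc i)) inside) (trans (proj₁ (outer-rail s i)) (cong suc (≡-sym (x≡column q mid (rail s (inject₁ i)) inside)))))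
      (bottom x-inner (rows s (y-lowered l)))))
    where
    inner : ¬ Lowered q h (inject₁ i)
    inner (_ , _ , eq) = ℕ.<⇒≢ (Fin.toℕ<n i) (trans (≡-sym (Fin.toℕ-inject₁ i)) eq)
    inside : parity q ≡ false
    inside = parity-0 {q} q≡0
    x-inner : x (vert q mid (rail s (inject₁ i))) ≡ 2 + κ + κ
    x-inner = trans (x≡column q mid (rail s (inject₁ i)) inside)
      (trans (cong (λ z → 3 + κ + z) (Fin.toℕ-inject₁ i)) (trans (≡-sym (ℕ.+-suc (2 + κ) (toℕ i))) (cong (λ z → 2 + κ + z) 1+i≡κ)))
    rows : ∀ s {r} → r ≡ bit s → r ≡ 0 ⊎ (r ≡ 1 × κ ≢ 0)
    rows lo eq = inj₁ eq
    rows up eq = inj₂ (eq , λ κ≡0 → contradiction (trans 1+i≡κ κ≡0) λ ())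

  column-inner-rim : ∀ s → column false mid (rail s top) ≡ 3 + κ + κ
  column-inner-rim s = cong (λ z → 3 + κ + z) toℕ-top

  column-outer-rim : ∀ s → column true mid (rail s top) ≡ 4 + κ + κ
  column-outer-rim s = trans (cong (4 + κ + κ +_) (trans (cong (κ ∸_) toℕ-top) (ℕ.n∸n≡0 κ))) (ℕ.+-identityʳ (4 + κ + κ))

  mid-ring-∼ : ∀ q → suc (toℕ q) < P → vert q mid (rail up top) ∼ vert (rot 1 q) mid (rail lo top)
  mid-ring-∼ q 1+q<P = go (lowered? q mid top) (parity q) refl
    where
    toℕ-next : toℕ (rot 1 q) ≡ suc (toℕ q)
    toℕ-next = trans (toℕ-rot-< 1 q (subst (_< P) (ℕ.+-comm 1 (toℕ q)) 1+q<P)) (ℕ.+-comm (toℕ q) 1)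
    y-next : y (vert (rot 1 q) mid (rail lo top)) ≡ 2 + toℕ q
    y-next = trans (y-regular (λ (eq , _) → contradiction (trans (≡-sym toℕ-next) eq) λ ())) (cong suc toℕ-next)
    inner→outer : parity q ≡ false → x (vert (rot 1 q) mid (rail lo top)) ≡ suc (x (vert q mid (rail up top)))
    inner→outer b = trans (x≡column (rot 1 q) mid _ (trans (parity-rot-1 q) (cong not b)))
      (trans (column-outer-rim lo) (cong suc (≡-sym (trans (x≡column q mid _ b) (column-inner-rim up)))))
    outer→inner : parity q ≡ true → x (vert q mid (rail up top)) ≡ suc (x (vert (rot 1 q) mid (rail lo top)))
    outer→inner b = trans (x≡column q mid _ b) (trans (column-outer-rim up)
      (cong suc (≡-sym (trans (x≡column (rot 1 q) mid _ (trans (parity-rot-1 q) (cong not b))) (column-inner-rim lo)))))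
    go : Dec (Lowered q mid top) → ∀ b → parity q ≡ b → vert q mid (rail up top) ∼ vert (rot 1 q) mid (rail lo top)
    go (yes (q≡0 , _))   true  b = contradiction (trans (≡-sym b) (parity-0 {q} q≡0)) λ ()
    -- Leaving the lowered rung, the edge to bone 1 has to climb one row; all later middle ring
    -- edges are horizontal up to the seam.
    go (yes l@(q≡0 , _)) false b = inj₁ (slash
      (trans y-next (trans (cong (2 +_) q≡0) (cong suc (≡-sym (y-lowered l))))) (inner→outer b)
      (seam (trans (x≡column q mid _ b) (column-inner-rim up)) (y-lowered l)))
    go (no ¬l) false b = inj₁ (hor (trans y-next (≡-sym (y-regular ¬l))) (inner→outer b))
    go (no ¬l) true  b = inj₂ (inj₁ (hor (trans (y-regular ¬l) (≡-sym y-next)) (outer→inner b)))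

  pole-ring-∼ : ∀ q → toℕ q + 2 < P → vert q pole (rail up top) ∼ vert (rot 2 q) pole (rail lo top)
  pole-ring-∼ q q+2<P = inj₁ (vert
    (trans (y-pole (rot 2 q) lo top) (trans (cong suc (trans (toℕ-rot-< 2 q q+2<P) (ℕ.+-comm (toℕ q) 2)))
      (cong suc (≡-sym (y-pole q up top)))))
    (trans (x≡column (rot 2 q) pole (rail lo top) (parity-rot-2 q)) (≡-sym (x-side q pole up lo top))))

  ring-∼ : ∀ q h → vert q h (rail up top) ∼ vert (rot (stride h) q) h (rail lo top)
  ring-∼ q mid with ℕ.m≤n⇒m<n∨m≡n (Fin.toℕ<n q)
  ... | inj₁ 1+q<P = mid-ring-∼ q 1+q<P
  ... | inj₂ 1+q≡P = inj₂ (inj₂ (mid-seam q (rot 1 q) 1+q≡P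
    (toℕ-rot-wrap 1 0 q (ℕ.<-≤-trans (s≤s z≤n) 5<P) (trans (ℕ.+-comm (toℕ q) 1) 1+q≡P))))
  ring-∼ q pole with ℕ.<-≤-connex (toℕ q + 2) P
  ... | inj₁ q+2<P = pole-ring-∼ q q+2<P
  ... | inj₂ P≤q+2 = inj₂ (inj₂ (pole-seam q (rot 2 q) (trans (≡-sym (ℕ.m∸n+n≡m P≤q+2)) (cong (_+ P)
    (≡-sym (toℕ-rot-wrap 2 (toℕ q + 2 ∸ P) q small (≡-sym (ℕ.m∸n+n≡m P≤q+2)))))) (parity-rot-2 q)))
    where
    small : toℕ q + 2 ∸ P < P
    small = ℕ.≤-<-trans (ℕ.∸-monoˡ-≤ P (ℕ.+-monoˡ-≤ 2 (ℕ.<⇒≤ (Fin.toℕ<n q))))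
      (ℕ.≤-<-trans (ℕ.≤-reflexive (ℕ.m+n∸m≡n P 2)) (ℕ.≤-trans (s≤s (s≤s (s≤s z≤n))) 5<P))

  spine-∼ : ∀ q → vert q mid apex ∼ vert q pole apex
  spine-∼ q with parity q in b
  ... | false = inj₂ (inj₁ (hor refl (trans (x≡column q mid apex b) (cong suc (≡-sym (x≡column q pole apex b))))))
  ... | true  = inj₁ (hor refl (trans (x≡column q pole apex b) (trans (ℕ.+-suc (4 + κ + κ) (suc κ)) (cong suc (≡-sym (x≡column q mid apex b))))))

  E⇒∼ : ∀ {u v} → E u v → u ∼ v
  E⇒∼ (spine q)      = spine-∼ q
  E⇒∼ (foot q h s)   = foot-∼ q h s
  E⇒∼ (rung q h j)   = rung-∼ q h j
  E⇒∼ (rail q h s i) = rail-∼ q h s i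
  E⇒∼ (ring q h)     = ring-∼ q h

  dist-bound : ∀ h f → dist h f ≤ 3 + κ + κ
  dist-bound mid  (rail s j) = ℕ.≤-trans (ℕ.m∸n≤m κ (toℕ j)) (ℕ.m≤n+m κ (3 + κ))
  dist-bound mid  apex       = s≤s (ℕ.≤-trans (ℕ.m≤n+m κ κ) (ℕ.m≤n+m (κ + κ) 2))
  dist-bound pole apex       = s≤s (s≤s (ℕ.≤-trans (ℕ.m≤n+m κ κ) (ℕ.n≤1+n (κ + κ))))
  dist-bound pole (rail s j) = ℕ.+-monoʳ-≤ (3 + κ) (ℕ.s≤s⁻¹ (Fin.toℕ<n j))

  width : ℕ
  width = 4 + κ + κ

  column-false : ∀ h f → column false h f < width
  column-false h f = s≤s (dist-bound (not h) f)

  column-true : ∀ h f → width ≤ column true h f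
  column-true h f = ℕ.m≤m+n width (dist h f)

  private
    zone : Bool → Frag → ℕ
    zone mid  (rail _ _) = 0
    zone mid  apex       = 1
    zone pole apex       = 2
    zone pole (rail _ _) = 3

    -- The truncated difference tells apart the four kinds of vertices along a bone, so that
    -- injectivity of `dist` need only be checked within one kind.
    dist-zone : ∀ h f → (dist h f ∸ κ) ℕ.⊓ 3 ≡ zone h f
    dist-zone mid  (rail s j) = cong (ℕ._⊓ 3) (ℕ.m≤n⇒m∸n≡0 (ℕ.m∸n≤m κ (toℕ j)))
    dist-zone mid  apex       = cong (ℕ._⊓ 3) (ℕ.m+n∸n≡m 1 κ)
    dist-zone pole apex       = cong (ℕ._⊓ 3) (ℕ.m+n∸n≡m 2 κ)
    dist-zone pole (rail s j) = trans (cong (ℕ._⊓ 3) (trans (cong (_∸ κ) (lemma κ (toℕ j))) (ℕ.m+n∸n≡m (3 + toℕ j) κ))) (cong (3 +_) (ℕ.⊓-zeroʳ (toℕ j)))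
      where
      lemma : ∀ κ j → 3 + κ + j ≡ 3 + j + κ
      lemma = solve-∀

  data SameSpot : Frag → Frag → Set where
    apex : SameSpot apex apex
    rail : ∀ s s' j → SameSpot (rail s j) (rail s' j)

  dist-injective : ∀ h f h' f' → dist h f ≡ dist h' f' → h ≡ h' × SameSpot f f'
  dist-injective h f h' f' eq = go h f h' f' eq (trans (≡-sym (dist-zone h f)) (trans (cong (λ z → (z ∸ κ) ℕ.⊓ 3) eq) (dist-zone h' f')))
    where
    go : ∀ h f h' f' → dist h f ≡ dist h' f' → zone h f ≡ zone h' f' → h ≡ h' × SameSpot f f'
    go mid  apex       mid  apex         _  _ = refl , apex
    go pole apex       pole apex         _  _ = refl , apex
    go mid  apex       mid  (rail _ _)   _  ()
    go mid  (rail _ _) mid  apex         _  ()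
    go mid  apex       pole (rail _ _)   _  ()
    go mid  (rail _ _) pole apex         _  ()
    go pole apex       mid  (rail _ _)   _  ()
    go pole (rail _ _) mid  apex         _  ()
    go pole apex       pole (rail _ _)   _  ()
    go pole (rail _ _) pole apex         _  ()
    go mid  (rail s j) mid  (rail s' j') eq _
      with refl ← Fin.toℕ-injective (ℕ.∸-cancelˡ-≡ (ℕ.s≤s⁻¹ (Fin.toℕ<n j)) (ℕ.s≤s⁻¹ (Fin.toℕ<n j')) eq) = refl , rail s s' j
    go pole (rail s j) pole (rail s' j') eq _
      with refl ← Fin.toℕ-injective (ℕ.+-cancelˡ-≡ (3 + κ) (toℕ j) (toℕ j') eq) = refl , rail s s' j

  column-injective : ∀ b h f b' h' f' → column b h f ≡ column b' h' f' → b ≡ b' × h ≡ h' × SameSpot f f'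
  column-injective false h f false h' f' eq with h≡ , same ← dist-injective (not h) f (not h') f' eq = refl , Bool.not-injective h≡ , same
  column-injective true  h f true  h' f' eq with h≡ , same ← dist-injective h f h' f' (ℕ.+-cancelˡ-≡ width _ _ eq) = refl , h≡ , same
  column-injective false h f true  h' f' eq = contradiction eq (ℕ.<⇒≢ (ℕ.<-≤-trans (column-false h f) (column-true h' f')))
  column-injective true  h f false h' f' eq = contradiction (≡-sym eq) (ℕ.<⇒≢ (ℕ.<-≤-trans (column-false h' f') (column-true h f)))

  private
    below : ∀ s s' {m} → m ≢ 0 → bit s < bit s' + suc m
    below s  s' {zero}  m≢0 = contradiction refl m≢0
    below lo s' {suc m} _ = ℕ.≤-trans (s≤s z≤n) (ℕ.m≤n+m (2 + m) (bit s'))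
    below up s' {suc m} _ = ℕ.≤-trans (s≤s (s≤s z≤n)) (ℕ.m≤n+m (2 + m) (bit s'))

  -- A column fixes the parity of the bone, the half and the rung. Bones of equal parity are two
  -- rows or more apart, so the two ends of their rungs cannot collide, and the lowered rung lies
  -- below everything else in its column.
  grid-injective : ∀ {u v} → x u ≡ x v → y u ≡ y v → u ≡ v
  grid-injective {vert q h f} {vert q' h' f'} x≡ y≡
    with column-injective (parity q) h f (parity q') h' f' x≡
  ... | b≡ , refl , apex = cong (λ z → vert z h apex) (Fin.toℕ-injective (ℕ.suc-injective y≡))
  ... | b≡ , refl , rail s s' j with lowered? q h j | lowered? q' h j
  ...   | yes (q≡0 , _) | yes (q'≡0 , _) = cong₂ (λ z s → vert z h (rail s j)) (Fin.toℕ-injective (trans q≡0 (≡-sym q'≡0))) (bit-injective s s' y≡)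
    where
    bit-injective : ∀ s s' → bit s ≡ bit s' → s ≡ s'
    bit-injective lo lo _ = refl
    bit-injective up up _ = refl
  ...   | yes (_ , hj) | no ¬l = contradiction y≡ (ℕ.<⇒≢ (below s s' (λ q'≡0 → ¬l (q'≡0 , hj))))
  ...   | no ¬l | yes (_ , hj) = contradiction (≡-sym y≡) (ℕ.<⇒≢ (below s' s (λ q≡0 → ¬l (q≡0 , hj))))
  ...   | no _ | no _ = same-row s s' y≡
    where
    flip-odd : ∀ {m m'} → odd m ≡ odd m' → m ≢ suc m'
    flip-odd eq refl = Bool.not-¬ refl (≡-sym eq)
    same-row : ∀ s s' → bit s + suc (toℕ q) ≡ bit s' + suc (toℕ q') → vert q h (rail s j) ≡ vert q' h (rail s' j)
    same-row lo lo eq = cong (λ z → vert z h (rail lo j)) (Fin.toℕ-injective (ℕ.suc-injective eq))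
    same-row up up eq = cong (λ z → vert z h (rail up j)) (Fin.toℕ-injective (ℕ.suc-injective (ℕ.suc-injective eq)))
    same-row lo up eq = contradiction (ℕ.suc-injective eq) (flip-odd b≡)
    same-row up lo eq = contradiction (≡-sym (ℕ.suc-injective eq)) (flip-odd (≡-sym b≡))

  -- Stretched coordinates

  rim? : ∀ s (f : Frag) → Dec (f ≡ rail s top)
  rim? s apex = no λ ()
  rim? s (rail s' j) with s' Bool.≟ s | j Fin.≟ top
  ... | yes refl | yes refl = yes refl
  ... | no ¬p    | _        = no λ { refl → ¬p refl }
  ... | yes _    | no ¬p    = no λ { refl → ¬p refl }

  Last : V → Set
  Last v = suc (toℕ (bone v)) ≡ P × half v ≡ mid × frag v ≡ rail up top

  First : V → Set
  First v = toℕ (bone v) ≡ 0 × half v ≡ mid × frag v ≡ rail lo top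

  PoleEnd : V → Set
  PoleEnd v = half v ≡ pole × ((frag v ≡ rail lo top × toℕ (bone v) < 2) ⊎ (frag v ≡ rail up top × P ≤ toℕ (bone v) + 2))

  last? : ∀ v → Dec (Last v)
  last? v = (suc (toℕ (bone v)) ℕ.≟ P) ×-dec ((half v Bool.≟ mid) ×-dec rim? up (frag v))

  first? : ∀ v → Dec (First v)
  first? v = (toℕ (bone v) ℕ.≟ 0) ×-dec ((half v Bool.≟ mid) ×-dec rim? lo (frag v))

  poleEnd? : ∀ v → Dec (PoleEnd v)
  poleEnd? v = (half v Bool.≟ pole) ×-dec
    ((rim? lo (frag v) ×-dec (toℕ (bone v) ℕ.<? 2)) ⊎-dec (rim? up (frag v) ×-dec (P ℕ.≤? toℕ (bone v) + 2)))

  -- The line carrying the middle seam stays below every vertex of row at least 1 and abscissa at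
  -- least `margin`, provided that `margin` exceeds `P * width`.
  margin : ℕ
  margin = suc (P * width)

  -- The ends of the pole seams stick out by one, which makes these seams vertical lines with the rest
  -- of the grid on one side; the upper end of the middle seam is so far to the left that this seam is
  -- on the convex hull.
  X : V → ℕ
  X v with last? v | poleEnd? v
  ... | yes _ | _     = 0
  ... | no _  | yes _ = if parity (bone v) then 2 + margin + x v else margin
  ... | no _  | no _  = 1 + margin + x v

  data Place (v : V) : Set where
    last      : Last v → X v ≡ 0 → Place v
    left-end  : ¬ Last v → PoleEnd v → parity (bone v) ≡ false → X v ≡ margin → Place v
    right-end : ¬ Last v → PoleEnd v → parity (bone v) ≡ true → X v ≡ 2 + margin + x v → Place v
    regular   : ¬ Last v → ¬ PoleEnd v → X v ≡ 1 + margin + x v → Place v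

  place : ∀ v → Place v
  place v with last? v in l | poleEnd? v in e
  ... | yes L | _ = last L X≡
    where
    X≡ : X v ≡ 0
    X≡ rewrite l = refl
  ... | no ¬L | no ¬E = regular ¬L ¬E X≡
    where
    X≡ : X v ≡ 1 + margin + x v
    X≡ rewrite l | e = refl
  ... | no ¬L | yes E with parity (bone v) in b
  ...   | false = left-end ¬L E b X≡
    where
    X≡ : X v ≡ margin
    X≡ rewrite l | e | b = refl
  ...   | true = right-end ¬L E b X≡
    where
    X≡ : X v ≡ 2 + margin + x v
    X≡ rewrite l | e | b = refl

  x-max : ℕ
  x-max = width + (3 + κ + κ)

  column≤x-max : ∀ b h f → column b h f ≤ x-max
  column≤x-max false h f = ℕ.≤-trans (ℕ.<⇒≤ (column-false h f)) (ℕ.m≤m+n width _)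
  column≤x-max true  h f = ℕ.+-monoʳ-≤ width (dist-bound h f)

  x≤x-max : ∀ v → x v ≤ x-max
  x≤x-max (vert q h f) = column≤x-max (parity q) h f

  poleEnd-rim : ∀ {v} → PoleEnd v → half v ≡ pole × Σ Bool λ s → frag v ≡ rail s top
  poleEnd-rim (h≡ , inj₁ (f≡ , _)) = h≡ , lo , f≡
  poleEnd-rim (h≡ , inj₂ (f≡ , _)) = h≡ , up , f≡

  left-end-x : ∀ {v} → PoleEnd v → parity (bone v) ≡ false → x v ≡ 0
  left-end-x {vert q h f} E b with refl , s , refl ← poleEnd-rim E =
    trans (x≡column q pole (rail s top) b) (trans (cong (κ ∸_) toℕ-top) (ℕ.n∸n≡0 κ))

  right-end-x : ∀ {v} → PoleEnd v → parity (bone v) ≡ true → x v ≡ x-max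
  right-end-x {vert q h f} E b with refl , s , refl ← poleEnd-rim E =
    trans (x≡column q pole (rail s top) b) (cong (λ z → width + (3 + κ + z)) toℕ-top)

  margin≤X : ∀ {v} → ¬ Last v → margin ≤ X v
  margin≤X {v} ¬L with place v
  ... | last L _           = contradiction L ¬L
  ... | left-end _ _ _ e   = ℕ.≤-reflexive (≡-sym e)
  ... | right-end _ _ _ e  = ℕ.≤-trans (ℕ.m≤n+m margin 2) (ℕ.≤-trans (ℕ.m≤m+n (2 + margin) (x v)) (ℕ.≤-reflexive (≡-sym e)))
  ... | regular _ _ e      = ℕ.≤-trans (ℕ.n≤1+n margin) (ℕ.≤-trans (ℕ.m≤m+n (1 + margin) (x v)) (ℕ.≤-reflexive (≡-sym e)))

  parity-last : ∀ {q} → suc (toℕ q) ≡ P → parity q ≡ true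
  parity-last {q} eq = Bool.not-injective (trans (cong odd eq) (odd-double n))

  y-top : ∀ v → y v ≡ suc P → suc (toℕ (bone v)) ≡ P
  y-top (vert q h apex) eq = contradiction (ℕ.suc-injective eq) (ℕ.<⇒≢ (Fin.toℕ<n q))
  y-top (vert q h (rail s j)) eq with lowered? q h j
  y-top (vert q h (rail lo j)) eq | no _ = contradiction (ℕ.suc-injective eq) (ℕ.<⇒≢ (Fin.toℕ<n q))
  y-top (vert q h (rail up j)) eq | no _ = ℕ.suc-injective eq
  y-top (vert q h (rail lo j)) () | yes _
  y-top (vert q h (rail up j)) eq | yes _ = contradiction (ℕ.suc-injective eq) (ℕ.<⇒≢ (ℕ.<-≤-trans (s≤s z≤n) 5<P))

  last-y : ∀ {v} → Last v → y v ≡ suc P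
  last-y {vert q h f} (1+q≡P , refl , refl) = trans (y-regular (λ (q≡0 , _) → contradiction (trans (cong suc (≡-sym q≡0)) 1+q≡P)
    (ℕ.<⇒≢ (ℕ.≤-trans (s≤s (s≤s z≤n)) 5<P)))) (cong suc 1+q≡P)

  last-x : ∀ {v} → Last v → x v ≡ width
  last-x {vert q h f} (1+q≡P , refl , refl) = trans (x≡column q mid _ (parity-last {q} 1+q≡P)) (column-outer-rim up)

  width≤x : ∀ {v} → y v ≡ suc P → width ≤ x v
  width≤x {vert q h f} eq = subst (width ≤_) (≡-sym (x≡column q h f (parity-last {q} (y-top (vert q h f) eq)))) (column-true h f)

  -- The displaced vertices were extreme in their rows already: pole ends lie in the first or in the
  -- last column, and the top row contains only vertices of the last bone, among which the end of
  -- the middle seam is leftmost.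
  X-mono : ∀ {u v} → y u ≡ y v → x u < x v → X u < X v
  X-mono {u} {v} y≡ x< with place u | place v
  ... | _ | last L _ = contradiction (ℕ.≤-<-trans (width≤x {u} (trans y≡ (last-y L))) (subst (x u <_) (last-x L) x<)) (ℕ.<-irrefl refl)
  ... | _ | left-end _ E b _ = contradiction (subst (x u <_) (left-end-x E b) x<) λ ()
  ... | right-end _ E b _ | _ = contradiction (subst (_< x v) (right-end-x E b) x<) (ℕ.≤⇒≯ (x≤x-max v))
  ... | last _ e | right-end ¬L _ _ _ = subst (_< X v) (≡-sym e) (ℕ.<-≤-trans (s≤s z≤n) (margin≤X ¬L))
  ... | last _ e | regular ¬L _ _ = subst (_< X v) (≡-sym e) (ℕ.<-≤-trans (s≤s z≤n) (margin≤X ¬L))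
  ... | left-end _ _ _ e | right-end _ _ _ e' = subst₂ _<_ (≡-sym e) (≡-sym e') (ℕ.m≤n⇒m≤1+n (ℕ.m≤m+n (1 + margin) (x v)))
  ... | left-end _ _ _ e | regular _ _ e' = subst₂ _<_ (≡-sym e) (≡-sym e') (ℕ.m≤m+n (1 + margin) (x v))
  ... | regular _ _ e | right-end _ _ _ e' = subst₂ _<_ (≡-sym e) (≡-sym e') (ℕ.m≤n⇒m≤1+n (ℕ.+-monoʳ-< (1 + margin) x<))
  ... | regular _ _ e | regular _ _ e' = subst₂ _<_ (≡-sym e) (≡-sym e') (ℕ.+-monoʳ-< (1 + margin) x<)

  open LevelDrawing x y X grid-injective X-mono public

  -- Order of the edges between two rows

  Slope : V → V → Set
  Slope a b = x b ≡ x a ⊎ (x b ≡ suc (x a) × Slash (x a) (y a)) ⊎ (x a ≡ suc (x b) × Back (x b) (y a))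

  slopes-ordered : ∀ a b c d → Slope a b → Slope c d → y a ≡ y c → x a < x c → x b ≤ x d
  slopes-ordered a b c d ab cd ya≡yc xa<xc = go ab cd
    where
    b≤ : x b ≤ x a → x c ≤ suc (x d) → x b ≤ x d
    b≤ xb≤xa xc≤ = ℕ.≤-trans xb≤xa (ℕ.s≤s⁻¹ (ℕ.≤-trans xa<xc xc≤))
    left : Slope a b → x b ≤ x a ⊎ (x b ≡ suc (x a) × Slash (x a) (y a))
    left (inj₁ e)              = inj₁ (ℕ.≤-reflexive e)
    left (inj₂ (inj₁ e))       = inj₂ e
    left (inj₂ (inj₂ (e , _))) = inj₁ (ℕ.≤-trans (ℕ.n≤1+n _) (ℕ.≤-reflexive (≡-sym e)))
    right : Slope c d → x c ≤ x d ⊎ (x c ≡ suc (x d) × Back (x d) (y c))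
    right (inj₁ e)              = inj₁ (ℕ.≤-reflexive (≡-sym e))
    right (inj₂ (inj₁ (e , _))) = inj₁ (ℕ.≤-trans (ℕ.n≤1+n _) (ℕ.≤-reflexive (≡-sym e)))
    right (inj₂ (inj₂ e))       = inj₂ e
    go : Slope a b → Slope c d → x b ≤ x d
    go ab cd with left ab | right cd
    ... | inj₁ le       | inj₁ le'       = b≤ le (ℕ.m≤n⇒m≤1+n le')
    ... | inj₁ le       | inj₂ (e , _)   = b≤ le (ℕ.≤-reflexive e)
    ... | inj₂ (e , _)  | inj₁ le'       = ℕ.≤-trans (ℕ.≤-reflexive e) (ℕ.≤-trans xa<xc le')
    ... | inj₂ (e , sl) | inj₂ (e' , bk) with ℕ.m≤n⇒m<n∨m≡n (ℕ.s≤s⁻¹ (subst (x a <_) e' xa<xc))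
    ...   | inj₁ xa<xd = ℕ.≤-trans (ℕ.≤-reflexive e) xa<xd
    -- Edges shift by at most one column, so the order can be reversed only by a rising and a
    -- falling diagonal in the same cell.
    ...   | inj₂ xa≡xd = ⊥-elim (slash-back sl (subst₂ Back (≡-sym xa≡xd) (≡-sym ya≡yc) bk))

  ⌢-view : ∀ {a b} → a ⌢ b → Horizontal a b ⊎ (Steep a b × Slope a b)
  ⌢-view (hor e e')      = inj₁ (e , e')
  ⌢-view (vert e e')     = inj₂ (e , inj₁ e')
  ⌢-view (slash e e' sl) = inj₂ (e , inj₂ (inj₁ (e' , sl)))
  ⌢-view (back e e' bk)  = inj₂ (e , inj₂ (inj₂ (e' , bk)))

  meet-⌢ : ∀ {a b c d} → a ⌢ b → c ⌢ d → ¬ (a ≡ c × b ≡ d) → Meet a b c d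
  meet-⌢ {a} {b} {c} {d} ab cd different with ⌢-view ab | ⌢-view cd
  ... | inj₁ h        | inj₁ h'         = meet-hor-hor h h' different
  ... | inj₁ h        | inj₂ (st' , _)  = meet-hor-steep h st'
  ... | inj₂ (st , _) | inj₁ h'         = meet-swap (meet-hor-steep h' st)
  ... | inj₂ (st , sl) | inj₂ (st' , sl') = meet-steep-steep st st' 
    (slopes-ordered a b c d sl sl') (slopes-ordered c d a b sl' sl) different

  -- The three seams

  First-unique : ∀ {u v} → First u → First v → u ≡ v
  First-unique {vert q h f} {vert q' h' f'} (q≡0 , refl , refl) (q'≡0 , refl , refl) =
    cong (λ z → vert z mid (rail lo top)) (Fin.toℕ-injective (trans q≡0 (≡-sym q'≡0)))

  Last-unique : ∀ {u v} → Last u → Last v → u ≡ v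
  Last-unique {vert q h f} {vert q' h' f'} (q≡ , refl , refl) (q'≡ , refl , refl) =
    cong (λ z → vert z mid (rail up top)) (Fin.toℕ-injective (ℕ.suc-injective (trans q≡ (≡-sym q'≡))))

  0<y : ∀ v → ¬ First v → 0 < y v
  0<y (vert q h apex) _ = s≤s z≤n
  0<y (vert q h (rail s j)) ¬F with lowered? q h j
  0<y (vert q h (rail s j)) ¬F | no _ = ℕ.≤-trans (s≤s z≤n) (ℕ.m≤n+m (suc (toℕ q)) (bit s))
  0<y (vert q h (rail lo j)) ¬F | yes (q≡0 , refl , j≡κ) =
    contradiction (q≡0 , refl , cong (rail lo) (Fin.toℕ-injective (trans j≡κ (≡-sym toℕ-top)))) ¬F
  0<y (vert q h (rail up j)) ¬F | yes _ = s≤s z≤n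

  private
    consecutive : ∀ {m m'} → m < m' → m' < P → P ≤ m + 2 → odd m ≢ odd m'
    consecutive {m} lt m'<P le eq
      with refl ← ℕ.≤-antisym (ℕ.s≤s⁻¹ (ℕ.≤-trans m'<P (ℕ.≤-trans le (ℕ.≤-reflexive (ℕ.+-comm m 2))))) lt = Bool.not-¬ refl eq

  -- The last two bones have different parities.
  near-end : ∀ {m m'} → m < P → P ≤ m + 2 → m' < P → P ≤ m' + 2 → odd m ≡ odd m' → m ≡ m'
  near-end {m} {m'} m<P P≤m+2 m'<P P≤m'+2 b≡ with ℕ.<-cmp m m'
  ... | tri≈ _ eq _ = eq
  ... | tri< lt _ _ = contradiction b≡ (consecutive lt m'<P P≤m+2)
  ... | tri> _ _ gt = contradiction (≡-sym b≡) (consecutive gt m<P P≤m'+2)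

  near-start : ∀ {m m'} → m < 2 → m' < 2 → odd m ≡ odd m' → m ≡ m'
  near-start {0} {0} _ _ _ = refl
  near-start {1} {1} _ _ _ = refl
  near-start {suc (suc _)} (s≤s (s≤s ())) _ _
  near-start {_} {suc (suc _)} _ (s≤s (s≤s ())) _

  module _ (q q' : Fin P) (wrap : toℕ q + 2 ≡ toℕ q' + P) (b≡ : parity q' ≡ parity q) where

    private
      a b : V
      a = vert q pole (rail up top)
      b = vert q' pole (rail lo top)

    q'<2 : toℕ q' < 2
    q'<2 = ℕ.+-cancelʳ-< P (toℕ q') 2 (subst (_< 2 + P) wrap (subst (_< 2 + P) (ℕ.+-comm 2 (toℕ q)) (s≤s (s≤s (Fin.toℕ<n q)))))

    P≤q+2 : P ≤ toℕ q + 2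
    P≤q+2 = subst (P ≤_) (≡-sym wrap) (ℕ.m≤n+m P (toℕ q'))

    end-a : PoleEnd a
    end-a = refl , inj₂ (refl , P≤q+2)

    end-b : PoleEnd b
    end-b = refl , inj₁ (refl , q'<2)

    seam-ends : ∀ {v} → PoleEnd v → parity (bone v) ≡ parity q → v ≡ a ⊎ v ≡ b
    seam-ends {vert r h f} (refl , inj₁ (refl , r<2)) eq =
      inj₂ (cong (λ z → vert z pole (rail lo top)) (Fin.toℕ-injective (near-start r<2 q'<2 (trans eq (≡-sym b≡)))))
    seam-ends {vert r h f} (refl , inj₂ (refl , P≤r+2)) eq =
      inj₁ (cong (λ z → vert z pole (rail up top)) (Fin.toℕ-injective (near-end (Fin.toℕ<n r) P≤r+2 (Fin.toℕ<n q) P≤q+2 eq)))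

    end-not-last : ∀ {v} → PoleEnd v → ¬ Last v
    end-not-last (refl , _) (_ , () , _)

    module _ (left : parity q ≡ false) where

      X-left : ∀ {v} → PoleEnd v → parity (bone v) ≡ false → X v ≡ margin
      X-left {v} E b with place v
      ... | last L _            = contradiction L (end-not-last E)
      ... | left-end _ _ _ e    = e
      ... | right-end _ _ b' _  = contradiction (trans (≡-sym b) b') λ ()
      ... | regular _ ¬E _      = contradiction E ¬E

      left-cases : ∀ v → ¬ Last v → (v ≡ a ⊎ v ≡ b) ⊎ margin < X v
      left-cases v ¬L with place v
      ... | last L _            = contradiction L ¬L
      ... | left-end _ E b _    = inj₁ (seam-ends E (trans b (≡-sym left)))
      ... | right-end _ _ _ e   = inj₂ (subst (margin <_) (≡-sym e) (ℕ.m≤n⇒m≤1+n (ℕ.m≤m+n (1 + margin) (x v))))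
      ... | regular _ _ e       = inj₂ (subst (margin <_) (≡-sym e) (ℕ.m≤m+n (1 + margin) (x v)))

      q'≡0 : toℕ q' ≡ 0
      q'≡0 = near-start q'<2 (s≤s z≤n) (trans b≡ left)

      meet-last : ∀ {c d} → P ≤ y c → Last d → Meet a b c d
      meet-last P≤yc Ld = meet-sides affine-y (ι P)
        (ι-mono-≤ (ℕ.≤-reflexive (trans (y-pole q up top) (trans (ℕ.+-comm 2 (toℕ q)) (trans wrap (cong (_+ P) q'≡0))))))
        (ι-mono-< (subst (_< P) (≡-sym (trans (y-pole q' lo top) (cong suc q'≡0))) (ℕ.≤-trans (s≤s (s≤s z≤n)) 5<P)))
        (ι-mono-≤ P≤yc) (ι-mono-< (ℕ.≤-reflexive (≡-sym (last-y Ld))))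

      -- Only the upper end of the middle seam lies further left than this seam. Grid edges at that
      -- vertex stay in the rows from `P` upwards, where the pole seam has at most its upper end.
      left-meet : ∀ {c d} → c ⌢ d → c ≢ d → ¬ (a ≡ c × b ≡ d) → ¬ (a ≡ d × b ≡ c) → Meet a b c d
      left-meet {c} {d} c⌢d c≢d ¬same ¬flipped with last? c | last? d
      ... | yes Lc | _ = meet-flipʳ (meet-last (ℕ.≤-trans (subst (P ≤_) (≡-sym (last-y Lc)) (ℕ.n≤1+n P)) (proj₁ (⌢-y c⌢d))) Lc)
      ... | no _ | yes Ld = meet-last (ℕ.s≤s⁻¹ (subst (_≤ suc (y c)) (last-y Ld) (proj₂ (⌢-y c⌢d)))) Ld
      ... | no ¬Lc | no ¬Ld = meet-hull-edge affine-x (ι margin) (cong ι (X-left end-a left)) (cong ι (X-left end-b (trans b≡ left)))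
        (map₂ ι-mono-< (left-cases c ¬Lc)) (map₂ ι-mono-< (left-cases d ¬Ld)) c≢d ¬same ¬flipped

    module _ (right : parity q ≡ true) where

      rightmost : ℕ
      rightmost = 2 + margin + x-max

      X-right : ∀ {v} → PoleEnd v → parity (bone v) ≡ true → X v ≡ rightmost
      X-right {v} E b with place v
      ... | last L _            = contradiction L (end-not-last E)
      ... | left-end _ _ b' _   = contradiction (trans (≡-sym b) b') λ ()
      ... | right-end _ _ _ e   = trans e (cong (2 + margin +_) (right-end-x E b))
      ... | regular _ ¬E _      = contradiction E ¬E

      right-cases : ∀ v → (v ≡ a ⊎ v ≡ b) ⊎ X v < rightmost
      right-cases v with place v
      ... | last _ e            = inj₂ (subst (_< rightmost) (≡-sym e) (s≤s z≤n))
      ... | left-end _ _ _ e    = inj₂ (subst (_< rightmost) (≡-sym e) (ℕ.m≤n⇒m≤1+n (ℕ.m≤m+n (1 + margin) x-max)))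
      ... | right-end _ E b _   = inj₁ (seam-ends E (trans b (≡-sym right)))
      ... | regular _ _ e       = inj₂ (subst (_< rightmost) (≡-sym e) (s≤s (ℕ.+-monoʳ-≤ (1 + margin) (x≤x-max v))))

      right-meet : ∀ {c d} → c ≢ d → ¬ (a ≡ c × b ≡ d) → ¬ (a ≡ d × b ≡ c) → Meet a b c d
      right-meet {c} {d} = meet-hull-edge (affine-neg affine-x) (ℚ.- ι rightmost)
        (cong (ℚ.-_ ∘ ι) (X-right end-a right)) (cong (ℚ.-_ ∘ ι) (X-right end-b (trans b≡ right)))
        (map₂ (ℚ.neg-antimono-< ∘ ι-mono-<) (right-cases c)) (map₂ (ℚ.neg-antimono-< ∘ ι-mono-<) (right-cases d))

  module _ {a b : V} (La : Last a) (Fb : First b) where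

    private
      X-first : ℕ
      X-first = margin + width

      -- The left side of the equation of the middle seam, a line meeting the axes at `X-first` and
      -- at `suc P`, with denominators cleared.
      height : V → ℕ
      height v = suc P * X v + X-first * y v

      hull : ℕ
      hull = suc P * X-first

      f : Point → ℚ
      f p = ι (suc P) ℚ.* proj₁ p ℚ.+ ι X-first ℚ.* proj₂ p

      f-pos : ∀ v → f (pos v) ≡ ι (height v)
      f-pos v = ≡-sym (trans (ι-+ (suc P * X v) (X-first * y v)) (cong₂ ℚ._+_ (ι-* (suc P) (X v)) (ι-* X-first (y v))))

      X-last : X a ≡ 0
      X-last with place a
      ... | last _ e             = e
      ... | left-end ¬L _ _ _    = contradiction La ¬L
      ... | right-end ¬L _ _ _   = contradiction La ¬L
      ... | regular ¬L _ _       = contradiction La ¬L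

      height-a : height a ≡ hull
      height-a = trans (cong₂ (λ z z' → suc P * z + X-first * z') X-last (last-y La))
        (trans (cong (_+ X-first * suc P) (ℕ.*-zeroʳ (suc P))) (ℕ.*-comm X-first (suc P)))

      first-x : ∀ {v} → First v → x v ≡ 3 + κ + κ
      first-x {vert q h f} (q≡0 , refl , refl) = trans (x≡column q mid _ (parity-0 {q} q≡0)) (column-inner-rim lo)

      first-y : ∀ {v} → First v → y v ≡ 0
      first-y {vert q h f} (q≡0 , refl , refl) = y-lowered (q≡0 , refl , toℕ-top)

      first-not-end : ∀ {v} → First v → ¬ PoleEnd v
      first-not-end (_ , refl , _) (() , _)

      X-b : X b ≡ X-first
      X-b with place b
      ... | last (1+q≡P , _) _   = contradiction (trans (cong suc (≡-sym (proj₁ Fb))) 1+q≡P) (ℕ.<⇒≢ (ℕ.≤-trans (s≤s (s≤s z≤n)) 5<P))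
      ... | left-end _ E _ _     = contradiction E (first-not-end Fb)
      ... | right-end _ E _ _    = contradiction E (first-not-end Fb)
      ... | regular _ _ e        = trans e (trans (cong (1 + margin +_) (first-x Fb)) (≡-sym (ℕ.+-suc margin (3 + κ + κ))))

      height-b : height b ≡ hull
      height-b = trans (cong₂ (λ z z' → suc P * z + X-first * z') X-b (first-y Fb))
        (trans (cong (hull +_) (ℕ.*-zeroʳ X-first)) (ℕ.+-identityʳ hull))

      above : ∀ {v} → margin ≤ X v → 0 < y v → hull < height v
      above {v} m≤X 0<y = begin-strict
        X-first + P * X-first                   ≡⟨ lemma P margin width ⟩
        -- The choice of `margin` enters here, with a surplus of exactly one.
        P * margin + P * width + X-first        <⟨ ℕ.+-monoˡ-< X-first (ℕ.+-monoʳ-< (P * margin) (ℕ.n<1+n (P * width))) ⟩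
        P * margin + margin + X-first           ≡⟨ cong (_+ X-first) (ℕ.+-comm (P * margin) margin) ⟩
        suc P * margin + X-first                ≡⟨ cong (suc P * margin +_) (≡-sym (ℕ.*-identityʳ X-first)) ⟩
        suc P * margin + X-first * 1            ≤⟨ ℕ.+-mono-≤ (ℕ.*-monoʳ-≤ (suc P) m≤X) (ℕ.*-monoʳ-≤ X-first 0<y) ⟩
        suc P * X v + X-first * y v             ∎
        where
        open ℕ.≤-Reasoning
        lemma : ∀ p m w → m + w + p * (m + w) ≡ p * m + p * w + (m + w)
        lemma = solve-∀

      mid-cases : ∀ v → (v ≡ a ⊎ v ≡ b) ⊎ ι hull ℚ.< f (pos v)
      mid-cases v = go (last? v) (first? v)
        where
        go : Dec (Last v) → Dec (First v) → (v ≡ a ⊎ v ≡ b) ⊎ ι hull ℚ.< f (pos v)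
        go (yes L) _       = inj₁ (inj₁ (Last-unique L La))
        go (no _)  (yes F) = inj₁ (inj₂ (First-unique F Fb))
        go (no ¬L) (no ¬F) = inj₂ (subst (ι hull ℚ.<_) (≡-sym (f-pos v)) (ι-mono-< (above {v} (margin≤X ¬L) (0<y v ¬F))))

    mid-meet : ∀ {c d} → c ≢ d → ¬ (a ≡ c × b ≡ d) → ¬ (a ≡ d × b ≡ c) → Meet a b c d
    mid-meet {c} {d} = meet-hull-edge (affine-combination (ι (suc P)) (ι X-first)) (ι hull)
      (trans (f-pos a) (cong ι height-a)) (trans (f-pos b) (cong ι height-b)) (mid-cases c) (mid-cases d)

  module _ {a b c d : V} (c≢d : c ≢ d) (¬same : ¬ (a ≡ c × b ≡ d)) (¬flipped : ¬ (a ≡ d × b ≡ c)) where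

    private
      ¬same˘ : ¬ (a ≡ c × b ≡ d) → ¬ (c ≡ a × d ≡ b)
      ¬same˘ ¬p (e , e') = ¬p (≡-sym e , ≡-sym e')

    meet-seam-⌢ : Seam a b → c ⌢ d → Meet a b c d
    meet-seam-⌢ (mid-seam q q' q≡ q'≡) _ = mid-meet (q≡ , refl , refl) (q'≡ , refl , refl) c≢d ¬same ¬flipped
    meet-seam-⌢ (pole-seam q q' w b≡) cd with parity q in b
    ... | false = left-meet q q' w (trans b≡ (≡-sym b)) b cd c≢d ¬same ¬flipped
    ... | true  = right-meet q q' w (trans b≡ (≡-sym b)) b c≢d ¬same ¬flipped

    -- Of two different seams, at least one is the middle or the right pole seam, and these lie on
    -- the convex hull.
    meet-seam-seam : a ≢ b → Seam a b → Seam c d → Meet a b c d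
    meet-seam-seam a≢b (mid-seam q q' q≡ q'≡) _ = mid-meet (q≡ , refl , refl) (q'≡ , refl , refl) c≢d ¬same ¬flipped
    meet-seam-seam a≢b (pole-seam _ _ _ _) (mid-seam q q' q≡ q'≡) =
      meet-swap (mid-meet (q≡ , refl , refl) (q'≡ , refl , refl) a≢b (¬same˘ ¬same) λ (e , e') → ¬flipped (≡-sym e' , ≡-sym e))
    meet-seam-seam a≢b (pole-seam q q' w b≡) (pole-seam r r' w' b≡') with parity q in b | parity r in b'
    ... | true  | _     = right-meet q q' w (trans b≡ (≡-sym b)) b c≢d ¬same ¬flipped
    ... | false | true  = meet-swap (right-meet r r' w' (trans b≡' (≡-sym b')) b' a≢b (¬same˘ ¬same) λ (e , e') → ¬flipped (≡-sym e' , ≡-sym e))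
    ... | false | false = contradiction
      ( cong (λ z → vert z pole (rail up top)) (Fin.toℕ-injective (near-end (Fin.toℕ<n q) (P≤q+2 q q' w b≡₁) (Fin.toℕ<n r) (P≤q+2 r r' w' b≡₂) (trans b (≡-sym b'))))
      , cong (λ z → vert z pole (rail lo top)) (Fin.toℕ-injective (trans (q'≡0 q q' w b≡₁ b) (≡-sym (q'≡0 r r' w' b≡₂ b')))) ) ¬same
      where
      b≡₁ : parity q' ≡ parity q
      b≡₁ = trans b≡ (≡-sym b)
      b≡₂ : parity r' ≡ parity r
      b≡₂ = trans b≡' (≡-sym b')

  meet-∼ : ∀ {a b c d} → a ∼ b → c ∼ d → a ≢ b → c ≢ d → ¬ (a ≡ c × b ≡ d) → ¬ (a ≡ d × b ≡ c) → Meet a b c d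
  meet-∼ (inj₁ ab) (inj₁ cd) a≢b c≢d ¬same ¬flipped = meet-⌢ ab cd ¬same
  meet-∼ (inj₁ ab) (inj₂ (inj₁ dc)) a≢b c≢d ¬same ¬flipped = meet-flipʳ (meet-⌢ ab dc ¬flipped)
  meet-∼ (inj₂ (inj₁ ba)) (inj₁ cd) a≢b c≢d ¬same ¬flipped = meet-flipˡ (meet-⌢ ba cd λ (e , e') → ¬flipped (e' , e))
  meet-∼ (inj₂ (inj₁ ba)) (inj₂ (inj₁ dc)) a≢b c≢d ¬same ¬flipped = meet-flipˡ (meet-flipʳ (meet-⌢ ba dc λ (e , e') → ¬same (e' , e)))
  meet-∼ (inj₂ (inj₂ ab)) (inj₁ cd) a≢b c≢d ¬same ¬flipped = meet-seam-⌢ c≢d ¬same ¬flipped ab cd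
  meet-∼ (inj₂ (inj₂ ab)) (inj₂ (inj₁ dc)) a≢b c≢d ¬same ¬flipped = meet-flipʳ (meet-seam-⌢ (c≢d ∘ ≡-sym) ¬flipped ¬same ab dc)
  meet-∼ (inj₂ (inj₂ ab)) (inj₂ (inj₂ cd)) a≢b c≢d ¬same ¬flipped = meet-seam-seam c≢d ¬same ¬flipped a≢b ab cd
  meet-∼ (inj₁ ab) (inj₂ (inj₂ cd)) a≢b c≢d ¬same ¬flipped =
    meet-swap (meet-seam-⌢ a≢b (λ (e , e') → ¬same (≡-sym e , ≡-sym e')) (λ (e , e') → ¬flipped (≡-sym e' , ≡-sym e)) cd ab)
  meet-∼ (inj₂ (inj₁ ba)) (inj₂ (inj₂ cd)) a≢b c≢d ¬same ¬flipped =
    meet-swap (meet-flipʳ (meet-seam-⌢ (a≢b ∘ ≡-sym) (λ (e , e') → ¬flipped (≡-sym e' , ≡-sym e)) (λ (e , e') → ¬same (≡-sym e , ≡-sym e')) cd ba))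

  meet-edges : ∀ {a b c d} → a ~ b → c ~ d → ¬ (a ≡ c × b ≡ d) → ¬ (a ≡ d × b ≡ c) → Meet a b c d
  meet-edges (inj₁ ab) (inj₁ cd) ¬same ¬flipped = meet-∼ (E⇒∼ ab) (E⇒∼ cd) (E-irrefl ab) (E-irrefl cd) ¬same ¬flipped
  meet-edges (inj₁ ab) (inj₂ dc) ¬same ¬flipped = meet-flipʳ (meet-∼ (E⇒∼ ab) (E⇒∼ dc) (E-irrefl ab) (E-irrefl dc) ¬flipped ¬same)
  meet-edges (inj₂ ba) (inj₁ cd) ¬same ¬flipped = meet-flipˡ (meet-∼ (E⇒∼ ba) (E⇒∼ cd) (E-irrefl ba) (E-irrefl cd)
    (λ (e , e') → ¬flipped (e' , e)) (λ (e , e') → ¬same (e' , e)))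
  meet-edges (inj₂ ba) (inj₂ dc) ¬same ¬flipped = meet-flipˡ (meet-flipʳ (meet-∼ (E⇒∼ ba) (E⇒∼ dc) (E-irrefl ba) (E-irrefl dc)
    (λ (e , e') → ¬same (e' , e)) (λ (e , e') → ¬flipped (e' , e))))

-- Transfer to numbered vertices

module BoneGraph (κ n : ℕ) (2<n : 2 < n) where
  open Bones κ n 2<n hiding (Nb)
  open Connectivity κ n 2<n
  open Cycles κ n 2<n
  open Planarity κ n 2<n
  open ClosedWalk _~_ ~-sym
  open CubicGraph V↔Fin nb₀ nb₁ nb₂

  N : ℕ
  N = P * (2 * (1 + 2 * K))

  Nb-sym : ∀ {u v} → Nb u v → Nb v u
  Nb-sym = ~⇒Nb ∘ ~-sym ∘ Nb⇒~

  Nb-irrefl : ∀ {u} → ¬ Nb u u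
  Nb-irrefl nb = ~-irrefl (Nb⇒~ nb) refl

  G : Graph N
  G = graph Nb-sym Nb-irrefl

  G-cubic : Cubic G
  G-cubic = cubic Nb-sym Nb-irrefl nb₀≢nb₁ nb₀≢nb₂ nb₁≢nb₂

  Adj⇒~ : ∀ {i j} → Adj G i j → dec i ~ dec j
  Adj⇒~ {i} {j} e = Nb⇒~ (Adj⇒Nb Nb-sym Nb-irrefl {i} {j} e)

  ~⇒Adj : ∀ {i j} → dec i ~ dec j → Adj G i j
  ~⇒Adj {i} {j} e = Nb⇒Adj Nb-sym Nb-irrefl {i} {j} (~⇒Nb e)

  dec-injective : ∀ {i j} → dec i ≡ dec j → i ≡ j
  dec-injective {i} {j} eq = trans (≡-sym (enc∘dec i)) (trans (cong enc eq) (enc∘dec j))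

  G-threeConnected : ThreeConnected G
  G-threeConnected = ℕ.≤-trans (ℕ.≤-trans (s≤s (s≤s (s≤s (s≤s z≤n)))) 5<P) (ℕ.m≤m*n P (2 * (1 + 2 * K))) , λ a b u v u≢a u≢b v≢a v≢b →
    subst₂ (PathIn G _) (enc∘dec u) (enc∘dec v)
      (path a b (Deleted.connected (dec a) (dec b) (dec u) (dec v)
        (u≢a ∘ dec-injective , u≢b ∘ dec-injective) (v≢a ∘ dec-injective , v≢b ∘ dec-injective)))
    where
    ok : ∀ a b {w} → w ≢ dec a × w ≢ dec b → enc w ≢ a × enc w ≢ b
    ok a b {w} (w≢a , w≢b) = (λ eq → w≢a (trans (≡-sym (dec∘enc w)) (cong dec eq)))
                           , (λ eq → w≢b (trans (≡-sym (dec∘enc w)) (cong dec eq)))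
    path : ∀ a b {u v} → Path (λ w → w ≢ dec a × w ≢ dec b) u v → PathIn G (λ w → w ≢ a × w ≢ b) (enc u) (enc v)
    path a b (Path.here o)     = here (ok a b o)
    path a b (Path.step {u} {w} o e p) = step (ok a b o) (~⇒Adj (subst₂ _~_ (≡-sym (dec∘enc u)) (≡-sym (dec∘enc w)) e)) (path a b p)

  G-planar : Planar G
  G-planar = pos ∘ dec , dec-injective ∘ pos-injective , off-edge , λ a b c d ab cd ¬same ¬flipped s t s∈ t∈ eq →
    let v , v∈ab , v∈cd , p≡v = crossing a b c d ab cd ¬same ¬flipped s t s∈ t∈ eq
    in enc v , endpoint v∈ab , endpoint v∈cd , trans p≡v (cong pos (≡-sym (dec∘enc v)))
    where
    endpoint : ∀ {v i j} → v ≡ dec i ⊎ v ≡ dec j → enc v ≡ i ⊎ enc v ≡ j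
    endpoint {i = i} (inj₁ refl) = inj₁ (enc∘dec i)
    endpoint {j = j} (inj₂ refl) = inj₂ (enc∘dec j)
    crossing : ∀ a b c d → Adj G a b → Adj G c d → ¬ (a ≡ c × b ≡ d) → ¬ (a ≡ d × b ≡ c) →
      ∀ s t → InUnit s → InUnit t → lerp (pos (dec a)) (pos (dec b)) s ≡ lerp (pos (dec c)) (pos (dec d)) t →
      Σ V λ v → (v ≡ dec a ⊎ v ≡ dec b) × (v ≡ dec c ⊎ v ≡ dec d) × lerp (pos (dec a)) (pos (dec b)) s ≡ pos v
    crossing a b c d ab cd ¬same ¬flipped s t s∈ t∈ eq =
      meet-edges (Adj⇒~ {a} {b} ab) (Adj⇒~ {c} {d} cd)
        (λ (e , e') → ¬same (dec-injective e , dec-injective e')) (λ (e , e') → ¬flipped (dec-injective e , dec-injective e'))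
        .meet (onSegment s s∈ refl) (onSegment t t∈ eq)
    -- The vertex `v` is an end of its edge to `nb₀`. If it lay on an edge between other vertices,
    -- the two edges would meet in a point that is not a common end.
    off-edge : ∀ v a b → Adj G a b → v ≢ a → v ≢ b → ∀ s → InUnit s → lerp (pos (dec a)) (pos (dec b)) s ≢ pos (dec v)
    off-edge v a b ab v≢a v≢b s s∈ eq = on-edge (meet-edges (Adj⇒~ {a} {b} ab) (~nb₀ (dec v))
        (λ (e , _) → v≢a (≡-sym (dec-injective e))) (λ (_ , e) → v≢b (≡-sym (dec-injective e)))
        .meet (onSegment s s∈ refl) (onSegment ℚ.0ℚ (ℚ.≤-refl , ℚ.nonNegative⁻¹ ℚ.1ℚ) (trans eq (≡-sym (lerp-0 (pos (dec v)) (pos (nb₀ (dec v))))))))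
      where
      on-edge : (Σ V λ w → (w ≡ dec a ⊎ w ≡ dec b) × (w ≡ dec v ⊎ w ≡ nb₀ (dec v)) × lerp (pos (dec a)) (pos (dec b)) s ≡ pos w) → ⊥
      on-edge (w , w∈ab , _ , p≡w) with pos-injective (trans (≡-sym eq) p≡w)
      on-edge (w , inj₁ w≡a , _ , p≡w) | refl = v≢a (dec-injective w≡a)
      on-edge (w , inj₂ w≡b , _ , p≡w) | refl = v≢b (dec-injective w≡b)

  -- Reading indices modulo m turns the closing edge into an ordinary step.
  toClosed : ∀ {m} → HasCycle G m → Σ (ℕ → V) (Closed m)
  toClosed {m} (c , 3≤ , c-injective , c-step , c-close) = w , closed
    where
    instance
      length-nonZero : NonZero m
      length-nonZero = ℕ.>-nonZero (ℕ.≤-trans (s≤s z≤n) 3≤)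
    module R = Rotation m
    at : ℕ → Fin m
    at i = fromℕ< (m%n<n i m)
    toℕ-at : ∀ i → toℕ (at i) ≡ i % m
    toℕ-at i = Fin.toℕ-fromℕ< (m%n<n i m)
    w : ℕ → V
    w i = dec (c (at i))
    [1+i]%m : ∀ i → suc (i % m) % m ≡ suc i % m
    [1+i]%m i = subst₂ (λ z z' → z % m ≡ z' % m) (ℕ.+-comm (i % m) 1) (ℕ.+-comm i 1) (R.[m%P+t]%P≡[m+t]%P i 1)
    link : ∀ i → Adj G (c (at i)) (c (at (suc i)))
    link i with ℕ.m≤n⇒m<n∨m≡n (m%n<n i m)
    ... | inj₁ lt = c-step (at i) (at (suc i)) (trans (cong suc (toℕ-at i))
      (≡-sym (trans (toℕ-at (suc i)) (trans (≡-sym ([1+i]%m i)) (m<n⇒m%n≡m lt)))))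
    ... | inj₂ eq = c-close (at (suc i)) (at i) (trans (toℕ-at (suc i)) (trans (≡-sym ([1+i]%m i)) (trans (cong (_% m) eq) (n%n≡0 m))))
      (trans (cong suc (toℕ-at i)) eq)
    closed : Closed m w
    closed .3≤m = 3≤
    closed .adjacent i = Adj⇒~ {c (at i)} {c (at (suc i))} (link i)
    closed .periodic i = cong (dec ∘ c) (Fin.toℕ-injective (trans (toℕ-at (i + m)) (trans ([m+n]%n≡m%n i m) (≡-sym (toℕ-at i)))))
    closed .injective {i} {j} i<m j<m eq = begin
      i           ≡⟨ m<n⇒m%n≡m i<m ⟨
      i % m       ≡⟨ toℕ-at i ⟨
      toℕ (at i)  ≡⟨ cong toℕ (c-injective (dec-injective eq)) ⟩
      toℕ (at j)  ≡⟨ toℕ-at j ⟩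
      j % m       ≡⟨ m<n⇒m%n≡m j<m ⟩
      j           ∎
      where open ≡-Reasoning

  -- A pole ring, the witness for the circumference: every bone of one parity contributes both ends
  -- of its last pole rung.
  around : Fin P → ℕ → V
  around q zero          = vert q pole (rail lo top)
  around q (suc zero)    = vert q pole (rail up top)
  around q (suc (suc t)) = around (rot 2 q) t

  around-~ : ∀ q t → around q t ~ around q (suc t)
  around-~ q zero          = inj₁ (rung q pole top)
  around-~ q (suc zero)    = inj₁ (ring q pole)
  around-~ q (suc (suc t)) = around-~ (rot 2 q) t

  around-≡ : ∀ q t → around q t ≡ vert (rot (⌊ t /2⌋ * 2) q) pole (rail (odd t) top)
  around-≡ q zero          = cong (λ z → vert z pole (rail lo top)) (≡-sym (rot-0 q))
  around-≡ q (suc zero)    = cong (λ z → vert z pole (rail up top)) (≡-sym (rot-0 q))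
  around-≡ q (suc (suc t)) = trans (around-≡ (rot 2 q) t)
    (cong₂ (λ z s → vert z pole (rail s top)) (rot-rot (⌊ t /2⌋ * 2) 2 q) (≡-sym (Bool.not-involutive (odd t))))

  halves : ∀ t → t ≡ bit (odd t) + ⌊ t /2⌋ * 2
  halves zero          = refl
  halves (suc zero)    = refl
  halves (suc (suc t)) = trans (cong (2 +_) (halves t)) (trans (lemma (bit (odd t)) (⌊ t /2⌋ * 2))
    (cong (λ s → bit s + (2 + ⌊ t /2⌋ * 2)) (≡-sym (Bool.not-involutive (odd t)))))
    where
    lemma : ∀ b h → 2 + (b + h) ≡ b + (2 + h)
    lemma = solve-∀

  around-injective : ∀ q {t t'} → t < P → t' < P → around q t ≡ around q t' → t ≡ t'
  around-injective q {t} {t'} t<P t'<P eq = trans (halves t) (trans (cong₂ (λ s h → bit s + h) odd≡ half≡) (≡-sym (halves t')))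
    where
    eq' : vert (rot (⌊ t /2⌋ * 2) q) pole (rail (odd t) top) ≡ vert (rot (⌊ t' /2⌋ * 2) q) pole (rail (odd t') top)
    eq' = trans (≡-sym (around-≡ q t)) (trans eq (around-≡ q t'))
    bound : ∀ {t} → t < P → ⌊ t /2⌋ * 2 < P
    bound {t} t<P = ℕ.≤-<-trans (ℕ.≤-trans (ℕ.m≤n+m (⌊ t /2⌋ * 2) (bit (odd t))) (ℕ.≤-reflexive (≡-sym (halves t)))) t<P
    half≡ : ⌊ t /2⌋ * 2 ≡ ⌊ t' /2⌋ * 2
    half≡ = rot-<-injective q (bound t<P) (bound t'<P) (cong bone eq')
    side : Frag → Bool
    side apex       = lo
    side (rail s _) = s
    odd≡ : odd t ≡ odd t'
    odd≡ = cong (side ∘ frag) eq'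

  around-P : ∀ q → around q P ≡ around q 0
  around-P q = trans (around-≡ q P) (cong₂ (λ z s → vert z pole (rail s top))
    (trans (cong (λ z → rot z q) (≡-sym (trans (halves P) (cong (λ s → bit s + ⌊ P /2⌋ * 2) (odd-double n))))) (rot-P q)) (odd-double n))

  G-cycle : HasCycle G P
  G-cycle = enc ∘ around q₀ ∘ toℕ , ℕ.≤-trans (s≤s (s≤s (s≤s z≤n))) 5<P ,
    (λ {i} {j} eq → Fin.toℕ-injective (around-injective q₀ (Fin.toℕ<n i) (Fin.toℕ<n j)
      (trans (≡-sym (dec∘enc _)) (trans (cong dec eq) (dec∘enc _))))) ,
    (λ i j eq → ~⇒Adj (subst₂ _~_ (≡-sym (dec∘enc _)) (≡-sym (dec∘enc _)) (subst (λ z → around q₀ (toℕ i) ~ around q₀ z) eq (around-~ q₀ (toℕ i))))) ,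
    (λ i j i≡0 1+j≡P → ~⇒Adj (subst₂ _~_ (≡-sym (dec∘enc _)) (≡-sym (dec∘enc _))
      (subst (around q₀ (toℕ j) ~_) (trans (cong (around q₀) 1+j≡P) (trans (around-P q₀) (cong (around q₀) (≡-sym i≡0)))) (around-~ q₀ (toℕ j)))))
    where
    q₀ : Fin P
    q₀ = fromℕ< (ℕ.≤-trans (s≤s z≤n) 5<P)

  G-gap : ∀ m → 1 + 2 * K < m → m < (5 + κ + κ) * 2 → m < n * 2 → ¬ (m ∈𝒞 G)
  G-gap m lt lt' lt'' has with w , c ← toClosed has = cycle-gap c lt lt' lt''

theorem2 : ∀ (k : ℕ) → 2 ≤ k →
    Σ ℕ λ n → Σ (Graph n) λ G →
    ThreeConnected G × Cubic G × Planar G ×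
    CircumferenceAtLeast G (2 * k) ×
    (∀ m → 2 * k ≤ m → m ≤ 4 * k + 1 → ¬ (m ∈𝒞 G))
theorem2 (suc (suc κ)) (s≤s (s≤s z≤n)) =
  N , G , G-threeConnected , G-cubic , G-planar ,
  (P , ℕ.*-monoʳ-≤ 2 (ℕ.≤-trans (ℕ.m≤m+n k (k + 0)) (ℕ.n≤1+n (2 * k))) , G-cycle) ,
  λ m 2k≤m m≤4k+1 → G-gap m
    (ℕ.≤-trans (ℕ.≤-reflexive (short κ)) 2k≤m)
    (ℕ.<-≤-trans (s≤s m≤4k+1) (ℕ.≤-reflexive (long κ)))
    (ℕ.<-≤-trans (s≤s m≤4k+1) (ℕ.≤-reflexive (rings κ)))
  where
  k : ℕ
  k = 2 + κ
  2<1+2k : 2 < suc (2 * k)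
  2<1+2k = s≤s (ℕ.≤-trans (s≤s (s≤s z≤n)) (ℕ.m≤m+n k (k + 0)))
  -- For n = 2k + 1 the bounds for spokes and for rings both equal 4k + 2, and a cycle within a
  -- fragment has length at most 2k - 1; what lies between is the required gap.
  open BoneGraph κ (suc (2 * k)) 2<1+2k
  open Bones κ (suc (2 * k)) 2<1+2k using (P)
  short : ∀ κ → suc (1 + 2 * suc κ) ≡ 2 * (2 + κ)
  short = solve-∀
  long : ∀ κ → suc (4 * (2 + κ) + 1) ≡ (5 + κ + κ) * 2
  long = solve-∀
  rings : ∀ κ → suc (4 * (2 + κ) + 1) ≡ suc (2 * (2 + κ)) * 2
  rings = solve-∀
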